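{- Let $m>0$ and $0<i<k$ be integers. If $\Delta_i^p\,\mathbf{\Delta}\,\mathrm{DIFF}_m(\Sigma_k^p) = \Sigma_i^p\,\mathbf{\Delta}\,\mathrm{DIFF}_m(\Sigma_k^p)$, then $\mathrm{DIFF}_m(\Sigma_k^p) = \mathrm{coDIFF}_m(\Sigma_k^p)$.
   Context: Polynomial hierarchy: $\Sigma_0^p=\mathrm{P}$, $\Sigma_1^p=\mathrm{NP}$, $\Sigma_k^p=\mathrm{NP}^{\Sigma_{k-1}^p}$ for $k>1$; $\Delta_k^p = \mathrm{P}^{\Sigma_{k-1}^p}$ for $k\ge 1$. For sets $C,D$, $C\Delta D=(C-D)\cup(D-C)$, and for classes $\mathcal{C},\mathcal{D}$, $\mathcal{C}\,\mathbf{\Delta}\,\mathcal{D}=\{L\mid(\exists C\in\mathcal{C})(\exists D\in\mathcal{D})[L=C\Delta D]\}$. Boolean hierarchy over a class $\mathcal{C}$: $\mathrm{DIFF}_1(\mathcal{C})=\mathcal{C}$; for $j\ge1$, $\mathrm{DIFF}_{j+1}(\mathcal{C})=\{L\mid (\exists L_1\in\mathcal{C})(\exists L_2\in\mathrm{DIFF}_j(\mathcal{C}))[L=L_1-L_2]\}$; $\mathrm{coDIFF}_j(\mathcal{C})=\{L\mid \overline{L}\in\mathrm{DIFF}_j(\mathcal{C})\}$. -}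

module Defs where

open import Data.Nat using (ℕ; zero; suc; _+_; _^_; _<_)
open import Data.Fin using (Fin; zero; suc)
open import Data.Bool using (Bool; true; false; _∧_; not; _xor_)
open import Data.List using (List; []; _∷_; map; reverse; length)
open import Data.Maybe using (Maybe; just; nothing; Is-just)
open import Data.Product using (Σ; ∃; _×_; _,_)
open import Relation.Binary.PropositionalEquality using (_≡_)

Language : Set
Language = List Bool → Bool

Class : Set₁
Class = Language → Set

infix 4 _≐_
_≐_ : Class → Class → Set
C ≐ D = (L : Language) → (C L → D L) × (D L → C L)

-- Oracle Turing machines (single work tape + write-only query tape).
-- Tape symbols: Fin (3 + Γ); zero = blank, 1 = bit 0, 2 = bit 1,
-- the remaining Γ symbols are auxiliary.
-- Nondeterminism: the transition takes one choice bit per step.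
-- A deterministic machine is run with all choice bits fixed to false.

data Move : Set where
  left right stay : Move

module _ (Q Γ : ℕ) where
  Sym : Set
  Sym = Fin (3 + Γ)

  data Action : Set where
    accept reject : Action
    -- ordinary step: new state, symbol written, head move,
    -- and optionally a bit appended to the query tape
    step : Fin Q → Sym → Move → Maybe Bool → Action
    -- query the oracle about the content of the query tape; go to the
    -- first state if the answer is yes, the second if no; the query tape
    -- is erased.
    ask  : Fin Q → Fin Q → Action

record OTM : Set where
  field
    Q     : ℕ
    Γ     : ℕ
    start : Fin Q
    δ     : Fin Q → Sym Q Γ → Bool → Action Q Γ

record Config (M : OTM) : Set where
  constructor cfg
  open OTM M
  field
    state : Fin Q
    lft   : List (Sym Q Γ)   -- cells left of head, nearest first
    rgt   : List (Sym Q Γ)   -- head cell and cells to its right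
    qry   : List Bool        -- query tape, stored reversed

module Ops (M : OTM) where
  open OTM M
  blank : Sym Q Γ
  blank = zero

  bitSym : Bool → Sym Q Γ
  bitSym false = suc zero
  bitSym true  = suc (suc zero)

  readHead : List (Sym Q Γ) → Sym Q Γ
  readHead []      = blank
  readHead (s ∷ _) = s

  writeHead : Sym Q Γ → List (Sym Q Γ) → List (Sym Q Γ)
  writeHead s []      = s ∷ []
  writeHead s (_ ∷ r) = s ∷ r

  moveHead : Move → List (Sym Q Γ) → List (Sym Q Γ)
           → Σ (List (Sym Q Γ)) (λ _ → List (Sym Q Γ))
  moveHead left  []      r       = [] , blank ∷ r
  moveHead left  (a ∷ l) r       = l , a ∷ r
  moveHead right l       []      = blank ∷ l , []
  moveHead right l       (a ∷ r) = a ∷ l , r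
  moveHead stay  l       r       = l , r

  appendQ : Maybe Bool → List Bool → List Bool
  appendQ nothing  q = q
  appendQ (just b) q = b ∷ q

initConfig : (M : OTM) → List Bool → Config M
initConfig M x = cfg (OTM.start M) [] (map (Ops.bitSym M) x) []

run : Language → (M : OTM) → ℕ → (ℕ → Bool) → Config M → Maybe Bool
run A M zero    ch c = nothing
run A M (suc t) ch (cfg q l r w) with OTM.δ M q (Ops.readHead M r) (ch 0)
... | accept = just true
... | reject = just false
... | step q' s mv b with Ops.moveHead M mv l (Ops.writeHead M s r)
...   | (l' , r') = run A M t (λ n → ch (suc n)) (cfg q' l' r' (Ops.appendQ M b w))
run A M (suc t) ch (cfg q l r w) | ask qy qn with A (reverse w)
... | true  = run A M t (λ n → ch (suc n)) (cfg qy l r [])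
... | false = run A M t (λ n → ch (suc n)) (cfg qn l r [])

bound : ℕ → List Bool → ℕ
bound c x = length x ^ c + c

Prel : Language → Class
Prel A L = Σ OTM λ M → Σ ℕ λ c →
  (x : List Bool) → run A M (bound c x) (λ _ → false) (initConfig M x) ≡ just (L x)

NPrel : Language → Class
NPrel A L = Σ OTM λ M → Σ ℕ λ c →
  ((x : List Bool) (ch : ℕ → Bool) → Is-just (run A M (bound c x) ch (initConfig M x)))
  × ((x : List Bool) →
       (L x ≡ true → ∃ λ ch → run A M (bound c x) ch (initConfig M x) ≡ just true)
     × ((∃ λ ch → run A M (bound c x) ch (initConfig M x) ≡ just true) → L x ≡ true))

-- the empty oracle (machines relative to it are unrelativized machines)
∅ : Language
∅ _ = false

P : Class
P = Prel ∅

NP : Class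
NP = NPrel ∅

P^ : Class → Class
P^ C L = Σ Language λ A → C A × Prel A L

NP^ : Class → Class
NP^ C L = Σ Language λ A → C A × NPrel A L

Σp : ℕ → Class
Σp zero          = P
Σp (suc zero)    = NP
Σp (suc (suc k)) = NP^ (Σp (suc k))

-- Δ_k = P^{Σ_{k-1}} for k ≥ 1 (Δ_0 := P, unused)
Δp : ℕ → Class
Δp zero    = P
Δp (suc k) = P^ (Σp k)

infixl 6 _𝚫_
_𝚫_ : Class → Class → Class
(C 𝚫 D) L = Σ Language λ A → Σ Language λ B →
  C A × D B × ((x : List Bool) → L x ≡ (A x xor B x))

-- DIFF_0 := {∅} (unused; the paper only uses j ≥ 1)
DIFF : ℕ → Class → Class
DIFF zero          C L = (x : List Bool) → L x ≡ false
DIFF (suc zero)    C L = C L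
DIFF (suc (suc j)) C L = Σ Language λ L₁ → Σ Language λ L₂ →
  C L₁ × DIFF (suc j) C L₂ × ((x : List Bool) → L x ≡ (L₁ x ∧ not (L₂ x)))

coDIFF : ℕ → Class → Class
coDIFF j C L = DIFF j C (λ x → not (L x))

{-# OPTIONS --safe #-}
module Submission where

-- Let L be the language to complement and z an input. L is a chain of
-- differences of languages accepted by towers of oracle machines; let U ∈ Σ_i
-- be the (joined) oracle at level i, U q = ∃u R⟨q,u⟩, and let T⟨q,u⟩ say that
-- the reversal of u begins a witness for q. The hypothesis applied to
-- T(w) xor L(z) gives A ∈ Δ_i and B ∈ DIFF_m with
--   T w xor L z = A⟨w,z⟩ xor B⟨w,z⟩.
-- If A(⟨·,z⟩) is right about T on all relevant w, then it can replace U, which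
-- lowers the towers by one level and puts z ∈ L into Δ_k. Otherwise every w
-- with A⟨w,z⟩ ≠ T w satisfies B⟨w,z⟩ = ¬ L z. By self-reducibility of T the
-- case distinction is a Σ_i property of z: A is right everywhere unless it is
-- locally inconsistent, A⟨⟨q,u⟩,z⟩ ≠ A⟨⟨q,0u⟩,z⟩ ∨ A⟨⟨q,1u⟩,z⟩ for some q, u.
-- The advice is the input itself, so no complete sets are needed.
--
-- Polynomial time is handled through a function algebra in the style of Cobham,
-- equivalent to the oracle machines.

open import Defs
open import Data.Bool using (Bool; true; false; _∧_; _∨_; not; _xor_; if_then_else_)
open import Data.Bool.Properties using (∧-comm; ∨-identityʳ; not-involutive)
open import Data.Empty using (⊥-elim)
open import Data.Fin using (Fin; zero; suc; toℕ; _↑ˡ_; _↑ʳ_; splitAt; combine; remQuot; #_)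
open import Data.Fin.Properties using (toℕ<n; splitAt-join; remQuot-combine)
open import Data.List using (List; []; _∷_; map; reverse; length; take; drop; head; _++_; replicate; _ʳ++_)
open import Data.List.Properties
  using (length-take; take-all; length-replicate; length-++; length-reverse; length-map; length-drop; length-ʳ++;
         reverse-involutive; ++-identityʳ; ++-assoc)
open import Data.Maybe using (Maybe; just; nothing; Is-just)
open import Data.Maybe.Properties using (just-injective)
open import Data.Maybe.Relation.Unary.Any using () renaming (just to any-just)
open import Data.Nat using (ℕ; zero; suc; _+_; _*_; _^_; _∸_; _≤_; _<_; z≤n; s≤s; _⊔_; _≡ᵇ_)
open import Data.Nat.Properties
open import Data.Nat.Tactic.RingSolver using (solve-∀)
open import Data.Product using (Σ; ∃; _×_; _,_; proj₁; proj₂)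
open import Data.Sum using (_⊎_; inj₁; inj₂; [_,_]′)
open import Data.Unit using (⊤; tt)
open import Data.Vec as Vec using (Vec; []; _∷_; lookup)
open import Data.Vec.Properties using (lookup-splitAt; lookup-map; lookup-++ʳ)
open import Function using (_∘_; id)
open import Relation.Nullary using (yes; no)
open import Relation.Binary.PropositionalEquality

-- A function algebra for polynomial time

-- The arguments w and z of `T w xor L z` are independent: with z fixed, a single w on which A errs
-- reveals L z through B. Asking directly whether such a w exists would compare A with T under a
-- quantifier, a question of level i + 1, and for k = i + 1 its negation need not be in Σ_k.
-- Inconsistency refers only to A and to the relation R, both in Δ_i, so it is in Σ_i, and it and
-- its negation are both in Δ_k. A second obstacle is that the erring w must be guessed, whereas for
-- m > 1 the difference classes are not known to be closed under existential quantification. But all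
-- erring w give the same value of B, and under that promise the quantifier can be moved into the
-- sets of the chain one at a time. Without complete sets, oracles are merged by marked unions, and
-- the lengths of queries have to be tracked: a computation on x does not notice changes of its
-- oracle beyond a polynomial length, so consistency of A is tested only up to such a length.

Str : Set
Str = List Bool

isTrue isJust : Maybe Bool → Bool
isTrue (just b) = b
isTrue nothing = false
isJust (just _) = true
isJust nothing = false

isT : Str → Bool
isT v = isTrue (head v)

-- In place of Cobham's side condition, a loop truncates its accumulators to
-- the length of bnd; mul replaces the smash function.
data Exp : ℕ → Set where
  var  : ∀ {n} → Fin n → Exp n
  nil  : ∀ {n} → Exp n
  cons : ∀ {n} → Bool → Exp n → Exp n
  tl   : ∀ {n} → Exp n → Exp n
  cond : ∀ {n} → (Maybe Bool → Bool) → Exp n → Exp n → Exp n → Exp n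
  orc  : ∀ {n} → Exp n → Exp n
  mul  : ∀ {n} → Exp n → Exp n → Exp n
  comp : ∀ {n m} → Exp m → Vec (Exp n) m → Exp n
  loop : ∀ {n m} (count bnd : Exp n) → Vec (Exp n) m → Vec (Exp (n + m)) m → Fin m → Exp n

iter : {X : Set} → ℕ → (X → X) → X → X
iter zero    f a = a
iter (suc t) f a = iter t f (f a)

tail : Str → Str
tail = drop 1

mutual
  eval : ∀ {n} → Language → Exp n → Vec Str n → Str
  eval A (var i) env = lookup env i
  eval A nil env = []
  eval A (cons b e) env = b ∷ eval A e env
  eval A (tl e) env = tail (eval A e env)
  eval A (cond φ e a b) env = if φ (head (eval A e env)) then eval A a env else eval A b env
  eval A (orc e) env = A (eval A e env) ∷ []
  eval A (mul a b) env = replicate (length (eval A a env) * length (eval A b env)) true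
  eval A (comp f es) env = eval A f (evals A es env)
  eval A (loop c d is bs j) env =
    lookup (iter (length (eval A c env))
                 (λ a → Vec.map (take (length (eval A d env))) (evals A bs (env Vec.++ a)))
                 (evals A is env)) j

  evals : ∀ {n m} → Language → Vec (Exp n) m → Vec Str n → Vec Str m
  evals A [] env = []
  evals A (e ∷ es) env = eval A e env ∷ evals A es env

-- A common bound for the number of instructions and the lengths of all
-- intermediate values, given the bound n for the lengths of the inputs.
mutual
  cost : ∀ {n} → Exp n → ℕ → ℕ
  cost (var i) n = 1 + n
  cost nil n = 1
  cost (cons b e) n = 1 + cost e n
  cost (tl e) n = 1 + cost e n
  cost (cond φ e a b) n = 1 + (cost e n + (cost a n + cost b n))
  cost (orc e) n = 3 + cost e n
  cost (mul a b) n = 5 + (cost a n + cost b n + cost a n * (5 + 3 * cost b n))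
  cost (comp f es) n = 1 + (costs es n + cost f (costs es n))
  cost (loop c d is bs j) n =
    2 + (r + costs is n + cost c n * (3 + (2 * m + costs bs r)))
    where r = n + (cost c n + cost d n) + costs is n
          m = Vec.length is

  costs : ∀ {n m} → Vec (Exp n) m → ℕ → ℕ
  costs [] n = 1
  costs (e ∷ es) n = cost e n + costs es n

Bounded : ∀ {m} → Vec Str m → ℕ → Set
Bounded env n = ∀ i → length (lookup env i) ≤ n

++-Bounded : ∀ {n m} (env : Vec Str n) (a : Vec Str m) {k} → Bounded env k → Bounded a k →
  Bounded (env Vec.++ a) k
++-Bounded {n} env a p q i rewrite lookup-splitAt n env a i with splitAt n i
... | inj₁ j = p j
... | inj₂ j = q j

iter-inv : {X : Set} (P : X → Set) (f : X → X) → (∀ a → P a → P (f a)) → ∀ t a → P a → P (iter t f a)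
iter-inv P f h zero a p = p
iter-inv P f h (suc t) a p = iter-inv P f h t (f a) (h a p)

length-take≤ : ∀ {a} {X : Set a} n (xs : List X) → length (take n xs) ≤ n
length-take≤ n xs rewrite length-take n xs = m⊓n≤m n _

length-tail≤ : ∀ (v : Str) → length (tail v) ≤ length v
length-tail≤ [] = z≤n
length-tail≤ (_ ∷ v) = n≤1+n _

map-take-Bounded : ∀ {m} d (v : Vec Str m) → Bounded (Vec.map (take d) v) d
map-take-Bounded d v i rewrite lookup-map i (take d) v = length-take≤ d _

Bounded-mono : ∀ {m} (v : Vec Str m) {a b} → a ≤ b → Bounded v a → Bounded v b
Bounded-mono v h p i = ≤-trans (p i) h

-- Makes the charge for a loop, which multiplies the cost of the body by that of the counter, cover
-- at least one execution of the body.
1≤cost : ∀ {n} (e : Exp n) k → 1 ≤ cost e k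
1≤cost (var i) k = s≤s z≤n
1≤cost nil k = s≤s z≤n
1≤cost (cons b e) k = s≤s z≤n
1≤cost (tl e) k = s≤s z≤n
1≤cost (cond φ e a b) k = s≤s z≤n
1≤cost (orc e) k = s≤s z≤n
1≤cost (mul a b) k = s≤s z≤n
1≤cost (comp f es) k = s≤s z≤n
1≤cost (loop c d is bs j) k = s≤s z≤n

mutual
  length-eval : ∀ {n} A (e : Exp n) (env : Vec Str n) k → Bounded env k → length (eval A e env) ≤ cost e k
  length-eval A (var i) env k p = m≤n⇒m≤1+n (p i)
  length-eval A nil env k p = z≤n
  length-eval A (cons b e) env k p = s≤s (length-eval A e env k p)
  length-eval A (tl e) env k p = m≤n⇒m≤1+n (≤-trans (length-tail≤ (eval A e env)) (length-eval A e env k p))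
  length-eval A (cond φ e a b) env k p with φ (head (eval A e env))
  ... | true = m≤n⇒m≤1+n (≤-trans (length-eval A a env k p) (m≤n⇒m≤o+n (cost e k) (m≤m+n _ _)))
  ... | false = m≤n⇒m≤1+n (≤-trans (length-eval A b env k p) (m≤n⇒m≤o+n (cost e k) (m≤n+m _ _)))
  length-eval A (orc e) env k p = s≤s z≤n
  length-eval A (mul a b) env k p rewrite length-replicate (length (eval A a env) * length (eval A b env)) {true} =
    m≤n⇒m≤o+n 5 (m≤n⇒m≤o+n (cost a k + cost b k)
      (*-mono-≤ (length-eval A a env k p)
        (m≤n⇒m≤o+n 5 (≤-trans (length-eval A b env k p) (m≤m+n (cost b k) _)))))
  length-eval A (comp f es) env k p =
    m≤n⇒m≤1+n (m≤n⇒m≤o+n (costs es k) (length-eval A f (evals A es env) (costs es k) (evals-Bounded A es env k p)))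
  length-eval A (loop c d is bs j) env k p =
    m≤n⇒m≤o+n 2 (≤-trans (accs-Bounded A c d is bs env k p (length (eval A c env)) j)
      (≤-trans (m≤n+m (cost d k + costs is k) (k + cost c k))
        (≤-trans (≤-reflexive (lem k (cost c k) (cost d k) (costs is k)))
          (≤-trans (m≤m+n _ (costs is k)) (m≤m+n _ _)))))
    where
    lem : ∀ a b c d → (a + b) + (c + d) ≡ a + (b + c) + d
    lem a b c d = trans (sym (+-assoc (a + b) c d)) (cong (_+ d) (+-assoc a b c))

  -- The bound is independent of the number t of passes: every pass truncates to the value of `d`,
  -- and only the initial values, bounded by `costs is k`, escape truncation. Hence the body can be
  -- charged at one fixed size, which keeps `cost` polynomial.
  accs-Bounded : ∀ {n m} A (c d : Exp n) (is : Vec (Exp n) m) (bs : Vec (Exp (n + m)) m) env k → Bounded env k → ∀ t →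
    Bounded (iter t (λ a → Vec.map (take (length (eval A d env))) (evals A bs (env Vec.++ a))) (evals A is env))
            (cost d k + costs is k)
  accs-Bounded A c d is bs env k p t =
    iter-inv (λ a → Bounded a (cost d k + costs is k)) _
      (λ a _ → Bounded-mono (Vec.map _ (evals A bs (env Vec.++ a))) (≤-trans (length-eval A d env k p) (m≤m+n _ _)) (map-take-Bounded _ (evals A bs (env Vec.++ a))))
      t (evals A is env) (Bounded-mono (evals A is env) (m≤n+m _ (cost d k)) (evals-Bounded A is env k p))

  evals-Bounded : ∀ {n m} A (es : Vec (Exp n) m) (env : Vec Str n) k → Bounded env k → Bounded (evals A es env) (costs es k)
  evals-Bounded A (e ∷ es) env k p zero = ≤-trans (length-eval A e env k p) (m≤m+n _ _)
  evals-Bounded A (e ∷ es) env k p (suc i) = ≤-trans (evals-Bounded A es env k p i) (m≤n+m _ _)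

-- The base `2 + n` is at least 2 even for n = 0, so a single power absorbs constants, and one more
-- factor absorbs a sum of two powers.
PolyBounded : (ℕ → ℕ) → Set
PolyBounded f = ∃ λ d → ∀ n → f n ≤ (2 + n) ^ d

^-mono-exp : ∀ n {a b} → a ≤ b → (2 + n) ^ a ≤ (2 + n) ^ b
^-mono-exp n = ^-monoʳ-≤ (2 + n)

n<2^n : ∀ n → n ≤ 2 ^ n
n<2^n zero = z≤n
n<2^n (suc n) = ≤-trans (+-mono-≤ (m^n>0 2 n) (n<2^n n)) (+-monoʳ-≤ (2 ^ n) (m≤m+n (2 ^ n) 0))

opaque
  poly-const : ∀ c → PolyBounded (λ _ → c)
  poly-const c = c , λ n → ≤-trans (n<2^n c) (^-monoˡ-≤ c (m≤m+n 2 n))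

  poly-id : PolyBounded id
  poly-id = 1 , λ n → ≤-trans (m≤n+m n 2) (m≤m*n (2 + n) 1)

double≤ : ∀ n d → (2 + n) ^ d + (2 + n) ^ d ≤ (2 + n) ^ suc d
double≤ n d = +-monoʳ-≤ ((2 + n) ^ d) (m≤m+n _ _)

opaque
  poly-+ : ∀ {f g} → PolyBounded f → PolyBounded g → PolyBounded (λ n → f n + g n)
  poly-+ (a , p) (b , q) = suc (a + b) , λ n →
    ≤-trans (+-mono-≤ (≤-trans (p n) (^-mono-exp n (m≤m+n a b))) (≤-trans (q n) (^-mono-exp n (m≤n+m b a))))
            (double≤ n (a + b))

  poly-* : ∀ {f g} → PolyBounded f → PolyBounded g → PolyBounded (λ n → f n * g n)
  poly-* (a , p) (b , q) = a + b , λ n →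
    ≤-trans (*-mono-≤ (p n) (q n)) (≤-reflexive (sym (^-distribˡ-+-* (2 + n) a b)))

  poly-∘ : ∀ {f g} → PolyBounded f → PolyBounded g → PolyBounded (λ n → f (g n))
  poly-∘ {f} {g} (a , p) (b , q) with poly-+ (poly-const 2) (b , q)
  ... | d , h = d * a , λ n → ≤-trans (p (g n)) (≤-trans (^-monoˡ-≤ a (h n)) (≤-reflexive (^-*-assoc (2 + n) d a)))

mutual
  cost-poly : ∀ {n} (e : Exp n) → PolyBounded (cost e)
  cost-poly (var i) = poly-+ (poly-const 1) poly-id
  cost-poly nil = poly-const 1
  cost-poly (cons b e) = poly-+ (poly-const 1) (cost-poly e)
  cost-poly (tl e) = poly-+ (poly-const 1) (cost-poly e)
  cost-poly (cond φ e a b) = poly-+ (poly-const 1) (poly-+ (cost-poly e) (poly-+ (cost-poly a) (cost-poly b)))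
  cost-poly (orc e) = poly-+ (poly-const 3) (cost-poly e)
  cost-poly (mul a b) = poly-+ (poly-const 5) (poly-+ (poly-+ (cost-poly a) (cost-poly b))
    (poly-* (cost-poly a) (poly-+ (poly-const 5) (poly-* (poly-const 3) (cost-poly b)))))
  cost-poly (comp f es) = poly-+ (poly-const 1) (poly-+ (costs-poly es) (poly-∘ (cost-poly f) (costs-poly es)))
  cost-poly (loop c d is bs j) =
    poly-+ (poly-const 2) (poly-+ (poly-+ r (costs-poly is))
      (poly-* (cost-poly c) (poly-+ (poly-const 3) (poly-+ (poly-const (2 * Vec.length is)) (poly-∘ (costs-poly bs) r)))))
    where r = poly-+ (poly-+ poly-id (poly-+ (cost-poly c) (cost-poly d))) (costs-poly is)

  costs-poly : ∀ {n m} (es : Vec (Exp n) m) → PolyBounded (costs es)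
  costs-poly [] = poly-const 1
  costs-poly (e ∷ es) = poly-+ (cost-poly e) (costs-poly es)

iter-cong : {X : Set} (P : X → Set) {f g : X → X} → (∀ a → P a → f a ≡ g a × P (f a)) → ∀ t {a} → P a → iter t f a ≡ iter t g a
iter-cong P h zero p = refl
iter-cong P {f} {g} h (suc t) {a} p with h a p
... | eq , p' = trans (iter-cong P h t p') (cong (iter t g) eq)

loop-parts : ∀ k c d i {X} → let B = k + (c + d) + i + i + X in c ≤ B × d ≤ B × i ≤ B
loop-parts k c d i {X} = ≤-trans (≤-trans (m≤m+n c d) (m≤n+m _ k)) r≤ , ≤-trans (≤-trans (m≤n+m d c) (m≤n+m _ k)) r≤ ,
                         ≤-trans (m≤n+m i _) (m≤m+n _ X)
  where
  r≤ : k + (c + d) ≤ k + (c + d) + i + i + X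
  r≤ = ≤-trans (≤-trans (m≤m+n _ i) (m≤m+n _ i)) (m≤m+n _ X)

mutual
  -- Every query is itself an intermediate value, hence no longer than the cost. This is what allows
  -- an oracle to be replaced by one that is right only on short strings.
  eval-local : ∀ {n} {A A' : Language} (e : Exp n) (env : Vec Str n) k → Bounded env k →
    (∀ q → length q ≤ cost e k → A q ≡ A' q) → eval A e env ≡ eval A' e env
  eval-local (var i) env k p h = refl
  eval-local nil env k p h = refl
  eval-local (cons b e) env k p h = cong (b ∷_) (eval-local e env k p λ q l → h q (m≤n⇒m≤1+n l))
  eval-local (tl e) env k p h = cong tail (eval-local e env k p λ q l → h q (m≤n⇒m≤1+n l))
  eval-local {A = A} {A'} (cond φ e a b) env k p h
    rewrite eval-local {A = A} {A'} e env k p (λ q l → h q (m≤n⇒m≤1+n (≤-trans l (m≤m+n _ _))))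
    with φ (head (eval A' e env))
  ... | true = eval-local a env k p λ q l → h q (m≤n⇒m≤1+n (≤-trans l (m≤n⇒m≤o+n (cost e k) (m≤m+n _ _))))
  ... | false = eval-local b env k p λ q l → h q (m≤n⇒m≤1+n (≤-trans l (m≤n⇒m≤o+n (cost e k) (m≤n+m _ _))))
  eval-local {A = A} {A'} (orc e) env k p h
    rewrite eval-local {A = A} {A'} e env k p (λ q l → h q (m≤n⇒m≤o+n 3 l))
    = cong (_∷ []) (h _ (m≤n⇒m≤o+n 3 (length-eval A' e env k p)))
  eval-local {A = A} {A'} (mul a b) env k p h =
    cong₂ (λ x y → replicate (length x * length y) true)
      (eval-local a env k p λ q l → h q (m≤n⇒m≤o+n 5 (≤-trans l (≤-trans (m≤m+n _ (cost b k)) (m≤m+n _ _)))))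
      (eval-local b env k p λ q l → h q (m≤n⇒m≤o+n 5 (≤-trans l (≤-trans (m≤n+m _ (cost a k)) (m≤m+n _ _)))))
  eval-local {A = A} {A'} (comp f es) env k p h
    rewrite evals-local {A = A} {A'} es env k p (λ q l → h q (m≤n⇒m≤1+n (≤-trans l (m≤m+n _ _))))
    = eval-local f (evals A' es env) (costs es k) (evals-Bounded A' es env k p) λ q l → h q (m≤n⇒m≤1+n (m≤n⇒m≤o+n (costs es k) l))
  eval-local {A = A} {A'} (loop {n} {m} c d is bs j) env k p h
    rewrite eval-local {A = A} {A'} c env k p (λ q l → h q (m≤n⇒m≤o+n 2 (≤-trans l (proj₁ (loop-parts k (cost c k) (cost d k) (costs is k))))))
          | eval-local {A = A} {A'} d env k p (λ q l → h q (m≤n⇒m≤o+n 2 (≤-trans l (proj₁ (proj₂ (loop-parts k (cost c k) (cost d k) (costs is k)))))))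
          | evals-local {A = A} {A'} is env k p (λ q l → h q (m≤n⇒m≤o+n 2 (≤-trans l (proj₂ (proj₂ (loop-parts k (cost c k) (cost d k) (costs is k)))))))
    = cong (λ v → lookup v j)
        (iter-cong (λ a → Bounded a (cost d k + costs is k))
          (λ a q → cong (Vec.map (take D)) (bodies a q) ,
             Bounded-mono (Vec.map (take D) (evals A bs (env Vec.++ a))) (≤-trans (length-eval A' d env k p) (m≤m+n _ _)) (map-take-Bounded D (evals A bs (env Vec.++ a))))
          (length (eval A' c env)) (Bounded-mono (evals A' is env) (m≤n+m _ (cost d k)) (evals-Bounded A' is env k p)))
    where
    D = length (eval A' d env)
    r = k + (cost c k + cost d k) + costs is k
    1≤c : 1 ≤ cost c k
    1≤c = 1≤cost c k
    b≤ : costs bs r ≤ r + costs is k + cost c k * (3 + (2 * Vec.length is + costs bs r))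
    b≤ = ≤-trans (≤-trans (m≤n⇒m≤o+n 3 (m≤n+m (costs bs r) (2 * m))) (≤-trans (≤-reflexive (sym (+-identityʳ _))) (*-monoˡ-≤ (3 + (2 * m + costs bs r)) 1≤c)))
           (m≤n+m _ (r + costs is k))
    bodies : ∀ a → Bounded a (cost d k + costs is k) → evals A bs (env Vec.++ a) ≡ evals A' bs (env Vec.++ a)
    bodies a q = evals-local bs (env Vec.++ a) r
      (++-Bounded env a (Bounded-mono env (≤-trans (m≤m+n k _) (m≤m+n _ _)) p)
         (Bounded-mono a (+-monoˡ-≤ (costs is k) (≤-trans (m≤n+m _ (cost c k)) (m≤n+m _ k))) q))
      λ s l → h s (m≤n⇒m≤o+n 2 (≤-trans l b≤))

  evals-local : ∀ {n m} {A A' : Language} (es : Vec (Exp n) m) (env : Vec Str n) k → Bounded env k →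
    (∀ q → length q ≤ costs es k → A q ≡ A' q) → evals A es env ≡ evals A' es env
  evals-local [] env k p h = refl
  evals-local (e ∷ es) env k p h =
    cong₂ _∷_ (eval-local e env k p λ q l → h q (≤-trans l (m≤m+n _ _)))
              (evals-local es env k p λ q l → h q (≤-trans l (m≤n+m _ _)))

-- Register programs

data Prim : Set where
  cp  : (src dst : ℕ) → Prim
  tr  : (len dst : ℕ) → Prim
  psh : Bool → ℕ → Prim
  pop : ℕ → Prim
  clr : ℕ → Prim

infixr 5 _⨾_
-- `flip` branches on the choice bit. The relation `Exec` has no rule for it: it describes
-- deterministic runs, and the only nondeterministic program, `guess`, is treated on the machine
-- itself in `guess-Ev`.
data Prog : Set where
  skip  : Prog
  prim  : Prim → Prog
  _⨾_   : Prog → Prog → Prog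
  br    : ℕ → (Maybe Bool → Bool) → Prog → Prog → Prog
  while : ℕ → Prog → Prog
  ask   : ℕ → Prog → Prog → Prog
  flip  : Prog → Prog → Prog

State : Set
State = ℕ → Str

upd : ℕ → Str → State → State
upd d v σ j = if j ≡ᵇ d then v else σ j

upd-same : ∀ d v σ → upd d v σ d ≡ v
upd-same zero v σ = refl
upd-same (suc d) v σ = upd-same d v (σ ∘ suc)

upd-other : ∀ j d v σ → j ≢ d → upd d v σ j ≡ σ j
upd-other zero zero v σ h = ⊥-elim (h refl)
upd-other zero (suc d) v σ h = refl
upd-other (suc j) zero v σ h = refl
upd-other (suc j) (suc d) v σ h = upd-other j d v (σ ∘ suc) (h ∘ cong suc)

exec : Prim → State → State
exec (cp a d) σ = upd d (σ a) σ
exec (tr a d) σ = upd d (take (length (σ a)) (σ d)) σ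
exec (psh b d) σ = upd d (b ∷ σ d) σ
exec (pop d) σ = upd d (tail (σ d)) σ
exec (clr d) σ = upd d [] σ

Short : ℕ → State → Set
Short S σ = ∀ j → length (σ j) ≤ S

Short-upd : ∀ {S} d {v σ} → length v ≤ S → Short S σ → Short S (upd d v σ)
Short-upd d {v} {σ} l h j with j ≡ᵇ d
... | true = l
... | false = h j

-- The last index bounds the number of executed instructions, and S the
-- length of every register along the way.
data Exec (A : Language) (S : ℕ) : Prog → State → State → ℕ → Set where
  eskip   : ∀ {σ} → Exec A S skip σ σ 1
  eprim   : ∀ {π σ} → Short S σ → Exec A S (prim π) σ (exec π σ) 1
  eseq    : ∀ {p q σ σ₁ σ₂ k l} → Exec A S p σ σ₁ k → Exec A S q σ₁ σ₂ l → Exec A S (p ⨾ q) σ σ₂ (k + l)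
  ebr     : ∀ {r φ p q σ σ' k} → Exec A S (if φ (head (σ r)) then p else q) σ σ' k → Exec A S (br r φ p q) σ σ' (1 + k)
  ewhile0 : ∀ {r p σ} → σ r ≡ [] → Exec A S (while r p) σ σ 1
  ewhile+ : ∀ {r p σ σ₁ σ₂ b v k l} → σ r ≡ b ∷ v → Exec A S p σ σ₁ k → Exec A S (while r p) σ₁ σ₂ l →
            Exec A S (while r p) σ σ₂ (1 + (k + l))
  eask    : ∀ {r p q σ σ' k} → Short S σ → Exec A S (if A (σ r) then p else q) σ σ' k → Exec A S (ask r p q) σ σ' (1 + k)
  eweak   : ∀ {p σ σ' k l} → k ≤ l → Exec A S p σ σ' k → Exec A S p σ σ' l

-- A loop computes its new accumulators in fresh registers, because each body may still read all the
-- old ones. Only afterwards are they copied back, and the truncation is done on the copies.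
truncBack : ℕ → ℕ → ℕ → ℕ → Prog
truncBack zero d s t = skip
truncBack (suc m) d s t = prim (cp s t) ⨾ prim (tr d t) ⨾ truncBack m d (suc s) (suc t)

loopEnv : ∀ n m → (Fin n → ℕ) → ℕ → Fin (n + m) → ℕ
loopEnv n m ρ b i = [ ρ , (λ j → b + toℕ j) ]′ (splitAt n i)

mutual
  -- Variable i lives in register `ρ i` below `b`, the result is left in register `b`, and
  -- everything above is scratch space. Registers below `b` are preserved (field `keep` of `Post`),
  -- so subexpressions can be compiled one after another at increasing `b`.
  compile : ∀ {n} → Exp n → (Fin n → ℕ) → ℕ → Prog
  compile (var i) ρ b = prim (cp (ρ i) b)
  compile nil ρ b = prim (clr b)
  compile (cons x e) ρ b = compile e ρ b ⨾ prim (psh x b)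
  compile (tl e) ρ b = compile e ρ b ⨾ prim (pop b)
  compile (cond φ e x y) ρ b = compile e ρ b ⨾ br b φ (compile x ρ b) (compile y ρ b)
  compile (orc e) ρ b =
    compile e ρ b ⨾ ask b (prim (clr b) ⨾ prim (psh true b)) (prim (clr b) ⨾ prim (psh false b))
  compile (mul x y) ρ b = compile x ρ b ⨾ compile y ρ (1 + b) ⨾ prim (clr (2 + b)) ⨾ mulLoop b ⨾ prim (cp (2 + b) b)
  compile (comp {m = m} f es) ρ b =
    compiles es ρ b ⨾ compile f (λ i → b + toℕ i) (b + m) ⨾ prim (cp (b + m) b)
  compile (loop {n} {m} c d is bs j) ρ b =
    compile c ρ b ⨾ compile d ρ (1 + b) ⨾ compiles is ρ (2 + b) ⨾
    while b (prim (pop b) ⨾ compiles bs (loopEnv n m ρ (2 + b)) (2 + b + m) ⨾ truncBack m (1 + b) (2 + b + m) (2 + b)) ⨾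
    prim (cp (2 + b + toℕ j) b)

  compiles : ∀ {n m} → Vec (Exp n) m → (Fin n → ℕ) → ℕ → Prog
  compiles [] ρ b = skip
  compiles (e ∷ es) ρ b = compile e ρ b ⨾ compiles es ρ (1 + b)

  mulLoop : ℕ → Prog
  mulLoop b = while b (prim (pop b) ⨾ prim (cp (1 + b) (3 + b)) ⨾ addLoop b)

  addLoop : ℕ → Prog
  addLoop b = while (3 + b) (prim (pop (3 + b)) ⨾ prim (psh true (2 + b)))

module _ (A : Language) (S : ℕ) where

  record Post (p : Prog) (b : ℕ) (σ : State) (k : ℕ) (R : State → Set) : Set where
    constructor post
    field
      σ'    : State
      runs  : Exec A S p σ σ' k
      keep  : ∀ j → j < b → σ' j ≡ σ j
      short : Short S σ'
      rel   : R σ'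

  Holds : ℕ → Str → State → Set
  Holds b v σ = σ b ≡ v

  HoldsAll : ∀ {m} → ℕ → Vec Str m → State → Set
  HoldsAll b vs σ = ∀ i → σ (b + toℕ i) ≡ lookup vs i

  infixr 4 _>>_
  _>>_ : ∀ {p q b b' σ k l R R'} → Post p b σ k R →
    ((σ₁ : State) → (∀ j → j < b → σ₁ j ≡ σ j) → Short S σ₁ → R σ₁ → b' ≤ b × Post q b' σ₁ l R') →
    Post (p ⨾ q) b' σ (k + l) R'
  post σ₁ x kp sh r >> f with f σ₁ kp sh r
  ... | b'≤b , post σ₂ y kp' sh' r' =
    post σ₂ (eseq x y) (λ j l → trans (kp' j l) (kp j (≤-trans l b'≤b))) sh' r'

  weaken : ∀ {p b σ k l R} → k ≤ l → Post p b σ k R → Post p b σ l R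
  weaken h (post σ' x kp sh r) = post σ' (eweak h x) kp sh r

  primPost : ∀ π d v {σ} → exec π σ ≡ upd d v σ → length v ≤ S → Short S σ →
    Post (prim π) d σ 1 (λ σ' → σ' ≡ upd d v σ)
  primPost π d v {σ} eq l sh = post (exec π σ) (eprim sh)
    (λ j j<d → trans (cong (λ f → f j) eq) (upd-other j d v σ (<⇒≢ j<d)))
    (subst (Short S) (sym eq) (Short-upd d {v} {σ} l sh)) eq

  relax : ∀ {p b σ k} {R R' : State → Set} → (∀ σ' → R σ' → R' σ') → Post p b σ k R → Post p b σ k R'
  relax f (post σ' x kp sh r) = post σ' x kp sh (f σ' r)

  prim-holds : ∀ π d v {σ} → exec π σ ≡ upd d v σ → length v ≤ S → Short S σ → Post (prim π) d σ 1 (Holds d v)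
  prim-holds π d v {σ} eq l sh = relax (λ { σ' refl → upd-same d v σ }) (primPost π d v eq l sh)

  addLoop-post : ∀ b ys t σ → σ (3 + b) ≡ ys → σ (2 + b) ≡ replicate t true → length ys + t ≤ S → Short S σ →
    Post (addLoop b) (2 + b) σ (1 + length ys * 3) (Holds (2 + b) (replicate (length ys + t) true))
  addLoop-post b [] t σ e₁ e₂ l sh = post σ (ewhile0 e₁) (λ _ _ → refl) sh e₂
  addLoop-post b (y ∷ ys) t σ e₁ e₂ l sh = post (σ' IH) (ewhile+ e₁ (eseq (eprim sh) (eprim sh₁)) (runs IH))
      (λ j h → trans (keep IH j h) (trans (upd-other j (2 + b) (true ∷ σ₁ (2 + b)) σ₁ (<⇒≢ h)) (upd-other j (3 + b) (tail (σ (3 + b))) σ (<⇒≢ (m<n⇒m<1+n h)))))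
      (short IH) (trans (rel IH) (cong (λ n → replicate n true) (+-suc (length ys) t)))
    where
    open Post
    σ₁ = upd (3 + b) (tail (σ (3 + b))) σ
    sh₁ : Short S σ₁
    sh₁ = Short-upd (3 + b) {tail (σ (3 + b))} {σ} (≤-trans (length-tail≤ (σ _)) (sh (3 + b))) sh
    σ₂ = upd (2 + b) (true ∷ σ₁ (2 + b)) σ₁
    e₂' : true ∷ σ₁ (2 + b) ≡ replicate (suc t) true
    e₂' = cong (true ∷_) (trans (upd-other (2 + b) (3 + b) _ σ (<⇒≢ ≤-refl)) e₂)
    IH = addLoop-post b ys (suc t) σ₂
          (trans (upd-other (3 + b) (2 + b) _ σ₁ (>⇒≢ ≤-refl)) (trans (upd-same (3 + b) _ σ) (cong tail e₁)))
          (trans (upd-same (2 + b) _ σ₁) e₂')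
          (≤-trans (≤-reflexive (+-suc (length ys) t)) l)
          (Short-upd (2 + b) {_} {σ₁} (≤-trans (≤-reflexive (trans (cong length e₂') (length-replicate (suc t)))) (≤-trans (m≤n+m (suc t) (length ys))
            (≤-trans (≤-reflexive (+-suc (length ys) t)) l))) sh₁)

  mulLoop-post : ∀ b xs ys t σ → σ b ≡ xs → σ (1 + b) ≡ ys → σ (2 + b) ≡ replicate t true →
    length xs * length ys + t ≤ S → Short S σ →
    Post (mulLoop b) b σ (1 + length xs * (4 + length ys * 3)) (Holds (2 + b) (replicate (length xs * length ys + t) true))
  mulLoop-post b [] ys t σ e₀ e₁ e₂ l sh = post σ (ewhile0 e₀) (λ _ _ → refl) sh e₂
  mulLoop-post b (x ∷ xs) ys t σ e₀ e₁ e₂ l sh =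
    post (σ' IH₂) (eweak (≤-reflexive arith)
        (ewhile+ e₀ (eseq (eprim sh) (eseq (eprim sh₁) (runs IH))) (runs IH₂)))
      (λ j h → trans (keep IH₂ j h) (trans (low j (m<n⇒m<1+n (m<n⇒m<1+n h))) (upd-other j b (tail (σ b)) σ (<⇒≢ h))))
      (short IH₂) (trans (rel IH₂) (cong (λ n → replicate n true) comm))
    where
    open Post
    σ₁ = upd b (tail (σ b)) σ
    sh₁ : Short S σ₁
    sh₁ = Short-upd b {tail (σ b)} {σ} (≤-trans (length-tail≤ (σ _)) (sh b)) sh
    σ₂ = upd (3 + b) (σ₁ (1 + b)) σ₁
    e₁' : σ₁ (1 + b) ≡ ys
    e₁' = trans (upd-other (1 + b) b _ σ (>⇒≢ ≤-refl)) e₁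
    comm : length xs * length ys + (length ys + t) ≡ length ys + length xs * length ys + t
    comm = trans (sym (+-assoc (length xs * length ys) (length ys) t)) (cong (_+ t) (+-comm (length xs * length ys) (length ys)))
    IH = addLoop-post b ys t σ₂ (trans (upd-same (3 + b) _ σ₁) e₁')
          (trans (upd-other (2 + b) (3 + b) _ σ₁ (<⇒≢ ≤-refl))
            (trans (upd-other (2 + b) b _ σ (>⇒≢ (m<n⇒m<1+n ≤-refl))) e₂))
          (≤-trans (m≤n+m _ (length xs * length ys)) (≤-trans (≤-reflexive comm) l))
          (Short-upd (3 + b) {_} {σ₁} (sh₁ (1 + b)) sh₁)
    low : ∀ j → j < 2 + b → σ' IH j ≡ σ₁ j
    low j h = trans (keep IH j h) (upd-other j (3 + b) _ σ₁ (<⇒≢ (m<n⇒m<1+n h)))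
    IH₂ = mulLoop-post b xs ys (length ys + t) (σ' IH)
          (trans (low b (m<n⇒m<1+n ≤-refl)) (trans (upd-same b _ σ) (cong tail e₀)))
          (trans (low (1 + b) ≤-refl) e₁') (rel IH) (≤-trans (≤-reflexive comm) l) (short IH)
    L = length ys * 3
    X = length xs * (4 + L)
    arith : 1 + (1 + (1 + (1 + L)) + (1 + X)) ≡ 1 + (4 + L + X)
    arith = cong (4 +_) (+-suc L X)

  -- `t + m ≤ s` keeps source and target blocks apart, so no value is overwritten before it is
  -- copied; `d < t` protects the register that gives the bound.
  truncBack-post : ∀ m (vs : Vec Str m) d s t σ → d < t → t + m ≤ s → HoldsAll s vs σ → Short S σ →
    Post (truncBack m d s t) t σ (1 + m * 2) (HoldsAll t (Vec.map (take (length (σ d))) vs))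
  truncBack-post zero [] d s t σ d<t h hs sh = post σ eskip (λ _ _ → refl) sh (λ ())
  truncBack-post (suc m) (v ∷ vs) d s t σ d<t h hs sh =
    post (σ' IH) (eweak (≤-reflexive (+-suc 2 (m * 2))) (eseq (eprim sh) (eseq (eprim sh₁) (runs IH))))
      (λ j l → trans (keep IH j (m<n⇒m<1+n l)) (low j (<⇒≢ l)))
      (short IH)
      λ { zero → trans (cong (σ' IH) (+-identityʳ t)) (trans (keep IH t ≤-refl) (trans (upd-same t _ σ₁) (cong₂ (λ x → take (length x))
               (upd-other d t _ σ (<⇒≢ d<t))
               (trans (upd-same t _ σ) (trans (cong σ (sym (+-identityʳ s))) (hs zero))))))
        ; (suc i) → trans (cong (σ' IH) (+-suc t (toℕ i)))
              (trans (rel IH i) (cong (λ x → lookup (Vec.map (take (length x)) vs) i) (low d (<⇒≢ d<t)))) }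
    where
    open Post
    σ₁ = upd t (σ s) σ
    sh₁ : Short S σ₁
    sh₁ = Short-upd t {σ s} {σ} (sh s) sh
    σ₂ = upd t (take (length (σ₁ d)) (σ₁ t)) σ₁
    low : ∀ j → j ≢ t → σ₂ j ≡ σ j
    low j l = trans (upd-other j t _ σ₁ l) (upd-other j t _ σ l)
    t<s : suc t ≤ s
    t<s = ≤-trans (s≤s (m≤m+n t m)) (≤-trans (≤-reflexive (sym (+-suc t m))) h)
    IH = truncBack-post m vs d (suc s) (suc t) σ₂ (m<n⇒m<1+n d<t) (s≤s (≤-trans (+-monoʳ-≤ t (n≤1+n m)) h))
          (λ i → trans (low (suc s + toℕ i) (>⇒≢ (s≤s (≤-trans (<⇒≤ t<s) (m≤m+n s (toℕ i))))))
                   (trans (cong σ (sym (+-suc s (toℕ i)))) (hs (suc i))))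
          (Short-upd t {_} {σ₁} (≤-trans (length-take≤ (length (σ₁ d)) (σ₁ t)) (sh₁ d)) sh₁)

  loopEnv-lookup : ∀ {n m} (ρ : Fin n → ℕ) b (env : Vec Str n) (a : Vec Str m) σ →
    (∀ i → σ (ρ i) ≡ lookup env i) → HoldsAll b a σ → ∀ i → σ (loopEnv n m ρ b i) ≡ lookup (env Vec.++ a) i
  loopEnv-lookup {n} ρ b env a σ h h' i rewrite lookup-splitAt n env a i with splitAt n i
  ... | inj₁ j = h j
  ... | inj₂ j = h' j

  loopEnv-< : ∀ {n m} (ρ : Fin n → ℕ) b → (∀ i → ρ i < b) → ∀ i → loopEnv n m ρ b i < b + m
  loopEnv-< {n} {m} ρ b h i with splitAt n i
  ... | inj₁ j = ≤-trans (h j) (m≤m+n b m)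
  ... | inj₂ j = +-monoʳ-< b (toℕ<n j)

  mutual
    compile-post : ∀ {n} (e : Exp n) ρ b (env : Vec Str n) k σ → (∀ i → ρ i < b) → (∀ i → σ (ρ i) ≡ lookup env i) →
      Bounded env k → cost e k ≤ S → Short S σ → Post (compile e ρ b) b σ (cost e k) (Holds b (eval A e env))
    compile-post (var i) ρ b env k σ lt h bd l sh =
      weaken (s≤s z≤n) (relax (λ σ' eq → trans eq (h i)) (prim-holds (cp (ρ i) b) b (σ (ρ i)) refl (sh (ρ i)) sh))
    compile-post nil ρ b env k σ lt h bd l sh = prim-holds (clr b) b [] refl z≤n sh
    compile-post (cons x e) ρ b env k σ lt h bd l sh =
      weaken (≤-reflexive (+-comm (cost e k) 1))
      (compile-post e ρ b env k σ lt h bd (<⇒≤ l) sh >> λ σ₁ kp sh₁ r →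
         ≤-refl , prim-holds (psh x b) b _ (cong (λ v → upd b (x ∷ v) σ₁) r)
                    (≤-trans (s≤s (length-eval A e env k bd)) l) sh₁)
    compile-post (tl e) ρ b env k σ lt h bd l sh =
      weaken (≤-reflexive (+-comm (cost e k) 1))
      (compile-post e ρ b env k σ lt h bd (<⇒≤ l) sh >> λ σ₁ kp sh₁ r →
         ≤-refl , prim-holds (pop b) b _ (cong (λ v → upd b (tail v) σ₁) r)
                    (≤-trans (length-tail≤ (eval A e env)) (≤-trans (length-eval A e env k bd) (<⇒≤ l))) sh₁)
    compile-post (cond φ e x y) ρ b env k σ lt h bd l sh =
      weaken (≤-reflexive (+-suc (cost e k) (cost x k + cost y k)))
      (compile-post e ρ b env k σ lt h bd (≤-trans (m≤m+n _ _) (<⇒≤ l)) sh >> λ σ₁ kp sh₁ r →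
         ≤-refl , branch σ₁ kp sh₁ r)
      where
      branch : ∀ σ₁ → (∀ j → j < b → σ₁ j ≡ σ j) → Short S σ₁ → Holds b (eval A e env) σ₁ →
        Post (br b φ (compile x ρ b) (compile y ρ b)) b σ₁ (1 + (cost x k + cost y k)) (Holds b (eval A (cond φ e x y) env))
      branch σ₁ kp sh₁ r =
        let post σ' ex kp' sh' r' = chosen (φ (head (eval A e env)))
        in post σ' (ebr (subst (λ v → Exec A S (if φ (head v) then _ else _) σ₁ σ' _) (sym r) ex)) kp' sh' r'
        where
        chosen : ∀ t → Post (if t then compile x ρ b else compile y ρ b) b σ₁ (cost x k + cost y k)
                         (Holds b (if t then eval A x env else eval A y env))
        chosen true = weaken (m≤m+n _ (cost y k)) (compile-post x ρ b env k σ₁ lt (λ i → trans (kp (ρ i) (lt i)) (h i)) bd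
          (≤-trans (≤-trans (m≤m+n _ (cost y k)) (m≤n+m _ (cost e k))) (<⇒≤ l)) sh₁)
        chosen false = weaken (m≤n+m _ (cost x k)) (compile-post y ρ b env k σ₁ lt (λ i → trans (kp (ρ i) (lt i)) (h i)) bd
          (≤-trans (≤-trans (m≤n+m _ (cost x k)) (m≤n+m _ (cost e k))) (<⇒≤ l)) sh₁)
    compile-post (orc e) ρ b env k σ lt h bd l sh =
      weaken (≤-reflexive (+-comm (cost e k) 3))
      (compile-post e ρ b env k σ lt h bd (m+n≤o⇒n≤o 3 l) sh >> λ σ₁ kp sh₁ r →
         ≤-refl , branch σ₁ sh₁ r)
      where
      answer : ∀ a σ₁ → Short S σ₁ → Post (prim (clr b) ⨾ prim (psh a b)) b σ₁ 2 (Holds b (a ∷ []))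
      answer a σ₁ sh₁ = prim-holds (clr b) b [] refl z≤n sh₁ >> λ σ₂ kp sh₂ r →
        ≤-refl , prim-holds (psh a b) b (a ∷ []) (cong (λ v → upd b (a ∷ v) σ₂) r) (≤-trans (s≤s z≤n) l) sh₂
      branch : ∀ σ₁ → Short S σ₁ → Holds b (eval A e env) σ₁ →
        Post (ask b (prim (clr b) ⨾ prim (psh true b)) (prim (clr b) ⨾ prim (psh false b))) b σ₁ 3
             (Holds b (A (eval A e env) ∷ []))
      branch σ₁ sh₁ r =
        let post σ' ex kp' sh' r' = chosen (A (eval A e env))
        in post σ' (eask sh₁ (subst (λ v → Exec A S (if A v then _ else _) σ₁ σ' _) (sym r) ex)) kp' sh' r'
        where
        chosen : ∀ t → Post (if t then prim (clr b) ⨾ prim (psh true b) else prim (clr b) ⨾ prim (psh false b)) b σ₁ 2 (Holds b (t ∷ []))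
        chosen true = answer true σ₁ sh₁
        chosen false = answer false σ₁ sh₁
    compile-post (mul x y) ρ b env k σ lt h bd l sh =
      weaken arith
      (compile-post x ρ b env k σ lt h bd cx≤ sh >> λ σ₁ kp₁ sh₁ r₁ → ≤-refl ,
       (compile-post y ρ (1 + b) env k σ₁ (λ i → m<n⇒m<1+n (lt i)) (λ i → trans (kp₁ (ρ i) (lt i)) (h i)) bd cy≤ sh₁
         >> λ σ₂ kp₂ sh₂ r₂ → n≤1+n b ,
       (prim-holds (clr (2 + b)) (2 + b) [] refl z≤n sh₂
         >> λ σ₃ kp₃ sh₃ r₃ → m≤n+m b 2 ,
       (mulLoop-post b X Y 0 σ₃ (trans (kp₃ b (m<n⇒m<1+n ≤-refl)) (trans (kp₂ b ≤-refl) r₁))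
           (trans (kp₃ (1 + b) ≤-refl) r₂) r₃
           (≤-trans (≤-reflexive (+-identityʳ _)) (≤-trans xy≤ l)) sh₃
         >> λ σ₄ kp₄ sh₄ r₄ → ≤-refl ,
       relax (λ σ' eq → trans eq (trans r₄ (cong (λ n → replicate n true) (+-identityʳ _))))
         (prim-holds (cp (2 + b) b) b (σ₄ (2 + b)) refl (sh₄ (2 + b)) sh₄)))))
      where
      X = eval A x env
      Y = eval A y env
      cx = cost x k
      cy = cost y k
      lX : length X ≤ cx
      lX = length-eval A x env k bd
      lY : length Y ≤ cy
      lY = length-eval A y env k bd
      xy≤ : length X * length Y ≤ cost (mul x y) k
      xy≤ = ≤-trans (≤-reflexive (sym (length-replicate (length X * length Y)))) (length-eval A (mul x y) env k bd)
      cx≤ : cx ≤ S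
      cx≤ = ≤-trans (≤-trans (m≤m+n cx cy) (≤-trans (m≤m+n _ _) (m≤n+m _ 5))) l
      cy≤ : cy ≤ S
      cy≤ = ≤-trans (≤-trans (m≤n+m cy cx) (≤-trans (m≤m+n _ _) (m≤n+m _ 5))) l
      regroup : ∀ a b m → a + (b + (1 + (1 + m + 1))) ≡ 3 + (a + b + m)
      regroup = solve-∀
      arith : cx + (cy + (1 + (1 + length X * (4 + length Y * 3) + 1))) ≤ cost (mul x y) k
      arith = ≤-trans (≤-reflexive (regroup cx cy (length X * (4 + length Y * 3))))
        (+-mono-≤ (m≤m+n 3 2) (+-monoʳ-≤ (cx + cy) (*-mono-≤ lX (+-mono-≤ (m≤m+n 4 1)
          (≤-trans (≤-reflexive (*-comm (length Y) 3)) (*-monoʳ-≤ 3 lY))))))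
    compile-post (comp {m = m} f es) ρ b env k σ lt h bd l sh =
      weaken (≤-reflexive (regroup (costs es k) (cost f (costs es k))))
      (compiles-post es ρ b env k σ lt h bd (≤-trans (m≤m+n _ _) (<⇒≤ l)) sh >> λ σ₁ kp₁ sh₁ r₁ → ≤-refl ,
       (compile-post f (λ i → b + toℕ i) (b + m) (evals A es env) (costs es k) σ₁ (λ i → +-monoʳ-< b (toℕ<n i)) r₁
           (evals-Bounded A es env k bd) (≤-trans (m≤n+m _ _) (<⇒≤ l)) sh₁ >> λ σ₂ kp₂ sh₂ r₂ → m≤m+n b m ,
       relax (λ σ' eq → trans eq r₂) (prim-holds (cp (b + m) b) b (σ₂ (b + m)) refl (sh₂ (b + m)) sh₂)))
      where
      regroup : ∀ a b → a + (b + 1) ≡ 1 + (a + b)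
      regroup = solve-∀
    compile-post (loop {n} {m} c d is bs j) ρ b env k σ lt h bd l sh =
      weaken arith
      (compile-post c ρ b env k σ lt h bd (≤-trans (m≤n⇒m≤o+n 2 (proj₁ parts)) l) sh >> λ σ₁ kp₁ sh₁ r₁ → ≤-refl ,
       (compile-post d ρ (1 + b) env k σ₁ (λ i → m<n⇒m<1+n (lt i)) (λ i → trans (kp₁ (ρ i) (lt i)) (h i)) bd
           (≤-trans (m≤n⇒m≤o+n 2 (proj₁ (proj₂ parts))) l) sh₁ >> λ σ₂ kp₂ sh₂ r₂ → n≤1+n b ,
       (compiles-post is ρ (2 + b) env k σ₂ lt₂
           (λ i → trans (kp₂ (ρ i) (m<n⇒m<1+n (lt i))) (trans (kp₁ (ρ i) (lt i)) (h i))) bd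
           (≤-trans (m≤n⇒m≤o+n 2 (proj₂ (proj₂ parts))) l) sh₂ >> λ σ₃ kp₃ sh₃ r₃ → m≤n+m b 2 ,
       (iterate-post (eval A c env) (evals A is env) σ₃
           (trans (kp₃ b (m<n⇒m<1+n ≤-refl)) (trans (kp₂ b ≤-refl) r₁))
           (trans (kp₃ (1 + b) ≤-refl) r₂)
           (λ i → trans (kp₃ (ρ i) (lt₂ i)) (trans (kp₂ (ρ i) (m<n⇒m<1+n (lt i))) (trans (kp₁ (ρ i) (lt i)) (h i))))
           r₃ (Bounded-mono (evals A is env) (m≤n+m _ (cost d k)) (evals-Bounded A is env k bd)) sh₃
         >> λ σ₄ kp₄ sh₄ r₄ → ≤-refl ,
       relax (λ σ' eq → trans eq (r₄ j))
         (prim-holds (cp (2 + b + toℕ j) b) b (σ₄ (2 + b + toℕ j)) refl (sh₄ (2 + b + toℕ j)) sh₄)))))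
      where
      parts = loop-parts k (cost c k) (cost d k) (costs is k)
      lt₂ : ∀ i → ρ i < 2 + b
      lt₂ i = m<n⇒m<1+n (m<n⇒m<1+n (lt i))
      r = k + (cost c k + cost d k) + costs is k
      D = length (eval A d env)
      F : Vec Str m → Vec Str m
      F a = Vec.map (take D) (evals A bs (env Vec.++ a))
      per = 3 + (2 * m + costs bs r)
      b≤ : costs bs r ≤ S
      b≤ = ≤-trans (≤-trans (≤-trans (m≤n⇒m≤o+n 3 (m≤n+m (costs bs r) (2 * m)))
             (≤-trans (≤-reflexive (sym (+-identityʳ _))) (*-monoˡ-≤ per (1≤cost c k))))
             (m≤n⇒m≤o+n 2 (m≤n+m _ (r + costs is k)))) l
      iterate-post : ∀ cs a σ → σ b ≡ cs → σ (1 + b) ≡ eval A d env → (∀ i → σ (ρ i) ≡ lookup env i) →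
        HoldsAll (2 + b) a σ → Bounded a (cost d k + costs is k) → Short S σ →
        Post (while b (prim (pop b) ⨾ compiles bs (loopEnv n m ρ (2 + b)) (2 + b + m) ⨾ truncBack m (1 + b) (2 + b + m) (2 + b)))
          b σ (1 + length cs * per) (HoldsAll (2 + b) (iter (length cs) F a))
      iterate-post [] a σ e₀ e₁ he ha ba sh = post σ (ewhile0 e₀) (λ _ _ → refl) sh ha
      iterate-post (x ∷ cs) a σ e₀ e₁ he ha ba sh =
        post (σ' IH₃) (eweak (≤-reflexive (regroup m (costs bs r) (length cs * per)))
            (ewhile+ e₀ (eseq (eprim sh) (eseq (runs IH₁) (runs IH₂))) (runs IH₃)))
          (λ i q → trans (keep IH₃ i q) (trans (low i (m<n⇒m<1+n (m<n⇒m<1+n q))) (upd-other i b (tail (σ b)) σ (<⇒≢ q))))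
          (short IH₃) (rel IH₃)
        where
        open Post
        σ₁ = upd b (tail (σ b)) σ
        sh₁ : Short S σ₁
        sh₁ = Short-upd b {tail (σ b)} {σ} (≤-trans (length-tail≤ (σ b)) (sh b)) sh
        σ₁b : ∀ i → b < i → σ₁ i ≡ σ i
        σ₁b i q = upd-other i b (tail (σ b)) σ (>⇒≢ q)
        held : ∀ i → σ₁ (ρ i) ≡ lookup env i
        held i = trans (upd-other (ρ i) b (tail (σ b)) σ (<⇒≢ (lt i))) (he i)
        IH₁ = compiles-post bs (loopEnv n m ρ (2 + b)) (2 + b + m) (env Vec.++ a) r σ₁
               (loopEnv-< ρ (2 + b) lt₂)
               (loopEnv-lookup ρ (2 + b) env a σ₁ held
                  (λ i → trans (σ₁b (2 + b + toℕ i) (s≤s (≤-trans (m≤m+n b (toℕ i)) (n≤1+n _)))) (ha i)))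
               (++-Bounded env a (Bounded-mono env (≤-trans (m≤m+n k _) (m≤m+n _ _)) bd)
                 (Bounded-mono a (+-monoˡ-≤ (costs is k) (≤-trans (m≤n+m _ (cost c k)) (m≤n+m _ k))) ba))
               b≤ sh₁
        IH₂ = truncBack-post m (evals A bs (env Vec.++ a)) (1 + b) (2 + b + m) (2 + b) (σ' IH₁) ≤-refl ≤-refl (rel IH₁) (short IH₁)
        low : ∀ i → i < 2 + b → σ' IH₂ i ≡ σ₁ i
        low i q = trans (keep IH₂ i q) (keep IH₁ i (≤-trans q (m≤m+n _ m)))
        e₁' : σ₁ (1 + b) ≡ eval A d env
        e₁' = trans (σ₁b (1 + b) ≤-refl) e₁
        IH₃ = iterate-post cs (F a) (σ' IH₂)
               (trans (low b (m<n⇒m<1+n ≤-refl)) (trans (upd-same b (tail (σ b)) σ) (cong tail e₀)))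
               (trans (low (1 + b) ≤-refl) e₁')
               (λ i → trans (low (ρ i) (lt₂ i)) (held i))
               (λ i → trans (rel IH₂ i) (cong (λ v → lookup (Vec.map (take (length v)) (evals A bs (env Vec.++ a))) i)
                   (trans (keep IH₁ (1 + b) (s≤s (s≤s (m≤m+n b m)))) e₁')))
               (Bounded-mono (F a) (≤-trans (length-eval A d env k bd) (m≤m+n _ _)) (map-take-Bounded D (evals A bs (env Vec.++ a))))
               (short IH₂)
        regroup : ∀ m c q → 1 + (1 + (c + (1 + m * 2)) + (1 + q)) ≡ 1 + (3 + (2 * m + c) + q)
        regroup = solve-∀
      arith : cost c k + (cost d k + (costs is k + (1 + length (eval A c env) * per + 1))) ≤ cost (loop c d is bs j) k
      arith = ≤-trans (≤-reflexive (regroup (cost c k) (cost d k) (costs is k) (length (eval A c env) * per)))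
        (+-monoʳ-≤ 2 (+-mono-≤ (+-monoˡ-≤ (costs is k) (≤-trans (m≤n+m _ k) (m≤m+n _ (costs is k)))) (*-monoˡ-≤ per (length-eval A c env k bd))))
        where
        regroup : ∀ c d i q → c + (d + (i + (1 + q + 1))) ≡ 2 + (c + d + i + q)
        regroup = solve-∀

    compiles-post : ∀ {n m} (es : Vec (Exp n) m) ρ b (env : Vec Str n) k σ → (∀ i → ρ i < b) → (∀ i → σ (ρ i) ≡ lookup env i) →
      Bounded env k → costs es k ≤ S → Short S σ → Post (compiles es ρ b) b σ (costs es k) (HoldsAll b (evals A es env))
    compiles-post [] ρ b env k σ lt h bd l sh = post σ eskip (λ _ _ → refl) sh (λ ())
    compiles-post (e ∷ es) ρ b env k σ lt h bd l sh =
      let post σ₁ x kp₁ sh₁ r₁ = compile-post e ρ b env k σ lt h bd (≤-trans (m≤m+n _ _) l) sh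
          post σ₂ y kp₂ sh₂ r₂ = compiles-post es ρ (1 + b) env k σ₁ (λ i → m<n⇒m<1+n (lt i))
            (λ i → trans (kp₁ (ρ i) (lt i)) (h i)) bd (≤-trans (m≤n+m _ (cost e k)) l) sh₁
      in post σ₂ (eseq x y) (λ i q → trans (kp₂ i (m<n⇒m<1+n q)) (kp₁ i q)) sh₂
         λ { zero → trans (cong σ₂ (+-identityʳ b)) (trans (kp₂ b ≤-refl) r₁)
           ; (suc i) → trans (cong σ₂ (+-suc b (toℕ i))) (r₂ i) }

-- Register programs on a multi-track tape

record Finite (X : Set) : Set where
  field
    size    : ℕ
    enc     : X → Fin size
    dec     : Fin size → X
    dec-enc : ∀ x → dec (enc x) ≡ x
open Finite

retract-finite : {X Y : Set} (f : X → Y) (g : Y → X) → (∀ x → g (f x) ≡ x) → Finite Y → Finite X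
retract-finite f g h F .size = size F
retract-finite f g h F .enc x = enc F (f x)
retract-finite f g h F .dec i = g (dec F i)
retract-finite f g h F .dec-enc x = trans (cong g (dec-enc F (f x))) (h x)

⊤-finite : Finite ⊤
⊤-finite = record { size = 1 ; enc = λ _ → zero ; dec = λ _ → tt ; dec-enc = λ _ → refl }

⊎-finite : {X Y : Set} → Finite X → Finite Y → Finite (X ⊎ Y)
⊎-finite F G .size = size F + size G
⊎-finite F G .enc (inj₁ x) = enc F x ↑ˡ size G
⊎-finite F G .enc (inj₂ y) = size F ↑ʳ enc G y
⊎-finite F G .dec i = [ (λ x → inj₁ (dec F x)) , (λ y → inj₂ (dec G y)) ]′ (splitAt (size F) i)
⊎-finite F G .dec-enc (inj₁ x) rewrite splitAt-join (size F) (size G) (inj₁ (enc F x)) = cong inj₁ (dec-enc F x)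
⊎-finite F G .dec-enc (inj₂ y) rewrite splitAt-join (size F) (size G) (inj₂ (enc G y)) = cong inj₂ (dec-enc G y)

×-finite : {X Y : Set} → Finite X → Finite Y → Finite (X × Y)
×-finite F G .size = size F * size G
×-finite F G .enc (x , y) = combine (enc F x) (enc G y)
×-finite F G .dec i = let (a , b) = remQuot (size G) i in dec F a , dec G b
×-finite F G .dec-enc (x , y) =
  trans (cong (λ p → dec F (proj₁ p) , dec G (proj₂ p)) (remQuot-combine (enc F x) (enc G y)))
        (cong₂ _,_ (dec-enc F x) (dec-enc G y))

Bool-finite : Finite Bool
Bool-finite = retract-finite (λ b → if b then inj₁ tt else inj₂ tt) [ (λ _ → true) , (λ _ → false) ]′
  (λ { true → refl ; false → refl }) (⊎-finite ⊤-finite ⊤-finite)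

Maybe-finite : {X : Set} → Finite X → Finite (Maybe X)
Maybe-finite F = retract-finite (λ { nothing → inj₁ tt ; (just x) → inj₂ x }) [ (λ _ → nothing) , just ]′
  (λ { nothing → refl ; (just x) → refl }) (⊎-finite ⊤-finite F)

Vec-finite : {X : Set} → Finite X → ∀ n → Finite (Vec X n)
Vec-finite F zero = retract-finite (λ _ → tt) (λ _ → []) (λ { [] → refl }) ⊤-finite
Vec-finite F (suc n) = retract-finite (λ { (x ∷ v) → x , v }) (λ { (x , v) → x ∷ v }) (λ { (x ∷ v) → refl })
  (×-finite F (Vec-finite F n))

widthPrim : Prim → ℕ
widthPrim (cp a d) = suc a ⊔ suc d
widthPrim (tr a d) = suc a ⊔ suc d
widthPrim (psh b d) = suc d
widthPrim (pop d) = suc d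
widthPrim (clr d) = suc d

width : Prog → ℕ
width skip = 0
width (prim π) = widthPrim π
width (p ⨾ q) = width p ⊔ width q
width (br r φ p q) = suc r ⊔ (width p ⊔ width q)
width (while r p) = suc r ⊔ width p
width (ask r p q) = suc r ⊔ (width p ⊔ width q)
width (flip p q) = width p ⊔ width q

-- Evaluation of a machine over both values of each choice bit: comb is the
-- first projection for deterministic acceptance and a disjunction for
-- nondeterministic acceptance.
module Evaluation (comb : Maybe Bool → Maybe Bool → Maybe Bool) (A : Language) (M : OTM) where
  open OTM M
  open Ops M

  mutual
    ev : ℕ → Config M → Maybe Bool
    ev zero c = nothing
    ev (suc t) (cfg q l r w) = comb (act t (δ q (readHead r) false) l r w) (act t (δ q (readHead r) true) l r w)

    act : ℕ → Action Q Γ → List (Sym Q Γ) → List (Sym Q Γ) → Str → Maybe Bool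
    act t accept l r w = just true
    act t reject l r w = just false
    act t (step q s mv b) l r w =
      ev t (cfg q (proj₁ (moveHead mv l (writeHead s r))) (proj₂ (moveHead mv l (writeHead s r))) (appendQ b w))
    act t (ask qy qn) l r w = ev t (cfg (if A (reverse w) then qy else qn) l r [])

  Ev : ℕ → Config M → Bool → Set
  Ev N c v = ∀ t → N ≤ t → ev t c ≡ just v

  Ev-mono : ∀ {N N' c v} → N ≤ N' → Ev N c v → Ev N' c v
  Ev-mono h e t l = e t (≤-trans h l)

  infix 3 _↝[_]_
  -- Reachability in continuation form: every outcome of c' is an outcome of c at the price of k
  -- further steps. It composes by adding the prices, and it makes sense for branching evaluation
  -- too, since an idempotent `comb` ignores a choice bit that does not affect the step.
  _↝[_]_ : Config M → ℕ → Config M → Set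
  c ↝[ k ] c' = ∀ {N v} → Ev N c' v → Ev (k + N) c v

  ↝-trans : ∀ {c c' c'' k l} → c ↝[ k ] c' → c' ↝[ l ] c'' → c ↝[ k + l ] c''
  ↝-trans {k = k} {l} f g {N} e = Ev-mono (≤-reflexive (sym (+-assoc k l N))) (f (g e))

  ↝-weak : ∀ {c c' k l} → k ≤ l → c ↝[ k ] c' → c ↝[ l ] c'
  ↝-weak h f {N} e = Ev-mono (+-monoˡ-≤ N h) (f e)

-- Register r is track r: cell j holds the j-th letter of every register, and `nothing` past the end
-- of a register. A cell that is empty on all tracks therefore marks the end of all registers at
-- once.
module Tracks (N-1 : ℕ) where
  N : ℕ
  N = suc N-1

  Cell : Set
  Cell = Vec (Maybe Bool) N

  opaque
    Cell-finite : Finite Cell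
    Cell-finite = Vec-finite (Maybe-finite Bool-finite) N

  Γ : ℕ
  Γ = suc (size Cell-finite)

  Symbol : Set
  Symbol = Fin (3 + Γ)

  get : ∀ {n} → ℕ → Vec (Maybe Bool) n → Maybe Bool
  get _ [] = nothing
  get zero (x ∷ v) = x
  get (suc r) (x ∷ v) = get r v

  set : ∀ {n} → ℕ → Maybe Bool → Vec (Maybe Bool) n → Vec (Maybe Bool) n
  set _ y [] = []
  set zero y (x ∷ v) = y ∷ v
  set (suc r) y (x ∷ v) = x ∷ set r y v

  empty : ∀ {n} → Vec (Maybe Bool) n
  empty {n} = Vec.replicate n nothing

  isEmpty : ∀ {n} → Vec (Maybe Bool) n → Bool
  isEmpty [] = true
  isEmpty (x ∷ v) = not (isJust x) ∧ isEmpty v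

  isEmpty-sound : ∀ {n} (v : Vec (Maybe Bool) n) → isEmpty v ≡ true → v ≡ empty
  isEmpty-sound [] h = refl
  isEmpty-sound (nothing ∷ v) h = cong (nothing ∷_) (isEmpty-sound v h)

  isEmpty-empty : ∀ n → isEmpty (empty {n}) ≡ true
  isEmpty-empty zero = refl
  isEmpty-empty (suc n) = isEmpty-empty n

  get-empty : ∀ n r → get r (empty {n}) ≡ nothing
  get-empty zero r = refl
  get-empty (suc n) zero = refl
  get-empty (suc n) (suc r) = get-empty n r

  empty-ext : ∀ {n} (v : Vec (Maybe Bool) n) → (∀ r → r < n → get r v ≡ nothing) → v ≡ empty
  empty-ext [] h = refl
  empty-ext (x ∷ v) h = cong₂ _∷_ (h 0 (s≤s z≤n)) (empty-ext v λ r l → h (suc r) (s≤s l))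

  get-set : ∀ {n} r y (v : Vec (Maybe Bool) n) → r < n → get r (set r y v) ≡ y
  get-set zero y (x ∷ v) l = refl
  get-set (suc r) y (x ∷ v) (s≤s l) = get-set r y v l

  get-set-other : ∀ {n} r d y (v : Vec (Maybe Bool) n) → r ≢ d → get r (set d y v) ≡ get r v
  get-set-other r d y [] h = refl
  get-set-other zero zero y (x ∷ v) h = ⊥-elim (h refl)
  get-set-other zero (suc d) y (x ∷ v) h = refl
  get-set-other (suc r) zero y (x ∷ v) h = refl
  get-set-other (suc r) (suc d) y (x ∷ v) h = get-set-other r d y v (h ∘ cong suc)

  set-empty : ∀ n d → set d nothing (empty {n}) ≡ empty
  set-empty zero d = refl
  set-empty (suc n) zero = refl
  set-empty (suc n) (suc d) = cong (nothing ∷_) (set-empty n d)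

  set-get-empty : ∀ d → set d (get d (empty {N})) empty ≡ empty
  set-get-empty d = trans (cong (λ x → set d x empty) (get-empty N d)) (set-empty N d)

  -- The input symbols 1 and 2 are read as cells holding a bit on track 0;
  -- the symbol 3 marks the left end of the tape.
  cellOf : Symbol → Cell
  cellOf zero = empty
  cellOf (suc zero) = set 0 (just false) empty
  cellOf (suc (suc zero)) = set 0 (just true) empty
  cellOf (suc (suc (suc zero))) = empty
  cellOf (suc (suc (suc (suc i)))) = dec Cell-finite i

  symOf : Cell → Symbol
  symOf v = suc (suc (suc (suc (enc Cell-finite v))))

  marker : Symbol
  marker = suc (suc (suc zero))

  isMarker : Symbol → Bool
  isMarker (suc (suc (suc zero))) = true
  isMarker _ = false

  cellOf-symOf : ∀ v → cellOf (symOf v) ≡ v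
  cellOf-symOf v = dec-enc Cell-finite v

  -- A primitive instruction is one pass from the left marker to the first empty cell and back, with
  -- one letter carried in the state. A push hands the displaced letters on during the way right
  -- (`fR`), a pop during the way left (`fL`); `emit` copies a track to the query tape.
  record Sweep : Set where
    field
      carry  : Maybe Bool
      fR fL  : Maybe Bool → Cell → Maybe Bool × Cell
      emit   : Cell → Maybe Bool
  open Sweep

  pointwise : (Cell → Cell) → Sweep
  pointwise F = record { carry = nothing ; fR = λ c v → c , F v ; fL = _,_ ; emit = λ _ → nothing }

  shiftR shiftL : ℕ → Sweep
  shiftR d = record { carry = nothing ; fR = λ c v → get d v , set d c v ; fL = _,_ ; emit = λ _ → nothing }
  shiftL d = record { carry = nothing ; fR = _,_ ; fL = λ c v → get d v , set d c v ; emit = λ _ → nothing }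

  copyCell truncCell : ℕ → ℕ → Cell → Cell
  copyCell a d v = set d (get a v) v
  truncCell a d v = set d (if isJust (get a v) then get d v else nothing) v

  sweepOf : Prim → Sweep
  sweepOf (cp a d) = pointwise (copyCell a d)
  sweepOf (tr a d) = pointwise (truncCell a d)
  sweepOf (psh b d) = record (shiftR d) { carry = just b }
  sweepOf (pop d) = shiftL d
  sweepOf (clr d) = pointwise (set d nothing)

  emitSweep : ℕ → Sweep
  emitSweep r = record (pointwise id) { emit = get r }

  data SweepState : Set where
    go  : SweepState
    goR goL : Maybe Bool → SweepState

  SweepState-finite : Finite SweepState
  SweepState-finite = retract-finite
    (λ { go → inj₁ tt ; (goR c) → inj₂ (inj₁ c) ; (goL c) → inj₂ (inj₂ c) })
    [ (λ _ → go) , [ goR , goL ]′ ]′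
    (λ { go → refl ; (goR c) → refl ; (goL c) → refl })
    (⊎-finite ⊤-finite (⊎-finite (Maybe-finite Bool-finite) (Maybe-finite Bool-finite)))

  St : Prog → Set
  St skip = ⊤
  St (prim π) = SweepState
  St (p ⨾ q) = St p ⊎ St q
  St (br r φ p q) = Bool ⊎ (St p ⊎ St q)
  St (while r p) = Bool ⊎ St p
  St (ask r p q) = SweepState ⊎ (St p ⊎ St q)
  St (flip p q) = ⊤ ⊎ (St p ⊎ St q)

  opaque
    St-finite : ∀ p → Finite (St p)
    St-finite skip = ⊤-finite
    St-finite (prim π) = SweepState-finite
    St-finite (p ⨾ q) = ⊎-finite (St-finite p) (St-finite q)
    St-finite (br r φ p q) = ⊎-finite Bool-finite (⊎-finite (St-finite p) (St-finite q))
    St-finite (while r p) = ⊎-finite Bool-finite (St-finite p)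
    St-finite (ask r p q) = ⊎-finite SweepState-finite (⊎-finite (St-finite p) (St-finite q))
    St-finite (flip p q) = ⊎-finite ⊤-finite (⊎-finite (St-finite p) (St-finite q))

  ent : ∀ p → St p
  ent skip = tt
  ent (prim π) = go
  ent (p ⨾ q) = inj₁ (ent p)
  ent (br r φ p q) = inj₁ false
  ent (while r p) = inj₁ false
  ent (ask r p q) = inj₁ go
  ent (flip p q) = inj₁ tt

  module Code (Q : ℕ) where
    Act : Set
    Act = Action Q Γ

    sweepδ : Sweep → (SweepState → Fin Q) → Act → SweepState → Symbol → Act
    sweepδ sw ι end go y = step (ι (goR (carry sw))) y right nothing
    sweepδ sw ι end (goR c) y =
      if isEmpty (cellOf y)
      then step (ι (goL nothing)) (symOf (proj₂ (fR sw c (cellOf y)))) left nothing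
      else step (ι (goR (proj₁ (fR sw c (cellOf y))))) (symOf (proj₂ (fR sw c (cellOf y)))) right (emit sw (cellOf y))
    sweepδ sw ι end (goL c) y =
      if isMarker y then end
      else step (ι (goL (proj₁ (fL sw c (cellOf y))))) (symOf (proj₂ (fL sw c (cellOf y)))) left nothing

    code : ∀ p → (St p → Fin Q) → Fin Q → St p → Symbol → Bool → Act
    code skip ι exit s y b = step exit y stay nothing
    code (prim π) ι exit s y b = sweepδ (sweepOf π) ι (step exit marker stay nothing) s y
    code (p ⨾ q) ι exit (inj₁ s) = code p (ι ∘ inj₁) (ι (inj₂ (ent q))) s
    code (p ⨾ q) ι exit (inj₂ s) = code q (ι ∘ inj₂) exit s
    code (br r φ p q) ι exit (inj₁ false) y b = step (ι (inj₁ true)) y right nothing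
    code (br r φ p q) ι exit (inj₁ true) y b =
      step (if φ (get r (cellOf y)) then ι (inj₂ (inj₁ (ent p))) else ι (inj₂ (inj₂ (ent q)))) y left nothing
    code (br r φ p q) ι exit (inj₂ (inj₁ s)) = code p (ι ∘ inj₂ ∘ inj₁) exit s
    code (br r φ p q) ι exit (inj₂ (inj₂ s)) = code q (ι ∘ inj₂ ∘ inj₂) exit s
    code (while r p) ι exit (inj₁ false) y b = step (ι (inj₁ true)) y right nothing
    code (while r p) ι exit (inj₁ true) y b =
      step (if isJust (get r (cellOf y)) then ι (inj₂ (ent p)) else exit) y left nothing
    code (while r p) ι exit (inj₂ s) = code p (ι ∘ inj₂) (ι (inj₁ false)) s
    code (ask r p q) ι exit (inj₁ s) y b =
      sweepδ (emitSweep r) (ι ∘ inj₁) (ask (ι (inj₂ (inj₁ (ent p)))) (ι (inj₂ (inj₂ (ent q))))) s y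
    code (ask r p q) ι exit (inj₂ (inj₁ s)) = code p (ι ∘ inj₂ ∘ inj₁) exit s
    code (ask r p q) ι exit (inj₂ (inj₂ s)) = code q (ι ∘ inj₂ ∘ inj₂) exit s
    code (flip p q) ι exit (inj₁ _) y b =
      step (if b then ι (inj₂ (inj₂ (ent q))) else ι (inj₂ (inj₁ (ent p)))) y stay nothing
    code (flip p q) ι exit (inj₂ (inj₁ s)) = code p (ι ∘ inj₂ ∘ inj₁) exit s
    code (flip p q) ι exit (inj₂ (inj₂ s)) = code q (ι ∘ inj₂ ∘ inj₂) exit s

  cellAt : List Symbol → ℕ → Cell
  cellAt [] j = empty
  cellAt (y ∷ ys) zero = cellOf y
  cellAt (y ∷ ys) (suc j) = cellAt ys j

  at : Str → ℕ → Maybe Bool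
  at [] j = nothing
  at (b ∷ v) zero = just b
  at (b ∷ v) (suc j) = at v j

  Rep : List Symbol → State → Set
  Rep ys σ = ∀ r → r < N → ∀ j → get r (cellAt ys j) ≡ at (σ r) j

  -- A sweep turns round at the first empty cell, so nothing may lie beyond it. Tapes that represent
  -- registers have this property because strings have no gaps.
  Closed : List Symbol → Set
  Closed ys = ∀ j → isEmpty (cellAt ys j) ≡ true → cellAt ys (suc j) ≡ empty

  closed-all : ∀ ys → Closed ys → isEmpty (cellAt ys 0) ≡ true → ∀ j → cellAt ys j ≡ empty
  closed-all ys cl h zero = isEmpty-sound _ h
  closed-all ys cl h (suc j) = cl j (trans (cong isEmpty (closed-all ys cl h j)) (isEmpty-empty N))

  at-mono : ∀ v j → at v j ≡ nothing → at v (suc j) ≡ nothing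
  at-mono [] j h = refl
  at-mono (b ∷ v) (suc j) h = at-mono v j h

  at-length : ∀ v j → length v ≤ j → at v j ≡ nothing
  at-length [] j h = refl
  at-length (b ∷ v) (suc j) (s≤s h) = at-length v j h

  at-tail : ∀ v j → at (tail v) j ≡ at v (suc j)
  at-tail [] j = refl
  at-tail (b ∷ v) j = refl

  at-take : ∀ (u v : Str) j → at (take (length u) v) j ≡ (if isJust (at u j) then at v j else nothing)
  at-take [] v j = refl
  at-take (a ∷ u) [] zero = refl
  at-take (a ∷ u) [] (suc j) with at u j
  ... | just _ = refl
  ... | nothing = refl
  at-take (a ∷ u) (b ∷ v) zero = refl
  at-take (a ∷ u) (b ∷ v) (suc j) = at-take u v j

  Rep-closed : ∀ ys σ → Rep ys σ → Closed ys
  Rep-closed ys σ rep j h = empty-ext _ λ r l → trans (rep r l (suc j))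
    (at-mono (σ r) j (trans (sym (rep r l j)) (trans (cong (get r) (isEmpty-sound (cellAt ys j) h)) (get-empty N r))))

  Rep-short : ∀ {S} ys σ → Rep ys σ → Short S σ → isEmpty (cellAt ys S) ≡ true
  Rep-short {S} ys σ rep sh = trans (cong isEmpty (empty-ext (cellAt ys S) λ r l → trans (rep r l S) (at-length (σ r) S (sh r)))) (isEmpty-empty N)

  module _ (sw : Sweep) where
    mutual
      sweep : Maybe Bool → List Symbol → Maybe Bool × List Symbol
      sweep c [] = nothing , symOf (proj₂ (fR sw c empty)) ∷ []
      sweep c (y ∷ ys) = sweepCell (isEmpty (cellOf y)) c y ys

      sweepCell : Bool → Maybe Bool → Symbol → List Symbol → Maybe Bool × List Symbol
      sweepCell true c y ys = nothing , symOf (proj₂ (fR sw c (cellOf y))) ∷ ys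
      sweepCell false c y ys =
        let (c' , v) = fR sw c (cellOf y)
            (d , ys') = sweep c' ys
            (d' , v') = fL sw d v
        in d' , symOf v' ∷ ys'

    mutual
      emitted : List Symbol → Str → Str
      emitted [] w = w
      emitted (y ∷ ys) w = emittedCell (isEmpty (cellOf y)) y ys w

      emittedCell : Bool → Symbol → List Symbol → Str → Str
      emittedCell true y ys w = w
      emittedCell false y ys w = emitted ys (cons? (emit sw (cellOf y)) w)

      cons? : Maybe Bool → Str → Str
      cons? nothing w = w
      cons? (just b) w = b ∷ w

  sweep-pointwise : ∀ F → F empty ≡ empty → ∀ e c ys → Closed ys → ∀ j →
    cellAt (proj₂ (sweep (record (pointwise F) { emit = e }) c ys)) j ≡ F (cellAt ys j)
  sweep-pointwise F F0 e c [] cl zero = cellOf-symOf (F empty)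
  sweep-pointwise F F0 e c [] cl (suc j) = sym F0
  sweep-pointwise F F0 e c (y ∷ ys) cl j with isEmpty (cellOf y) in eq
  sweep-pointwise F F0 e c (y ∷ ys) cl zero | true = cellOf-symOf _
  sweep-pointwise F F0 e c (y ∷ ys) cl (suc j) | true =
    trans (closed-all (y ∷ ys) cl eq (suc j)) (sym (trans (cong F (closed-all (y ∷ ys) cl eq (suc j))) F0))
  sweep-pointwise F F0 e c (y ∷ ys) cl zero | false = cellOf-symOf _
  sweep-pointwise F F0 e c (y ∷ ys) cl (suc j) | false = sweep-pointwise F F0 e c ys (cl ∘ suc) j

  sweep-shiftR : ∀ d b c ys → Closed ys → let zs = proj₂ (sweep (record (shiftR d) { carry = b }) c ys) in
    cellAt zs 0 ≡ set d c (cellAt ys 0) × (∀ j → cellAt zs (suc j) ≡ set d (get d (cellAt ys j)) (cellAt ys (suc j)))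
  sweep-shiftR d b c [] cl = cellOf-symOf _ , λ j →
    sym (set-get-empty d)
  sweep-shiftR d b c (y ∷ ys) cl with isEmpty (cellOf y) in eq
  ... | true = cellOf-symOf _ , λ j → trans (closed-all (y ∷ ys) cl eq (suc j))
        (sym (trans (cong₂ (λ u v → set d (get d u) v) (closed-all (y ∷ ys) cl eq j) (closed-all (y ∷ ys) cl eq (suc j)))
               (set-get-empty d)))
  ... | false = cellOf-symOf _ , λ { zero → proj₁ (sweep-shiftR d b _ ys (cl ∘ suc))
                                   ; (suc j) → proj₂ (sweep-shiftR d b _ ys (cl ∘ suc)) j }

  sweep-shiftL : ∀ d c ys → Closed ys → let (b , zs) = sweep (shiftL d) c ys in
    b ≡ get d (cellAt ys 0) × (∀ j → cellAt zs j ≡ set d (get d (cellAt ys (suc j))) (cellAt ys j))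
  sweep-shiftL d c [] cl = sym (get-empty N d) ,
      λ { zero → trans (cellOf-symOf _) (sym (set-get-empty d))
        ; (suc j) → sym (set-get-empty d) }
  sweep-shiftL d c (y ∷ ys) cl with isEmpty (cellOf y) in eq
  ... | true = sym (trans (cong (get d) (isEmpty-sound (cellOf y) eq)) (get-empty N d)) , cells
    where
    all : ∀ j → cellAt (y ∷ ys) j ≡ empty
    all = closed-all (y ∷ ys) cl eq
    noop : ∀ j → set d (get d (cellAt ys j)) (cellAt (y ∷ ys) j) ≡ empty
    noop j = trans (cong₂ (λ u v → set d (get d u) v) (all (suc j)) (all j))
               (set-get-empty d)
    cells : ∀ j → cellAt (symOf (cellOf y) ∷ ys) j ≡ set d (get d (cellAt ys j)) (cellAt (y ∷ ys) j)
    cells zero = trans (cellOf-symOf _) (trans (all 0) (sym (noop 0)))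
    cells (suc j) = trans (all (suc j)) (sym (noop (suc j)))
  ... | false with sweep-shiftL d c ys (cl ∘ suc)
  ...   | b≡ , h = refl , λ { zero → trans (cellOf-symOf _) (cong (λ x → set d x (cellOf y)) b≡) ; (suc j) → h j }

  Rep-upd : ∀ d ys zs v σ → d < N → Rep ys σ → (∀ r → r ≢ d → ∀ j → get r (cellAt zs j) ≡ get r (cellAt ys j)) →
    (∀ j → get d (cellAt zs j) ≡ at v j) → Rep zs (upd d v σ)
  Rep-upd d ys zs v σ d<N rep other same r l j with r ≟ d
  ... | yes refl = trans (same j) (cong (λ u → at u j) (sym (upd-same d v σ)))
  ... | no r≢d = trans (other r r≢d j) (trans (rep r l j) (cong (λ u → at u j) (sym (upd-other r d v σ r≢d))))

  Rep-pointwise : ∀ d (x : Cell → Maybe Bool) v ys σ → d < N → set d (x empty) empty ≡ empty → Rep ys σ →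
    (∀ j → x (cellAt ys j) ≡ at v j) → Rep (proj₂ (sweep (pointwise (λ c → set d (x c) c)) nothing ys)) (upd d v σ)
  Rep-pointwise d x v ys σ l x0 rep h = Rep-upd d ys (proj₂ (sweep (pointwise (λ c → set d (x c) c)) nothing ys)) v σ l rep
    (λ r r≢d j → trans (cong (get r) (sw j)) (get-set-other r d _ (cellAt ys j) r≢d))
    (λ j → trans (cong (get d) (sw j)) (trans (get-set d _ (cellAt ys j) l) (h j)))
    where sw = sweep-pointwise (λ c → set d (x c) c) x0 (λ _ → nothing) nothing ys (Rep-closed ys σ rep)

  Rep-exec : ∀ π ys σ → widthPrim π ≤ N → Rep ys σ →
    Rep (proj₂ (sweep (sweepOf π) (carry (sweepOf π)) ys)) (exec π σ)
  Rep-exec (cp a d) ys σ l rep = Rep-pointwise d (get a) (σ a) ys σ (m⊔n≤o⇒n≤o (suc a) _ l)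
    (trans (cong (λ x → set d x empty) (get-empty N a)) (set-empty N d)) rep (rep a (m⊔n≤o⇒m≤o _ (suc d) l))
  Rep-exec (tr a d) ys σ l rep =
    Rep-pointwise d (λ v → if isJust (get a v) then get d v else nothing) (take (length (σ a)) (σ d)) ys σ (m⊔n≤o⇒n≤o (suc a) _ l)
      (trans (cong (λ x → set d (if isJust x then get d (empty {N}) else nothing) (empty {N})) (get-empty N a)) (set-empty N d)) rep
      (λ j → trans (cong₂ (λ x y → if isJust x then y else nothing) (rep a (m⊔n≤o⇒m≤o _ (suc d) l) j) (rep d (m⊔n≤o⇒n≤o (suc a) _ l) j))
               (sym (at-take (σ a) (σ d) j)))
  Rep-exec (psh b d) ys σ l rep with sweep-shiftR d (just b) (just b) ys (Rep-closed ys σ rep)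
  ... | h0 , h = Rep-upd d ys (proj₂ (sweep (sweepOf (psh b d)) (just b) ys)) (b ∷ σ d) σ l rep
    (λ { r r≢d zero → trans (cong (get r) h0) (get-set-other r d _ (cellAt ys 0) r≢d)
       ; r r≢d (suc j) → trans (cong (get r) (h j)) (get-set-other r d _ (cellAt ys (suc j)) r≢d) })
    (λ { zero → trans (cong (get d) h0) (get-set d _ (cellAt ys 0) l)
       ; (suc j) → trans (cong (get d) (h j)) (trans (get-set d _ (cellAt ys (suc j)) l) (rep d l j)) })
  Rep-exec (pop d) ys σ l rep with sweep-shiftL d nothing ys (Rep-closed ys σ rep)
  ... | _ , h = Rep-upd d ys (proj₂ (sweep (shiftL d) nothing ys)) (tail (σ d)) σ l rep
    (λ r r≢d j → trans (cong (get r) (h j)) (get-set-other r d _ (cellAt ys j) r≢d))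
    (λ j → trans (cong (get d) (h j)) (trans (get-set d _ (cellAt ys j) l) (trans (rep d l (suc j)) (sym (at-tail (σ d) j)))))
  Rep-exec (clr d) ys σ l rep = Rep-pointwise d (λ _ → nothing) [] ys σ l (set-empty N d) rep (λ j → refl)

  emitted-emit : ∀ r ys v w → (∀ j → get r (cellAt ys j) ≡ at v j) → emitted (emitSweep r) ys w ≡ v ʳ++ w
  emitted-emit r [] [] w h = refl
  emitted-emit r [] (b ∷ v) w h with () ← trans (sym (get-empty N r)) (h 0)
  emitted-emit r (y ∷ ys) v w h with isEmpty (cellOf y) in eq
  emitted-emit r (y ∷ ys) [] w h | true = refl
  emitted-emit r (y ∷ ys) (b ∷ v) w h | true
    with () ← trans (sym (get-empty N r)) (trans (cong (get r) (sym (isEmpty-sound (cellOf y) eq))) (h 0))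
  emitted-emit r (y ∷ ys) v w h | false with get r (cellOf y) | h 0
  emitted-emit r (y ∷ ys) [] w h | false | _ | refl = emitted-emit r ys [] w (h ∘ suc)
  emitted-emit r (y ∷ ys) (b ∷ v) w h | false | _ | refl = emitted-emit r ys v (b ∷ w) (h ∘ suc)

  emitted-none : ∀ sw ys → (∀ v → emit sw v ≡ nothing) → emitted sw ys [] ≡ []
  emitted-none sw [] h = refl
  emitted-none sw (y ∷ ys) h with isEmpty (cellOf y)
  ... | true = refl
  ... | false rewrite h (cellOf y) = emitted-none sw ys h

-- Execution of register programs by the tape machine

module Running (N-1 : ℕ) (comb : Maybe Bool → Maybe Bool → Maybe Bool) (idem : ∀ x → comb x x ≡ x) (A : Language)
  (Q : ℕ) (start : Fin Q) (δ : Fin Q → Fin (3 + Tracks.Γ N-1) → Bool → Action Q (Tracks.Γ N-1)) where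
  open Tracks N-1
  open Code Q
  open Sweep

  M : OTM
  M = record { Q = Q ; Γ = Γ ; start = start ; δ = δ }

  open Evaluation comb A M
  open Ops M using (readHead; writeHead; moveHead; appendQ)

  step-↝ : ∀ {q l r w q' s mv o} → (∀ b → δ q (readHead r) b ≡ step q' s mv o) →
    cfg q l r w ↝[ 1 ] cfg q' (proj₁ (moveHead mv l (writeHead s r))) (proj₂ (moveHead mv l (writeHead s r))) (appendQ o w)
  step-↝ h e (suc t) (s≤s l) rewrite h false | h true = trans (idem _) (e t l)

  ask-↝ : ∀ {q l r w qy qn} → (∀ b → δ q (readHead r) b ≡ ask qy qn) →
    cfg q l r w ↝[ 1 ] cfg (if A (reverse w) then qy else qn) l r []
  ask-↝ h e (suc t) (s≤s l) rewrite h false | h true = trans (idem _) (e t l)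

  Placed : ∀ p → (St p → Fin Q) → Fin Q → Set
  Placed p ι exit = ∀ s y b → δ (ι s) y b ≡ code p ι exit s y b

  home : Fin Q → List Symbol → Config M
  home q ys = cfg q [] (marker ∷ ys) []

  SweepPlaced : Sweep → (SweepState → Fin Q) → Act → Set
  SweepPlaced sw ι end = ∀ s y b → δ (ι s) y b ≡ sweepδ sw ι end s y

  cons?-appendQ : ∀ sw o w → appendQ o w ≡ cons? sw o w
  cons?-appendQ sw nothing w = refl
  cons?-appendQ sw (just b) w = refl

  -- At most m nonempty cells are crossed, once in each direction, and one step turns the head
  -- round.
  sweep-↝ : ∀ sw ι end → SweepPlaced sw ι end → ∀ m c a l ys w → isEmpty (cellAt ys m) ≡ true →
    let (d , zs) = sweep sw c ys in
    cfg (ι (goR c)) (a ∷ l) ys w ↝[ 1 + 2 * m ] cfg (ι (goL d)) l (a ∷ zs) (emitted sw ys w)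
  sweep-↝ sw ι end h m c a l [] w em =
    ↝-weak (s≤s z≤n) (step-↝ {r = []} λ b → trans (h (goR c) zero b)
      (cong (λ e → if e then step (ι (goL nothing)) (symOf (proj₂ (fR sw c empty))) left nothing
                   else step (ι (goR (proj₁ (fR sw c empty)))) (symOf (proj₂ (fR sw c empty))) right (emit sw empty)) (isEmpty-empty N)))
  sweep-↝ sw ι end h m c a l (y ∷ ys) w em with isEmpty (cellOf y) in eq
  ... | true = ↝-weak (s≤s z≤n) (step-↝ {r = y ∷ ys} λ b → trans (h (goR c) y b)
      (cong (λ e → if e then step (ι (goL nothing)) (symOf (proj₂ (fR sw c (cellOf y)))) left nothing
                   else step (ι (goR (proj₁ (fR sw c (cellOf y))))) (symOf (proj₂ (fR sw c (cellOf y)))) right (emit sw (cellOf y))) eq))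
  sweep-↝ sw ι end h zero c a l (y ∷ ys) w em | false with () ← trans (sym em) eq
  sweep-↝ sw ι end h (suc m) c a l (y ∷ ys) w em | false =
    ↝-weak (≤-reflexive (arith m))
      (↝-trans {k = 1} {l = 1 + 2 * m + 1} fwd
        (↝-trans {k = 1 + 2 * m} {l = 1} (sweep-↝ sw ι end h m c' (symOf v) (a ∷ l) ys w' em) bwd))
    where
    c' = proj₁ (fR sw c (cellOf y))
    v = proj₂ (fR sw c (cellOf y))
    w' = cons? sw (emit sw (cellOf y)) w
    d = proj₁ (sweep sw c' ys)
    fwd : cfg (ι (goR c)) (a ∷ l) (y ∷ ys) w ↝[ 1 ] cfg (ι (goR c')) (symOf v ∷ a ∷ l) ys w'
    fwd = subst (λ u → cfg (ι (goR c)) (a ∷ l) (y ∷ ys) w ↝[ 1 ] cfg (ι (goR c')) (symOf v ∷ a ∷ l) ys u) (cons?-appendQ sw (emit sw (cellOf y)) w)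
      (step-↝ {r = y ∷ ys} λ b → trans (h (goR c) y b)
        (cong (λ e → if e then step (ι (goL nothing)) (symOf v) left nothing else step (ι (goR c')) (symOf v) right (emit sw (cellOf y))) eq))
    bwd : cfg (ι (goL d)) (a ∷ l) (symOf v ∷ proj₂ (sweep sw c' ys)) (emitted sw ys w') ↝[ 1 ]
          cfg (ι (goL (proj₁ (fL sw d v)))) l (a ∷ symOf (proj₂ (fL sw d v)) ∷ proj₂ (sweep sw c' ys)) (emitted sw ys w')
    bwd = step-↝ {r = symOf v ∷ proj₂ (sweep sw c' ys)} λ b → trans (h (goL d) (symOf v) b)
      (cong (λ u → step (ι (goL (proj₁ (fL sw d u)))) (symOf (proj₂ (fL sw d u))) left nothing) (cellOf-symOf v))
    arith : ∀ m → 1 + (1 + 2 * m + 1) ≡ 1 + 2 * suc m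
    arith = solve-∀

  fullSweep-↝ : ∀ sw ι end → SweepPlaced sw ι end → ∀ m ys → isEmpty (cellAt ys m) ≡ true →
    let (d , zs) = sweep sw (carry sw) ys in
    home (ι go) ys ↝[ 2 + 2 * m ] cfg (ι (goL d)) [] (marker ∷ zs) (emitted sw ys [])
  fullSweep-↝ sw ι end h m ys em =
    ↝-trans {k = 1} {l = 1 + 2 * m} (step-↝ {r = marker ∷ ys} λ b → h go marker b)
      (sweep-↝ sw ι end h m (carry sw) marker [] ys [] em)

  sweepOf-silent : ∀ π v → emit (sweepOf π) v ≡ nothing
  sweepOf-silent (cp a d) v = refl
  sweepOf-silent (tr a d) v = refl
  sweepOf-silent (psh b d) v = refl
  sweepOf-silent (pop d) v = refl
  sweepOf-silent (clr d) v = refl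

  prim-↝ : ∀ π ι exit → Placed (prim π) ι exit → ∀ S ys → isEmpty (cellAt ys S) ≡ true →
    home (ι go) ys ↝[ 2 + 2 * S + 1 ] home exit (proj₂ (sweep (sweepOf π) (carry (sweepOf π)) ys))
  prim-↝ π ι exit h S ys em = ↝-trans {k = 2 + 2 * S} {l = 1}
    (fullSweep-↝ (sweepOf π) ι (step exit marker stay nothing) h S ys em)
    (subst (λ w → cfg (ι (goL d)) [] (marker ∷ zs) w ↝[ 1 ] home exit zs) (sym (emitted-none (sweepOf π) ys (sweepOf-silent π)))
      (step-↝ {r = marker ∷ zs} λ b → h (goL d) marker b))
    where
    d = proj₁ (sweep (sweepOf π) (carry (sweepOf π)) ys)
    zs = proj₂ (sweep (sweepOf π) (carry (sweepOf π)) ys)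

  askSweep-↝ : ∀ r ι qy qn → SweepPlaced (emitSweep r) ι (ask qy qn) → ∀ S ys σ → isEmpty (cellAt ys S) ≡ true → r < N → Rep ys σ →
    home (ι go) ys ↝[ 2 + 2 * S + 1 ] home (if A (σ r) then qy else qn) (proj₂ (sweep (emitSweep r) nothing ys))
  askSweep-↝ r ι qy qn h S ys σ em r<N rep = ↝-trans {k = 2 + 2 * S} {l = 1}
    (fullSweep-↝ (emitSweep r) ι (ask qy qn) h S ys em)
    (subst (λ w → cfg (ι (goL d)) [] (marker ∷ zs) w ↝[ 1 ] home (if A (σ r) then qy else qn) zs)
      (sym (emitted-emit r ys (σ r) [] (rep r r<N)))
      (subst (λ v → cfg (ι (goL d)) [] (marker ∷ zs) (σ r ʳ++ []) ↝[ 1 ] home (if A v then qy else qn) zs) (reverse-involutive (σ r))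
        (ask-↝ {r = marker ∷ zs} λ b → h (goL d) marker b)))
    where
    d = proj₁ (sweep (emitSweep r) nothing ys)
    zs = proj₂ (sweep (emitSweep r) nothing ys)

  -- Passing over a cell writes its symbol back, which turns an unvisited end of the tape into an
  -- explicit blank. The represented cells do not change.
  rewrap : List Symbol → List Symbol
  rewrap ys = writeHead (readHead ys) ys

  cellAt-rewrap : ∀ ys j → cellAt (rewrap ys) j ≡ cellAt ys j
  cellAt-rewrap [] zero = refl
  cellAt-rewrap [] (suc j) = refl
  cellAt-rewrap (y ∷ ys) j = refl

  Rep-rewrap : ∀ ys σ → Rep ys σ → Rep (rewrap ys) σ
  Rep-rewrap ys σ rep r l j = trans (cong (get r) (cellAt-rewrap ys j)) (rep r l j)

  cellOf-head : ∀ ys → cellOf (readHead ys) ≡ cellAt ys 0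
  cellOf-head [] = refl
  cellOf-head (y ∷ ys) = refl

  at-head : ∀ v → at v 0 ≡ head v
  at-head [] = refl
  at-head (b ∷ v) = refl

  peek-↝ : ∀ {q₀ q₁ r ys} σ (next : Maybe Bool → Fin Q) v → σ r ≡ v → r < N →
    (∀ y b → δ q₀ y b ≡ step q₁ y right nothing) → (∀ y b → δ q₁ y b ≡ step (next (get r (cellOf y))) y left nothing) →
    Rep ys σ → home q₀ ys ↝[ 2 ] home (next (head v)) (rewrap ys)
  peek-↝ {r = r} {ys} σ next v refl r<N h₀ h₁ rep =
    ↝-trans {k = 1} {l = 1} (step-↝ {r = marker ∷ ys} λ b → h₀ marker b)
      (step-↝ {r = ys} λ b → trans (h₁ (readHead ys) b)
        (cong (λ x → step (next x) (readHead ys) left nothing)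
          (trans (cong (get r) (cellOf-head ys)) (trans (rep r r<N 0) (at-head (σ r))))))

  -- A sweep with its final step takes `3 + 2 * S` steps and a look at the first cell takes 2; one
  -- common price covers every instruction.
  stepCost : ℕ → ℕ
  stepCost S = 4 + 2 * S

  3+2S≤ : ∀ S → 2 + 2 * S + 1 ≤ stepCost S
  3+2S≤ S = ≤-trans (≤-reflexive (+-comm (2 + 2 * S) 1)) (n≤1+n (3 + 2 * S))

  Rep-emit : ∀ r ys σ → Rep ys σ → Rep (proj₂ (sweep (emitSweep r) nothing ys)) σ
  Rep-emit r ys σ rep r' l j = trans (cong (get r') (sweep-pointwise id refl (get r) nothing ys (Rep-closed ys σ rep) j)) (rep r' l j)

  mutual
    exec-↝ : ∀ {S p σ σ' k} → Exec A S p σ σ' k → width p ≤ N → ∀ ι exit → Placed p ι exit → ∀ ys → Rep ys σ →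
      Σ (List Symbol) λ zs → Rep zs σ' × (home (ι (ent p)) ys ↝[ k * stepCost S ] home exit zs)
    exec-↝ eskip wd ι exit h ys rep = ys , rep , ↝-weak (s≤s z≤n) (step-↝ {r = marker ∷ ys} λ b → h tt marker b)
    exec-↝ {S} (eprim {π} {σ} sh) wd ι exit h ys rep = _ , Rep-exec π ys σ wd rep ,
      ↝-weak (≤-trans (3+2S≤ S) (≤-reflexive (sym (*-identityˡ (stepCost S))))) (prim-↝ π ι exit h S ys (Rep-short ys σ rep sh))
    exec-↝ {S} (eseq {p} {q} {k = k} {l} x y) wd ι exit h ys rep
      with exec-↝ x (m⊔n≤o⇒m≤o (width p) _ wd) (ι ∘ inj₁) (ι (inj₂ (ent q))) (h ∘ inj₁) ys rep
    ... | zs , rep₁ , f with exec-↝ y (m⊔n≤o⇒n≤o (width p) _ wd) (ι ∘ inj₂) exit (h ∘ inj₂) zs rep₁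
    ...   | us , rep₂ , g = us , rep₂ , ↝-weak (≤-reflexive (sym (*-distribʳ-+ (stepCost S) k l))) (↝-trans {k = k * stepCost S} {l = l * stepCost S} f g)
    exec-↝ {S} (ebr {r} {φ} {p} {q} {σ} {k = k} x) wd ι exit h ys rep
      with exec-branch (φ (head (σ r))) x (m⊔n≤o⇒n≤o (suc r) _ wd) (ι ∘ inj₂) exit (λ s → h (inj₂ (inj₁ s))) (λ s → h (inj₂ (inj₂ s))) (rewrap ys) (Rep-rewrap ys σ rep)
    ... | zs , rep' , f = zs , rep' , ↝-weak (+-monoˡ-≤ (k * stepCost S) (s≤s (s≤s z≤n)))
          (↝-trans {k = 2} {l = k * stepCost S}
            (peek-↝ σ (λ x → if φ x then ι (inj₂ (inj₁ (ent p))) else ι (inj₂ (inj₂ (ent q)))) (σ r) refl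
              (m⊔n≤o⇒m≤o (suc r) (width p ⊔ width q) wd) (h (inj₁ false)) (h (inj₁ true)) rep) f)
    exec-↝ (ewhile0 {r} {p} {σ} e) wd ι exit h ys rep = rewrap ys , Rep-rewrap ys σ rep ,
      ↝-weak (s≤s (s≤s z≤n)) (peek-↝ σ (λ x → if isJust x then ι (inj₂ (ent p)) else exit) [] e
        (m⊔n≤o⇒m≤o (suc r) (width p) wd) (h (inj₁ false)) (h (inj₁ true)) rep)
    exec-↝ {S} (ewhile+ {r} {p} {σ} {k = k} {l} e x y) wd ι exit h ys rep
      with exec-↝ x (m⊔n≤o⇒n≤o (suc r) _ wd) (ι ∘ inj₂) (ι (inj₁ false)) (λ s → h (inj₂ s)) (rewrap ys) (Rep-rewrap ys σ rep)
    ... | zs , rep₁ , f with exec-↝ y wd ι exit h zs rep₁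
    ...   | us , rep₂ , g = us , rep₂ ,
        ↝-weak (≤-trans (≤-reflexive (cong (2 +_) (sym (*-distribʳ-+ (stepCost S) k l)))) (+-monoˡ-≤ ((k + l) * stepCost S) (s≤s (s≤s z≤n))))
          (↝-trans {k = 2} {l = k * stepCost S + l * stepCost S}
            (peek-↝ σ (λ x → if isJust x then ι (inj₂ (ent p)) else exit) (_ ∷ _) e
              (m⊔n≤o⇒m≤o (suc r) (width p) wd) (h (inj₁ false)) (h (inj₁ true)) rep)
            (↝-trans {k = k * stepCost S} {l = l * stepCost S} f g))
    exec-↝ {S} (eask {r} {p} {q} {σ} {k = k} sh x) wd ι exit h ys rep
      with exec-branch (A (σ r)) x (m⊔n≤o⇒n≤o (suc r) _ wd) (ι ∘ inj₂) exit (λ s → h (inj₂ (inj₁ s))) (λ s → h (inj₂ (inj₂ s)))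
             (proj₂ (sweep (emitSweep r) nothing ys)) (Rep-emit r ys σ rep)
    ... | zs , rep' , f = zs , rep' , ↝-weak (+-monoˡ-≤ (k * stepCost S) (3+2S≤ S))
          (↝-trans {k = 2 + 2 * S + 1} {l = k * stepCost S}
            (askSweep-↝ r (ι ∘ inj₁) _ _ (λ s → h (inj₁ s)) S ys σ (Rep-short ys σ rep sh) (m⊔n≤o⇒m≤o (suc r) (width p ⊔ width q) wd) rep) f)
    exec-↝ {S} (eweak k≤l x) wd ι exit h ys rep with exec-↝ x wd ι exit h ys rep
    ... | zs , rep' , f = zs , rep' , ↝-weak (*-monoˡ-≤ (stepCost S) k≤l) f

    exec-branch : ∀ t {S p q σ σ' k} → Exec A S (if t then p else q) σ σ' k → width p ⊔ width q ≤ N → ∀ (ι : St p ⊎ St q → Fin Q) exit →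
      Placed p (ι ∘ inj₁) exit → Placed q (ι ∘ inj₂) exit → ∀ ys → Rep ys σ →
      Σ (List Symbol) λ zs → Rep zs σ' × (home (if t then ι (inj₁ (ent p)) else ι (inj₂ (ent q))) ys ↝[ k * stepCost S ] home exit zs)
    exec-branch true {p = p} {q} x wd ι exit h₁ h₂ = exec-↝ x (m⊔n≤o⇒m≤o (width p) (width q) wd) (ι ∘ inj₁) exit h₁
    exec-branch false {p = p} x wd ι exit h₁ h₂ = exec-↝ x (m⊔n≤o⇒n≤o (width p) _ wd) (ι ∘ inj₂) exit h₂

-- Nondeterministic guesses and the assembled machine

anyBits : ℕ → (Str → Bool) → Bool
anyBits zero f = f []
anyBits (suc n) f = anyBits n (f ∘ (false ∷_)) ∨ anyBits n (f ∘ (true ∷_))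

anyBits-cong : ∀ n {f g} → (∀ u → length u ≡ n → f u ≡ g u) → anyBits n f ≡ anyBits n g
anyBits-cong zero h = h [] refl
anyBits-cong (suc n) h = cong₂ _∨_ (anyBits-cong n λ u e → h (false ∷ u) (cong suc e)) (anyBits-cong n λ u e → h (true ∷ u) (cong suc e))

∨-true : ∀ {a b} → a ∨ b ≡ true → a ≡ true ⊎ b ≡ true
∨-true {true} h = inj₁ refl
∨-true {false} h = inj₂ h

∨-introʳ : ∀ a {b} → b ≡ true → a ∨ b ≡ true
∨-introʳ true h = refl
∨-introʳ false h = h

anyBits-elim : ∀ n f → anyBits n f ≡ true → ∃ λ u → length u ≡ n × f u ≡ true
anyBits-elim zero f h = [] , refl , h
anyBits-elim (suc n) f h with ∨-true {anyBits n (f ∘ (false ∷_))} h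
... | inj₁ e = let (u , l , q) = anyBits-elim n _ e in false ∷ u , cong suc l , q
... | inj₂ e = let (u , l , q) = anyBits-elim n _ e in true ∷ u , cong suc l , q

anyBits-intro : ∀ f u → f u ≡ true → anyBits (length u) f ≡ true
anyBits-intro f [] h = h
anyBits-intro f (false ∷ u) h rewrite anyBits-intro (f ∘ (false ∷_)) u h = refl
anyBits-intro f (true ∷ u) h = ∨-introʳ (anyBits (length u) (f ∘ (false ∷_))) (anyBits-intro (f ∘ (true ∷_)) u h)

Bool-ext : ∀ {a b} → (a ≡ true → b ≡ true) → (b ≡ true → a ≡ true) → a ≡ b
Bool-ext {true} f g = sym (f refl)
Bool-ext {false} {true} f g = g refl
Bool-ext {false} {false} f g = refl

-- Needed because `guess` pushes its bits, so the register holds them in the reverse of the order in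
-- which they were chosen.
anyBits-reverse : ∀ n f → anyBits n (f ∘ reverse) ≡ anyBits n f
anyBits-reverse n f = Bool-ext
  (λ h → let (u , l , q) = anyBits-elim n (f ∘ reverse) h
         in subst (λ m → anyBits m f ≡ true) (trans (length-reverse u) l) (anyBits-intro f (reverse u) q))
  (λ h → let (u , l , q) = anyBits-elim n f h
         in subst (λ m → anyBits m (f ∘ reverse) ≡ true) (trans (length-reverse u) l)
              (anyBits-intro (f ∘ reverse) (reverse u) (trans (cong f (reverse-involutive u)) q)))

runAct : (A : Language) (M : OTM) → ℕ → (ℕ → Bool) → Action (OTM.Q M) (OTM.Γ M) →
  (l r : List (Sym (OTM.Q M) (OTM.Γ M))) → Str → Maybe Bool
runAct A M t ch accept l r w = just true
runAct A M t ch reject l r w = just false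
runAct A M t ch (step q s mv b) l r w =
  run A M t ch (cfg q (proj₁ (Ops.moveHead M mv l (Ops.writeHead M s r))) (proj₂ (Ops.moveHead M mv l (Ops.writeHead M s r))) (Ops.appendQ M b w))
runAct A M t ch (ask qy qn) l r w = run A M t ch (cfg (if A (reverse w) then qy else qn) l r [])

run-suc : ∀ A M t ch q l r w → run A M (suc t) ch (cfg q l r w) ≡
  runAct A M t (λ n → ch (suc n)) (OTM.δ M q (Ops.readHead M r) (ch 0)) l r w
run-suc A M t ch q l r w with OTM.δ M q (Ops.readHead M r) (ch 0)
... | accept = refl
... | reject = refl
... | step q' s mv b with Ops.moveHead M mv l (Ops.writeHead M s r)
...   | (l' , r') = refl
run-suc A M t ch q l r w | ask qy qn with A (reverse w)
... | true = refl
... | false = refl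

first : Maybe Bool → Maybe Bool → Maybe Bool
first a b = a

-- Undefined as soon as one branch is, so that a value of `ev` certifies that all choice sequences
-- halt in time, as `NPrel` demands.
either : Maybe Bool → Maybe Bool → Maybe Bool
either (just a) (just b) = just (a ∨ b)
either _ _ = nothing

either-idem : ∀ x → either x x ≡ x
either-idem (just true) = refl
either-idem (just false) = refl
either-idem nothing = refl

module _ (A : Language) (M : OTM) where
  open OTM M
  private
    module D = Evaluation first A M
    module E = Evaluation either A M

  run-det : ∀ t c → run A M t (λ _ → false) c ≡ D.ev t c
  run-det zero c = refl
  run-det (suc t) (cfg q l r w) =
    trans (run-suc A M t (λ _ → false) q l r w) (go (δ q (Ops.readHead M r) false))
    where
    go : ∀ a → runAct A M t (λ _ → false) a l r w ≡ D.act t a l r w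
    go accept = refl
    go reject = refl
    go (step x y z b) = run-det t _
    go (ask x y) = run-det t _

  either-just : ∀ x y {v} → either x y ≡ just v → ∃ λ a → ∃ λ b → x ≡ just a × y ≡ just b × v ≡ a ∨ b
  either-just (just a) (just b) refl = a , b , refl , refl , refl

  Agrees : ((ℕ → Bool) → Maybe Bool) → Bool → Set
  Agrees f v = (∀ ch → ∃ λ b → f ch ≡ just b × (b ≡ true → v ≡ true)) × (v ≡ true → ∃ λ ch → f ch ≡ just true)

  _∙_ : Bool → (ℕ → Bool) → ℕ → Bool
  (b ∙ ch) zero = b
  (b ∙ ch) (suc n) = ch n

  mutual
    run-nd : ∀ t c v → E.ev t c ≡ just v → Agrees (λ ch → run A M t ch c) v
    run-nd (suc t) (cfg q l r w) v h with either-just _ _ h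
    ... | a , b , ha , hb , refl with act-nd t (δ q (Ops.readHead M r) false) l r w a ha | act-nd t (δ q (Ops.readHead M r) true) l r w b hb
    ...   | f₀ , g₀ | f₁ , g₁ = all , some
      where
      all : ∀ ch → ∃ λ b' → run A M (suc t) ch (cfg q l r w) ≡ just b' × (b' ≡ true → a ∨ b ≡ true)
      all ch rewrite run-suc A M t ch q l r w with ch 0
      ... | false = let (x , e , i) = f₀ (λ n → ch (suc n)) in x , e , λ p → subst (λ y → y ∨ b ≡ true) (sym (i p)) refl
      ... | true = let (x , e , i) = f₁ (λ n → ch (suc n)) in x , e , λ p → ∨-introʳ a (i p)
      some : a ∨ b ≡ true → ∃ λ ch → run A M (suc t) ch (cfg q l r w) ≡ just true
      some p with ∨-true {a} p
      ... | inj₁ e = let (ch , x) = g₀ e in false ∙ ch , trans (run-suc A M t (false ∙ ch) q l r w) x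
      ... | inj₂ e = let (ch , x) = g₁ e in true ∙ ch , trans (run-suc A M t (true ∙ ch) q l r w) x

    act-nd : ∀ t a l r w v → E.act t a l r w ≡ just v → Agrees (λ ch → runAct A M t ch a l r w) v
    act-nd t accept l r w v refl = (λ ch → true , refl , λ _ → refl) , λ _ → (λ _ → false) , refl
    act-nd t reject l r w v refl = (λ ch → false , refl , λ ()) , λ ()
    act-nd t (step x y z b) l r w v h = run-nd t _ v h
    act-nd t (ask x y) l r w v h = run-nd t _ v h

guess : ℕ → ℕ → Prog
guess r u = while r (prim (pop r) ⨾ flip (prim (psh false u)) (prim (psh true u)))

module Machine (p : Prog) (out N-1 : ℕ) (width≤N : width p ≤ suc N-1) (out<N : out < suc N-1) where
  open Tracks N-1 public

  States : Set
  States = (Bool ⊎ Bool) ⊎ St p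

  opaque
    States-finite : Finite States
    States-finite = ⊎-finite (⊎-finite Bool-finite Bool-finite) (St-finite p)

  #Q : ℕ
  #Q = size States-finite

  open Code #Q public

  state : States → Fin #Q
  state = enc States-finite

  init final : Bool → Fin #Q
  init b = state (inj₁ (inj₁ b))
  final b = state (inj₁ (inj₂ b))

  δ' : States → Symbol → Bool → Act
  -- The head starts on the first input letter. A step to the left creates a new cell, which
  -- receives the marker; at the end the verdict is read from the first cell to the right of the
  -- marker, on track `out`.
  δ' (inj₁ (inj₁ false)) y b = step (init true) y left nothing
  δ' (inj₁ (inj₁ true)) y b = step (state (inj₂ (ent p))) marker stay nothing
  δ' (inj₁ (inj₂ false)) y b = step (final true) y right nothing
  δ' (inj₁ (inj₂ true)) y b = if isTrue (get out (cellOf y)) then accept else reject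
  δ' (inj₂ s) y b = code p (λ s → state (inj₂ s)) (final false) s y b

  δ : Fin #Q → Symbol → Bool → Act
  δ i = δ' (dec States-finite i)

  δ-state : ∀ s y b → δ (state s) y b ≡ δ' s y b
  δ-state s y b = cong (λ s → δ' s y b) (dec-enc States-finite s)

  input : Str → State
  input x = upd 0 x (λ _ → [])

  module Runs (comb : Maybe Bool → Maybe Bool → Maybe Bool) (idem : ∀ x → comb x x ≡ x) (A : Language) where
    open Running N-1 comb idem A #Q (init false) δ public
    open Evaluation comb A M public
    open Ops M using (readHead; bitSym)

    placed : Placed p (λ s → state (inj₂ s)) (final false)
    placed s = δ-state (inj₂ s)

    Rep-input : ∀ x → Rep (map bitSym x) (input x)
    Rep-input [] zero l j = get-empty N 0
    Rep-input (false ∷ x) zero l zero = refl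
    Rep-input (true ∷ x) zero l zero = refl
    Rep-input (b ∷ x) zero l (suc j) = Rep-input x zero l j
    Rep-input [] (suc r) l j = get-empty N (suc r)
    Rep-input (false ∷ x) (suc r) l zero = get-empty N-1 r
    Rep-input (true ∷ x) (suc r) l zero = get-empty N-1 r
    Rep-input (b ∷ x) (suc r) l (suc j) = Rep-input x (suc r) l j

    start-↝ : ∀ x → initConfig M x ↝[ 2 ] home (state (inj₂ (ent p))) (rewrap (map bitSym x))
    start-↝ x = ↝-trans {k = 1} {l = 1}
      (step-↝ {r = map bitSym x} λ b → δ-state (inj₁ (inj₁ false)) (readHead (map bitSym x)) b)
      (step-↝ {r = zero ∷ rewrap (map bitSym x)} λ b → δ-state (inj₁ (inj₁ true)) zero b)

    Rep-start : ∀ x → Rep (rewrap (map bitSym x)) (input x)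
    Rep-start x = Rep-rewrap (map bitSym x) (input x) (Rep-input x)

    halt-Ev : ∀ zs σ → Rep zs σ → Ev 2 (home (final false) zs) (isT (σ out))
    halt-Ev zs σ rep = step-↝ {r = marker ∷ zs} (λ b → δ-state (inj₁ (inj₂ false)) marker b) stop
      where
      verdict : ∀ b → δ (final true) (readHead zs) b ≡ (if isT (σ out) then accept else reject)
      verdict b = trans (δ-state (inj₁ (inj₂ true)) (readHead zs) b)
        (cong (λ x → if isTrue x then accept else reject) (trans (cong (get out) (cellOf-head zs)) (trans (rep out out<N 0) (at-head (σ out)))))
      stop : Ev 1 (cfg (final true) (marker ∷ []) zs []) (isT (σ out))
      stop (suc t) l rewrite verdict false | verdict true with isT (σ out)
      ... | true = idem (just true)
      ... | false = idem (just false)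

    flip-Ev : (∀ a b → comb (just a) (just b) ≡ just (a ∨ b)) → ∀ {q q₀ q₁ ys N v₀ v₁} →
      (∀ b → δ q marker b ≡ step (if b then q₁ else q₀) marker stay nothing) →
      Ev N (home q₀ ys) v₀ → Ev N (home q₁ ys) v₁ → Ev (1 + N) (home q ys) (v₀ ∨ v₁)
    flip-Ev or {q} {q₀} {q₁} {ys} h e₀ e₁ (suc t) (s≤s l) rewrite h false | h true | e₀ t l | e₁ t l = or _ _

    -- Each letter of the counter costs a look at it, two sweeps (pop and push) and a flip,
    -- `9 + 4 * S` steps in all, which `3 * stepCost S` covers. The continuation is evaluated once
    -- for each guess, and the flips join the outcomes by disjunction.
    guess-Ev : (∀ a b → comb (just a) (just b) ≡ just (a ∨ b)) → ∀ {r u} → r < N → u < N → r ≢ u → ∀ {S K} xs σ ys ι exit →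
      Placed (guess r u) ι exit → Rep ys σ → σ r ≡ xs → Short S σ → length xs + length (σ u) ≤ S → (f : Str → Bool) →
      (∀ zs σ' → Rep zs σ' → Short S σ' → (∀ j → j ≢ r → j ≢ u → σ' j ≡ σ j) → length (σ' u) ≡ length xs + length (σ u) →
        Ev K (home exit zs) (f (σ' u))) →
      Ev ((1 + length xs) * (3 * stepCost S) + K) (home (ι (inj₁ false)) ys) (anyBits (length xs) (λ v → f (v ʳ++ σ u)))
    guess-Ev or {r} {u} r<N u<N r≢u {S} {K} [] σ ys ι exit pl rep e sh l f k =
      Ev-mono (+-monoˡ-≤ K (s≤s (s≤s z≤n)))
        (peek-↝ σ (λ x → if isJust x then ι (inj₂ (inj₁ go)) else exit) [] e r<N (pl (inj₁ false)) (pl (inj₁ true)) rep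
          (k (rewrap ys) σ (Rep-rewrap ys σ rep) sh (λ _ _ _ → refl) refl))
    guess-Ev or {r} {u} r<N u<N r≢u {S} {K} (x ∷ xs) σ ys ι exit pl rep e sh l f k =
      Ev-mono arith
        (peek-↝ σ (λ x → if isJust x then ι (inj₂ (inj₁ go)) else exit) (x ∷ xs) e r<N (pl (inj₁ false)) (pl (inj₁ true)) rep
          (prim-↝ (pop r) (λ s → ι (inj₂ (inj₁ s))) (ι (inj₂ (inj₂ (inj₁ tt)))) (λ s → pl (inj₂ (inj₁ s))) S (rewrap ys)
             (Rep-short (rewrap ys) σ rep₀ sh)
             (flip-Ev or (pl (inj₂ (inj₂ (inj₁ tt))) marker) (branch false) (branch true))))
      where
      rep₀ = Rep-rewrap ys σ rep
      σ₁ = upd r (tail (σ r)) σ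
      ys₁ = proj₂ (sweep (shiftL r) nothing (rewrap ys))
      rep₁ : Rep ys₁ σ₁
      rep₁ = Rep-exec (pop r) (rewrap ys) σ r<N rep₀
      sh₁ : Short S σ₁
      sh₁ = Short-upd r {tail (σ r)} {σ} (≤-trans (length-tail≤ (σ r)) (sh r)) sh
      σ₁u : σ₁ u ≡ σ u
      σ₁u = upd-other u r (tail (σ r)) σ (r≢u ∘ sym)
      W = 2 + 2 * S + 1
      T = (1 + length xs) * (3 * stepCost S)
      arith : 2 + (W + (1 + (W + (T + K)))) ≤ 3 * stepCost S + T + K
      arith = ≤-trans (≤-reflexive (eq S T K)) (≤-trans (m≤m+n _ (3 + 2 * S)) (≤-reflexive (eq' S T K)))
        where
        eq : ∀ S T K → 2 + ((2 + 2 * S + 1) + (1 + ((2 + 2 * S + 1) + (T + K)))) ≡ 9 + (4 * S + (T + K))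
        eq = solve-∀
        eq' : ∀ S T K → 9 + (4 * S + (T + K)) + (3 + 2 * S) ≡ 3 * (4 + 2 * S) + T + K
        eq' = solve-∀
      branch : ∀ b → Ev (W + (T + K)) (home (if b then ι (inj₂ (inj₂ (inj₂ (inj₂ go)))) else ι (inj₂ (inj₂ (inj₂ (inj₁ go))))) ys₁)
                      (anyBits (length xs) (λ v → f (v ʳ++ (b ∷ σ u))))
      branch b = subst (λ w → Ev (W + (T + K)) (home (entry b) ys₁) (anyBits (length xs) (λ v → f (v ʳ++ w)))) σ₂u
        (push b
          (guess-Ev or r<N u<N r≢u xs σ₂ ys₂ ι exit pl rep₂
            (trans (upd-other r u (b ∷ σ₁ u) σ₁ r≢u) (trans (upd-same r (tail (σ r)) σ) (cong tail e)))
            sh₂ (≤-trans (≤-reflexive len) l) f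
            (λ zs σ' rep' sh' kp le → k zs σ' rep' sh'
              (λ j j≢r j≢u → trans (kp j j≢r j≢u) (trans (upd-other j u (b ∷ σ₁ u) σ₁ j≢u) (upd-other j r (tail (σ r)) σ j≢r)))
              (trans le len))))
        where
        entry : Bool → Fin #Q
        entry b = if b then ι (inj₂ (inj₂ (inj₂ (inj₂ go)))) else ι (inj₂ (inj₂ (inj₂ (inj₁ go))))
        σ₂ = upd u (b ∷ σ₁ u) σ₁
        ys₂ = proj₂ (sweep (sweepOf (psh b u)) (just b) ys₁)
        σ₂u : σ₂ u ≡ b ∷ σ u
        σ₂u = trans (upd-same u (b ∷ σ₁ u) σ₁) (cong (b ∷_) σ₁u)
        len : length xs + length (σ₂ u) ≡ suc (length xs + length (σ u))
        len = trans (cong (λ w → length xs + length w) σ₂u) (+-suc _ _)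
        rep₂ : Rep ys₂ σ₂
        rep₂ = Rep-exec (psh b u) ys₁ σ₁ u<N rep₁
        sh₂ : Short S σ₂
        sh₂ = Short-upd u {b ∷ σ₁ u} {σ₁} (≤-trans (≤-reflexive (cong (suc ∘ length) σ₁u))
                (≤-trans (s≤s (m≤n+m _ (length xs))) l)) sh₁
        push : ∀ b → home (entry b) ys₁ ↝[ W ] home (ι (inj₁ false)) (proj₂ (sweep (sweepOf (psh b u)) (just b) ys₁))
        push false = prim-↝ (psh false u) (λ s → ι (inj₂ (inj₂ (inj₂ (inj₁ s))))) (ι (inj₁ false)) (λ s → pl (inj₂ (inj₂ (inj₂ (inj₁ s))))) S ys₁ (Rep-short ys₁ σ₁ rep₁ sh₁)
        push true = prim-↝ (psh true u) (λ s → ι (inj₂ (inj₂ (inj₂ (inj₂ s))))) (ι (inj₁ false)) (λ s → pl (inj₂ (inj₂ (inj₂ (inj₂ s))))) S ys₁ (Rep-short ys₁ σ₁ rep₁ sh₁)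

-- For n ≥ 2 one has n + 2 ≤ n², which accounts for the exponent `2 * d`. For n ≤ 1 powers of n do
-- not grow, and the additive constant `3 ^ d` takes over.
poly≤bound : ∀ {f} → PolyBounded f → ∃ λ c → ∀ (x : Str) → f (length x) ≤ bound c x
poly≤bound {f} (d , h) = 2 * d + 3 ^ d , λ x → ≤-trans (h (length x)) (main (length x))
  where
  c = 2 * d + 3 ^ d
  square : ∀ n → 2 + (2 + n) ≤ (2 + n) ^ 2
  square n = ≤-trans (m≤m+n (4 + n) (3 * n + n * n)) (≤-reflexive (eq n))
    where
    eq : ∀ n → 4 + n + (3 * n + n * n) ≡ (2 + n) * ((2 + n) * 1)
    eq = solve-∀
  main : ∀ n → (2 + n) ^ d ≤ n ^ c + c
  main zero = ≤-trans (^-monoˡ-≤ d (n≤1+n 2)) (≤-trans (m≤n+m (3 ^ d) (2 * d)) (m≤n+m c (0 ^ c)))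
  main (suc zero) = ≤-trans (m≤n+m (3 ^ d) (2 * d)) (m≤n+m c (1 ^ c))
  main (suc (suc n)) = ≤-trans (^-monoˡ-≤ d (square n)) (≤-trans (≤-reflexive (^-*-assoc (2 + n) 2 d))
    (≤-trans (^-monoʳ-≤ (2 + n) (m≤m+n (2 * d) (3 ^ d))) (m≤m+n _ c)))

-- From expressions to machines

Short-input : ∀ x {S} → length x ≤ S → Short S (upd 0 x (λ _ → []))
Short-input x l zero = l
Short-input x l (suc j) = z≤n


module Deterministic (A : Language) (e : Exp 1) (N-1 : ℕ) (wd : width (compile e (λ _ → 0) 1) ≤ suc N-1) (wo : 1 < suc N-1) where
  open Machine (compile e (λ _ → 0) 1) 1 N-1 wd wo
  open Runs first (λ _ → refl) A

  S : ℕ → ℕ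
  S n = cost e n + n

  time : ℕ → ℕ
  time n = 2 + (cost e n * (4 + 2 * S n) + 2)

  time-poly : PolyBounded time
  time-poly = poly-+ (poly-const 2) (poly-+ (poly-* (cost-poly e)
    (poly-+ (poly-const 4) (poly-* (poly-const 2) (poly-+ (cost-poly e) poly-id)))) (poly-const 2))

  runs : ∀ x → Ev (time (length x)) (initConfig M x) (isT (eval A e (x ∷ [])))
  runs x = simulated (compile-post A (S (length x)) e (λ _ → 0) 1 (x ∷ []) (length x) (input x) (λ _ → s≤s z≤n) (λ { zero → refl })
      (λ { zero → ≤-refl }) (m≤m+n _ _) (Short-input x (m≤n+m (length x) (cost e (length x)))))
    where
    finish : ∀ σ' → σ' 1 ≡ eval A e (x ∷ []) → (Σ (List Symbol) λ zs → Rep zs σ' ×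
      (home (state (inj₂ (ent (compile e (λ _ → 0) 1)))) (rewrap (map (Ops.bitSym M) x)) ↝[ cost e (length x) * stepCost (S (length x)) ] home (final false) zs)) →
      Ev (time (length x)) (initConfig M x) (isT (eval A e (x ∷ [])))
    finish σ' val (zs , rep , f) = start-↝ x (f (subst (λ v → Ev 2 (home (final false) zs) (isT v)) val (halt-Ev zs σ' rep)))
    simulated : Post A (S (length x)) (compile e (λ _ → 0) 1) 1 (input x) (cost e (length x)) (Holds A (S (length x)) 1 (eval A e (x ∷ []))) →
      Ev (time (length x)) (initConfig M x) (isT (eval A e (x ∷ [])))
    simulated (post σ' ex _ _ val) =
      finish σ' val (exec-↝ ex wd (λ s → state (inj₂ s)) (final false) placed (rewrap (map (Ops.bitSym M) x)) (Rep-start x))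

  decides : ∀ {L} → (∀ x → isT (eval A e (x ∷ [])) ≡ L x) → Prel A L
  decides h = M , proj₁ b , λ x →
    trans (run-det A M (bound (proj₁ b) x) (initConfig M x)) (trans (runs x (bound (proj₁ b) x) (proj₂ b x)) (cong just (h x)))
    where b = poly≤bound time-poly

opaque
  toPrel : ∀ {A L} (e : Exp 1) → (∀ x → isT (eval A e (x ∷ [])) ≡ L x) → Prel A L
  toPrel {A} e h = Deterministic.decides A e (width (compile e (λ _ → 0) 1) ⊔ 2)
    (≤-trans (m≤m⊔n _ 2) (n≤1+n _)) (s≤s (≤-trans (s≤s z≤n) (m≤n⊔m (width (compile e (λ _ → 0) 1)) 2))) h

-- Register 0 keeps the input, register 1 receives the guess, and register 2 holds first the length
-- of the guess in unary, computed by `r`, and later the verdict of `e`.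
module Nondeterministic (A : Language) (r : Exp 1) (e : Exp 2) (N-1 : ℕ)
  (wr : width (compile r (λ _ → 0) 2) ≤ suc N-1) (we : width (compile e toℕ 2) ≤ suc N-1) (wo : 2 < suc N-1) where

  p₁ p₂ p : Prog
  p₁ = compile r (λ _ → 0) 2
  p₂ = compile e toℕ 2
  p = p₁ ⨾ guess 2 1 ⨾ p₂

  wp : width p ≤ suc N-1
  wp = ⊔-lub wr (⊔-lub (⊔-lub wo (⊔-lub wo (⊔-lub 2≤ 2≤))) we)
    where 2≤ = ≤-trans (n≤1+n 2) wo

  open Machine p 2 N-1 wp wo
  open Runs either either-idem A

  K S : ℕ → ℕ
  K n = n + cost r n
  S n = cost r n + (cost e (K n) + K n)

  time₁ time₂ time : ℕ → ℕ
  time₂ n = cost e (K n) * (4 + 2 * S n) + 2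
  time₁ n = (1 + cost r n) * (3 * (4 + 2 * S n)) + time₂ n
  time n = 2 + (cost r n * (4 + 2 * S n) + time₁ n)

  time-poly : PolyBounded time
  time-poly = poly-+ (poly-const 2) (poly-+ (poly-* (cost-poly r) S-poly)
    (poly-+ (poly-* (poly-+ (poly-const 1) (cost-poly r)) (poly-* (poly-const 3) S-poly))
      (poly-+ (poly-* (poly-∘ (cost-poly e) K-poly) S-poly) (poly-const 2))))
    where
    K-poly : PolyBounded K
    K-poly = poly-+ poly-id (cost-poly r)
    S-poly : PolyBounded (λ n → 4 + 2 * S n)
    S-poly = poly-+ (poly-const 4) (poly-* (poly-const 2) (poly-+ (cost-poly r) (poly-+ (poly-∘ (cost-poly e) K-poly) K-poly)))

  module _ (x : Str) where
    n : ℕ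
    n = length x

    G : Str
    G = eval A r (x ∷ [])

    test : Str → Bool
    test u = isT (eval A e (x ∷ u ∷ []))

    G≤ : length G ≤ cost r n
    G≤ = length-eval A r (x ∷ []) n λ { zero → ≤-refl }

    q₁ q₂ : Fin #Q
    q₁ = state (inj₂ (inj₂ (inj₁ (inj₁ false))))
    q₂ = state (inj₂ (inj₂ (inj₂ (ent p₂))))

    Ready : State → Set
    Ready σ = σ 0 ≡ x × length (σ 1) ≤ cost r n

    verify : ∀ us σ → Rep us σ → Short (S n) σ → Ready σ → Ev (time₂ n) (home q₂ us) (test (σ 1))
    verify us σ rep sh (e₀ , l₁) = simulated
      (compile-post A (S n) e toℕ 2 (x ∷ σ 1 ∷ []) (K n) σ (λ { zero → s≤s z≤n ; (suc zero) → s≤s (s≤s z≤n) })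
        (λ { zero → e₀ ; (suc zero) → refl }) (λ { zero → m≤m+n n _ ; (suc zero) → ≤-trans l₁ (m≤n+m _ n) })
        (≤-trans (m≤m+n _ (K n)) (m≤n+m _ (cost r n))) sh)
      where
      finish : ∀ σ' → σ' 2 ≡ eval A e (x ∷ σ 1 ∷ []) → (Σ (List Symbol) λ zs → Rep zs σ' ×
        (home q₂ us ↝[ cost e (K n) * stepCost (S n) ] home (final false) zs)) → Ev (time₂ n) (home q₂ us) (test (σ 1))
      finish σ' val (zs , rep' , f) = f (subst (λ v → Ev 2 (home (final false) zs) (isT v)) val (halt-Ev zs σ' rep'))
      simulated : Post A (S n) p₂ 2 σ (cost e (K n)) (Holds A (S n) 2 (eval A e (x ∷ σ 1 ∷ []))) → Ev (time₂ n) (home q₂ us) (test (σ 1))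
      simulated (post σ' ex _ _ val) =
        finish σ' val (exec-↝ ex we (λ s → state (inj₂ (inj₂ (inj₂ s)))) (final false) (λ s → placed (inj₂ (inj₂ s))) us rep)

    guessing : ∀ ys σ → Rep ys σ → Short (S n) σ → σ 0 ≡ x → σ 1 ≡ [] → σ 2 ≡ G →
      Ev (time₁ n) (home q₁ ys) (anyBits (length G) test)
    guessing ys σ rep sh e₀ e₁ e₂ = Ev-mono (+-monoˡ-≤ (time₂ n) (*-monoˡ-≤ (3 * stepCost (S n)) (s≤s G≤)))
      (subst (Ev _ (home q₁ ys)) (trans (cong (λ w → anyBits (length G) (λ v → test (v ʳ++ w))) e₁) (anyBits-reverse (length G) test))
        (guess-Ev (λ _ _ → refl) wo (≤-trans (n≤1+n 2) wo) (λ ()) G σ ys (λ s → state (inj₂ (inj₂ (inj₁ s)))) q₂ (λ s → placed (inj₂ (inj₁ s)))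
          rep e₂ sh (≤-trans (≤-reflexive len) (≤-trans G≤ (m≤m+n _ _))) test
          λ zs σ' rep' sh' kp le → verify zs σ' rep' sh' (trans (kp 0 (λ ()) (λ ())) e₀ , ≤-trans (≤-reflexive (trans le len)) G≤)))
      where
      len : length G + length (σ 1) ≡ length G
      len = trans (cong (λ w → length G + length w) e₁) (+-identityʳ _)

    runs : Ev (time n) (initConfig M x) (anyBits (length G) test)
    runs = simulated (compile-post A (S n) r (λ _ → 0) 2 (x ∷ []) n (input x) (λ _ → s≤s z≤n) (λ { zero → refl })
        (λ { zero → ≤-refl }) (m≤m+n _ _)
        (Short-input x (≤-trans (m≤m+n n (cost r n)) (≤-trans (m≤n+m _ (cost e (K n))) (m≤n+m _ (cost r n))))))
      where
      finish : ∀ σ' → (∀ j → j < 2 → σ' j ≡ input x j) → Short (S n) σ' → σ' 2 ≡ G → (Σ (List Symbol) λ zs → Rep zs σ' ×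
        (home (state (inj₂ (inj₁ (ent p₁)))) (rewrap (map (Ops.bitSym M) x)) ↝[ cost r n * stepCost (S n) ] home q₁ zs)) →
        Ev (time n) (initConfig M x) (anyBits (length G) test)
      finish σ' kp sh val (zs , rep , f) = start-↝ x (f (guessing zs σ' rep sh (kp 0 (s≤s z≤n)) (kp 1 (s≤s (s≤s z≤n))) val))
      simulated : Post A (S n) p₁ 2 (input x) (cost r n) (Holds A (S n) 2 G) → Ev (time n) (initConfig M x) (anyBits (length G) test)
      simulated (post σ' ex kp sh val) =
        finish σ' kp sh val (exec-↝ ex wr (λ s → state (inj₂ (inj₁ s))) q₁ (λ s → placed (inj₁ s)) (rewrap (map (Ops.bitSym M) x)) (Rep-start x))

  accepts : ∀ {L} → (∀ x → anyBits (length (G x)) (test x) ≡ L x) → NPrel A L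
  accepts {L} h = M , c , total , λ x → proj₂ (agrees x) , λ { (ch , q) → sound x ch q }
    where
    c = proj₁ (poly≤bound time-poly)
    agrees : ∀ x → Agrees A M (λ ch → run A M (bound c x) ch (initConfig M x)) (L x)
    agrees x = run-nd A M (bound c x) (initConfig M x) (L x)
      (trans (runs x (bound c x) (proj₂ (poly≤bound time-poly) x)) (cong just (h x)))
    total : ∀ x ch → Is-just (run A M (bound c x) ch (initConfig M x))
    total x ch = subst Is-just (sym (proj₁ (proj₂ (proj₁ (agrees x) ch)))) (any-just tt)
    sound : ∀ x ch → run A M (bound c x) ch (initConfig M x) ≡ just true → L x ≡ true
    sound x ch q = proj₂ (proj₂ (proj₁ (agrees x) ch)) (just-injective (trans (sym (proj₁ (proj₂ (proj₁ (agrees x) ch)))) q))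

opaque
  toNPrel : ∀ {A L} (r : Exp 1) (e : Exp 2) →
    (∀ x → anyBits (length (eval A r (x ∷ []))) (λ u → isT (eval A e (x ∷ u ∷ []))) ≡ L x) → NPrel A L
  toNPrel {A} r e h = Nondeterministic.accepts A r e (w ⊔ 3)
    (≤-trans (m≤m⊔n _ (width (compile e toℕ 2))) w≤) (≤-trans (m≤n⊔m (width (compile r (λ _ → 0) 2)) _) w≤)
    (s≤s (≤-trans (n≤1+n 2) (m≤n⊔m w 3))) h
    where
    w : ℕ
    w = width (compile r (λ _ → 0) 2) ⊔ width (compile e toℕ 2)
    w≤ : w ≤ suc (w ⊔ 3)
    w≤ = ≤-trans (m≤m⊔n w 3) (n≤1+n _)

-- Expressions for pairing and arithmetic on lengths

pattern x₀ = var zero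
pattern x₁ = var (suc zero)
pattern x₂ = var (suc (suc zero))
pattern x₃ = var (suc (suc (suc zero)))

consE : ∀ {n} → Str → Exp n → Exp n
consE [] e = e
consE (b ∷ s) e = cons b (consE s e)

eval-consE : ∀ {n} A s (e : Exp n) env → eval A (consE s e) env ≡ s ++ eval A e env
eval-consE A [] e env = refl
eval-consE A (b ∷ s) e env = cong (b ∷_) (eval-consE A s e env)

rfold : (Bool → Str) → Str → Str → Str
rfold c [] o = o
rfold c (b ∷ x) o = rfold c x (c b ++ o)

-- With w larger than the length of either block, output and remaining input never exceed w|x| +
-- |o|. The bound (w + |x|)(w + |o|) dominates this, so truncation never cuts anything.
foldX : (Bool → Str) → Exp 2
foldX c = loop x₀ (mul (consE pad x₀) (consE pad x₁))
  (x₁ ∷ x₀ ∷ [])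
  (cond isTrue x₃ (consE (c true) x₂) (consE (c false) x₂) ∷ tl x₃ ∷ []) (# 0)
  where pad = replicate (1 + (length (c true) + length (c false))) true

eval-foldX : ∀ A c x o → eval A (foldX c) (x ∷ o ∷ []) ≡ rfold c x o
eval-foldX A c x o = go x o start
  where
  w = 1 + (length (c true) + length (c false))
  pad = replicate w true
  B = length (eval A (mul (consE {2} pad x₀) (consE pad x₁)) (x ∷ o ∷ []))
  F : Vec Str 2 → Vec Str 2
  F a = Vec.map (take B) (evals A (cond isTrue x₃ (consE (c true) x₂) (consE (c false) x₂) ∷ tl x₃ ∷ []) (x ∷ o ∷ [] Vec.++ a))
  B≡ : B ≡ (w + length x) * (w + length o)
  B≡ = trans (length-replicate (length (eval A (consE {2} pad x₀) (x ∷ o ∷ [])) * _))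
    (cong₂ _*_ (len (# 0)) (len (# 1)))
    where
    len : ∀ i → length (eval A (consE pad (var i)) (x ∷ o ∷ [])) ≡ w + length (lookup (x ∷ o ∷ []) i)
    len i = trans (cong length (eval-consE A pad (var i) (x ∷ o ∷ [])))
      (trans (length-++ pad) (cong (_+ length (lookup (x ∷ o ∷ []) i)) (length-replicate w)))
  start : w * length x + length o ≤ B
  start = ≤-trans (product≤ (length (c true) + length (c false)) (length x) (length o)) (≤-reflexive (sym B≡))
    where
    product≤ : ∀ w a b → suc w * a + b ≤ (suc w + a) * (suc w + b)
    product≤ w a b = ≤-trans (m≤m+n _ (suc w * suc w + (w * b + a * b))) (≤-reflexive (eq w a b))
      where
      eq : ∀ w a b → suc w * a + b + (suc w * suc w + (w * b + a * b)) ≡ (suc w + a) * (suc w + b)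
      eq = solve-∀
  block≤ : ∀ b → suc (length (c b)) ≤ w
  block≤ true = s≤s (m≤m+n _ _)
  block≤ false = s≤s (m≤n+m _ _)
  next : ∀ b (o' r : Str) → (if isTrue (just b) then eval A (consE (c true) x₂) (x ∷ o ∷ o' ∷ (b ∷ r) ∷ [])
                       else eval A (consE (c false) x₂) (x ∷ o ∷ o' ∷ (b ∷ r) ∷ [])) ≡ c b ++ o'
  next true o' r = eval-consE A (c true) x₂ _
  next false o' r = eval-consE A (c false) x₂ _
  go : ∀ r o' → w * length r + length o' ≤ B → lookup (iter (length r) F (o' ∷ r ∷ [])) (# 0) ≡ rfold c r o'
  go [] o' h = refl
  go (b ∷ r) o' h = trans (cong (λ v → lookup (iter (length r) F v) (# 0)) (cong₂ (λ u v → u ∷ v ∷ [])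
      (trans (cong (take B) (next b o' r)) (take-all B (c b ++ o') le)) (take-all B r (≤-trans (m≤n⇒m≤o+n w (m≤n*m (length r) w)) le'))))
      (go r (c b ++ o') (≤-trans (+-monoʳ-≤ (w * length r) (≤-reflexive (length-++ (c b)))) (≤-trans (≤-reflexive (swap (w * length r) (length (c b)) (length o')))
         (≤-trans (+-monoˡ-≤ (length o') (+-monoˡ-≤ (w * length r) (<⇒≤ (block≤ b)))) le''))))
    where
    swap : ∀ a b c → a + (b + c) ≡ b + a + c
    swap = solve-∀
    le'' : w + w * length r + length o' ≤ B
    le'' = ≤-trans (≤-reflexive (cong (_+ length o') (sym (*-suc w (length r))))) h
    le' : w + w * length r ≤ B
    le' = ≤-trans (m≤m+n _ (length o')) le''
    le : length (c b ++ o') ≤ B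
    le = ≤-trans (≤-reflexive (length-++ (c b))) (≤-trans (+-monoˡ-≤ (length o') (≤-trans (<⇒≤ (block≤ b)) (m≤m+n w (w * length r)))) le'')

single doubled : Bool → Str
single b = b ∷ []
doubled b = true ∷ b ∷ []

rfold-single : ∀ x o → rfold single x o ≡ x ʳ++ o
rfold-single [] o = refl
rfold-single (b ∷ x) o = rfold-single x (b ∷ o)

opaque
  revE : ∀ {n} → Exp n → Exp n → Exp n
  revE e o = comp (foldX single) (e ∷ o ∷ [])

  eval-revE : ∀ {n} A (e o : Exp n) env → eval A (revE e o) env ≡ eval A e env ʳ++ eval A o env
  eval-revE A e o env = trans (eval-foldX A single (eval A e env) (eval A o env)) (rfold-single (eval A e env) _)

  -- Self-delimiting: each bit of x is preceded by `true`, and `false` opens y. The bits of x stand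
  -- in reverse order; the decoder stacks them again and so recovers x, after which it idles at the
  -- separator. The length is linear and depends only on the two lengths, which the later padding
  -- relies on.
  pair : Str → Str → Str
  pair x y = rfold doubled x (false ∷ y)

  pairE : ∀ {n} → Exp n → Exp n → Exp n
  pairE a b = comp (foldX doubled) (a ∷ cons false b ∷ [])

  eval-pairE : ∀ {n} A (a b : Exp n) env → eval A (pairE a b) env ≡ pair (eval A a env) (eval A b env)
  eval-pairE A a b env = eval-foldX A doubled (eval A a env) (false ∷ eval A b env)

  length-rfold-doubled : ∀ x o → length (rfold doubled x o) ≡ 2 * length x + length o
  length-rfold-doubled [] o = refl
  length-rfold-doubled (b ∷ x) o = trans (length-rfold-doubled x (true ∷ b ∷ o)) (eq (length x) (length o))
    where
    eq : ∀ a b → 2 * a + (2 + b) ≡ 2 * suc a + b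
    eq = solve-∀

  length-pair : ∀ x y → length (pair x y) ≡ 2 * length x + suc (length y)
  length-pair x y = length-rfold-doubled x (false ∷ y)

  unpStep : Str × Str → Str × Str
  unpStep (o , r) = (if isT r then isT (tail r) ∷ o else o) , (if isT r then tail (tail r) else r)

  decode : Str → Str × Str
  decode p = iter (length p) unpStep ([] , p)

  fst snd : Str → Str
  fst p = proj₁ (decode p)
  snd p = tail (proj₂ (decode p))

  iter-rfold : ∀ x r o k → iter (length x + k) unpStep (o , rfold doubled x r) ≡ iter k unpStep (x ++ o , r)
  iter-rfold [] r o k = refl
  iter-rfold (b ∷ x) r o k = trans (cong (λ n → iter n unpStep (o , rfold doubled x (true ∷ b ∷ r))) (sym (+-suc (length x) k)))
    (iter-rfold x (true ∷ b ∷ r) o (suc k))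

  iter-stop : ∀ k o y → iter k unpStep (o , false ∷ y) ≡ (o , false ∷ y)
  iter-stop zero o y = refl
  iter-stop (suc k) o y = iter-stop k o y

  decode-pair : ∀ x y → decode (pair x y) ≡ (x , false ∷ y)
  decode-pair x y = trans (cong (λ n → iter n unpStep ([] , pair x y)) (trans (length-pair x y) (eq (length x) (length y))))
    (trans (iter-rfold x (false ∷ y) [] (length x + suc (length y)))
      (trans (iter-stop (length x + suc (length y)) (x ++ []) y) (cong (_, false ∷ y) (++-identityʳ x))))
    where
    eq : ∀ a b → 2 * a + suc b ≡ a + (a + suc b)
    eq = solve-∀

  fst-pair : ∀ x y → fst (pair x y) ≡ x
  fst-pair x y = cong proj₁ (decode-pair x y)

  snd-pair : ∀ x y → snd (pair x y) ≡ y
  snd-pair x y = cong (tail ∘ proj₂) (decode-pair x y)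

  unpBodies : Vec (Exp 3) 2
  unpBodies = cond isTrue x₂ (cond isTrue (tl x₂) (cons true x₁) (cons false x₁)) x₁
    ∷ cond isTrue x₂ (tl (tl x₂)) x₂ ∷ []

  unpX : Fin 2 → Exp 1
  unpX j = loop x₀ x₀ (nil ∷ x₀ ∷ []) unpBodies j

  unpNext : Language → Str → Vec Str 2 → Vec Str 2
  unpNext A p a = Vec.map (take (length p)) (evals A unpBodies ((p ∷ []) Vec.++ a))

  eval-unp : ∀ A p t o r → length o + length r ≤ length p →
    iter t (unpNext A p) (o ∷ r ∷ []) ≡
    proj₁ (iter t unpStep (o , r)) ∷ proj₂ (iter t unpStep (o , r)) ∷ []
  eval-unp A p zero o r h = refl
  eval-unp A p (suc t) o [] h =
    trans (cong (λ v → iter t (unpNext A p) v) (cong₂ (λ u v → u ∷ v ∷ []) (take-all (length p) o (m+n≤o⇒m≤o _ h)) (take-all (length p) [] z≤n)))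
      (eval-unp A p t o [] h)
  eval-unp A p (suc t) o (false ∷ r) h =
    trans (cong (λ v → iter t (unpNext A p) v) (cong₂ (λ u v → u ∷ v ∷ []) (take-all (length p) o (m+n≤o⇒m≤o _ h))
        (take-all (length p) (false ∷ r) (m+n≤o⇒n≤o (length o) h))))
      (eval-unp A p t o (false ∷ r) h)
  eval-unp A p (suc t) o (true ∷ []) h =
    trans (cong (λ v → iter t (unpNext A p) v) (cong₂ (λ u v → u ∷ v ∷ []) (take-all (length p) (false ∷ o) (≤-trans (≤-reflexive (+-comm 1 (length o))) h))
        (take-all (length p) [] z≤n)))
      (eval-unp A p t (false ∷ o) [] (≤-trans (≤-reflexive (sym (+-suc (length o) 0))) h))
  eval-unp A p (suc t) o (true ∷ b ∷ r) h = trans (cong (λ v → iter t (unpNext A p) v) (cong₂ (λ u v → u ∷ v ∷ []) (first≡ b)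
      (take-all (length p) r (≤-trans (m≤n+m _ (suc (length o))) le))))
    (eval-unp A p t (b ∷ o) r le)
    where
    le : length (b ∷ o) + length r ≤ length p
    le = ≤-trans (≤-trans (≤-reflexive (sym (+-suc (length o) (length r)))) (+-monoʳ-≤ (length o) (n≤1+n _))) h
    first≡ : ∀ b → take (length p) (if b then true ∷ o else false ∷ o) ≡ b ∷ o
    first≡ true = take-all (length p) (true ∷ o) (m+n≤o⇒m≤o _ le)
    first≡ false = take-all (length p) (false ∷ o) (m+n≤o⇒m≤o _ le)

  decode-length : ∀ p → length (proj₁ (decode p)) + length (proj₂ (decode p)) ≤ length p
  decode-length p = iter-inv (λ { (o , r) → length o + length r ≤ length p }) unpStep
    (λ { (o , r) h → shrink o r h }) (length p) ([] , p) ≤-refl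
    where
    shrink : ∀ o r → length o + length r ≤ length p → length (proj₁ (unpStep (o , r))) + length (proj₂ (unpStep (o , r))) ≤ length p
    shrink o [] h = h
    shrink o (false ∷ r) h = h
    shrink o (true ∷ r) h = ≤-trans (≤-trans (s≤s (+-monoʳ-≤ (length o) (length-tail≤ r))) (≤-reflexive (sym (+-suc (length o) (length r))))) h

  length-fst : ∀ p → length (fst p) ≤ length p
  length-fst p = m+n≤o⇒m≤o _ (decode-length p)

  length-snd : ∀ p → length (snd p) ≤ length p
  length-snd p = ≤-trans (length-tail≤ (proj₂ (decode p))) (m+n≤o⇒n≤o (length (proj₁ (decode p))) (decode-length p))

  fstE sndE : ∀ {n} → Exp n → Exp n
  fstE e = comp (unpX (# 0)) (e ∷ [])
  sndE e = tl (comp (unpX (# 1)) (e ∷ []))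

  eval-fstE : ∀ {n} A (e : Exp n) env → eval A (fstE e) env ≡ fst (eval A e env)
  eval-fstE A e env = cong (λ v → lookup v (# 0)) (eval-unp A (eval A e env) (length (eval A e env)) [] (eval A e env) ≤-refl)

  eval-sndE : ∀ {n} A (e : Exp n) env → eval A (sndE e) env ≡ snd (eval A e env)
  eval-sndE A e env = cong (λ v → tail (lookup v (# 1))) (eval-unp A (eval A e env) (length (eval A e env)) [] (eval A e env) ≤-refl)

  -- `takeE` is a single pass with the identity as body: the truncation built into loops does the
  -- work.
  takeE dropE : ∀ {n} → Exp n → Exp n → Exp n
  takeE m u = loop (cons true nil) m (u ∷ []) (var (_ ↑ʳ zero) ∷ []) zero
  dropE m u = comp (loop x₀ x₁ (x₁ ∷ []) (tl x₂ ∷ []) zero) (m ∷ u ∷ [])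

  eval-takeE : ∀ {n} A (m u : Exp n) env → eval A (takeE m u) env ≡ take (length (eval A m env)) (eval A u env)
  eval-takeE A m u env = cong (take (length (eval A m env))) (lookup-++ʳ env (eval A u env ∷ []) zero)

  eval-dropE : ∀ {n} A (m u : Exp n) env → eval A (dropE m u) env ≡ drop (length (eval A m env)) (eval A u env)
  eval-dropE A m u env = go (length M) U ≤-refl
    where
    M U : Str
    M = eval A m env
    U = eval A u env
    next : Vec Str 1 → Vec Str 1
    next a = Vec.map (take (length U)) (evals A (tl x₂ ∷ []) ((M ∷ U ∷ []) Vec.++ a))
    go : ∀ t v → length v ≤ length U →
      lookup (iter t next (v ∷ [])) zero ≡ drop t v
    go zero v h = refl
    go (suc t) [] h = trans (cong (λ v → lookup (iter t next (v ∷ [])) zero) (take-all (length U) [] z≤n)) (trans (go t [] z≤n) (drop-[] t))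
      where
      drop-[] : ∀ t → drop {A = Bool} t [] ≡ []
      drop-[] zero = refl
      drop-[] (suc t) = refl
    go (suc t) (b ∷ v) h rewrite take-all (length U) v (<⇒≤ h) = go t v (<⇒≤ h)

powE : ∀ {n} → ℕ → Exp n → Exp n
powE zero e = cons true nil
powE (suc d) e = mul (cons true (cons true e)) (powE d e)

length-powE : ∀ {n} A d (e : Exp n) env → length (eval A (powE d e) env) ≡ (2 + length (eval A e env)) ^ d
length-powE A zero e env = refl
length-powE A (suc d) e env = trans (length-replicate ((2 + length (eval A e env)) * length (eval A (powE d e) env)))
  (cong ((2 + length (eval A e env)) *_) (length-powE A d e env))

-- Simulation of Turing machines by expressions

-- All codes have the same length K, so removing a tape symbol is K tails, and a case distinction
-- reads the code bit by bit.
oneHot : ∀ {K} → Fin K → Str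
oneHot {suc K} zero = true ∷ replicate K false
oneHot (suc i) = false ∷ oneHot i

length-oneHot : ∀ {K} (i : Fin K) → length (oneHot i) ≡ K
length-oneHot {suc K} zero = cong suc (length-replicate K)
length-oneHot (suc i) = cong suc (length-oneHot i)

dropHot : ∀ {K} (i : Fin K) v → drop K (oneHot i ++ v) ≡ v
dropHot {suc K} zero v = go K
  where
  go : ∀ K → drop K (replicate K false ++ v) ≡ v
  go zero = refl
  go (suc K) = go K
dropHot (suc i) v = dropHot i v

drop-nil : ∀ K → drop {A = Bool} K [] ≡ []
drop-nil zero = refl
drop-nil (suc K) = refl

tlsE : ∀ {n} → ℕ → Exp n → Exp n
tlsE zero e = e
tlsE (suc K) e = tlsE K (tl e)

eval-tlsE : ∀ {n} A K (e : Exp n) env → eval A (tlsE K e) env ≡ drop K (eval A e env)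
eval-tlsE A zero e env = refl
eval-tlsE A (suc K) e env = trans (eval-tlsE A K (tl e) env) (go (eval A e env))
  where
  go : ∀ v → drop K (tail v) ≡ drop (suc K) v
  go [] = drop-nil K
  go (b ∷ v) = refl

switch : ∀ {n} K → Exp n → Exp n → (Fin K → Exp n) → Exp n
switch zero e d f = d
switch (suc K) e d f = cond isTrue e (f zero) (switch K (tl e) d (f ∘ suc))

eval-switch : ∀ {n} A {K} (e d : Exp n) f env (i : Fin K) v → eval A e env ≡ oneHot i ++ v →
  eval A (switch K e d f) env ≡ eval A (f i) env
eval-switch A e d f env zero v h rewrite h = refl
eval-switch A {suc K} e d f env (suc i) v h rewrite h =
  eval-switch A {K} (tl e) d (f ∘ suc) env i v (cong tail h)

eval-switch-nil : ∀ {n} A K (e d : Exp n) f env → eval A e env ≡ [] → eval A (switch K e d f) env ≡ eval A d env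
eval-switch-nil A zero e d f env h = refl
eval-switch-nil A (suc K) e d f env h rewrite h = eval-switch-nil A K (tl e) d (f ∘ suc) env (cong tail h)

chl : Str → ℕ → Bool
chl [] n = false
chl (b ∷ u) zero = b
chl (b ∷ u) (suc n) = chl u n

chl-head : ∀ u → chl u 0 ≡ isT u
chl-head [] = refl
chl-head (b ∷ u) = refl

chl-tail : ∀ u (X : (ℕ → Bool) → Set) → X (λ n → chl u (suc n)) → X (chl (tail u))
chl-tail [] X p = p
chl-tail (b ∷ u) X p = p

prefix : ℕ → (ℕ → Bool) → Str
prefix zero ch = []
prefix (suc T) ch = ch 0 ∷ prefix T (λ n → ch (suc n))

length-prefix : ∀ T ch → length (prefix T ch) ≡ T
length-prefix zero ch = refl
length-prefix (suc T) ch = cong suc (length-prefix T _)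

-- Simulation of a machine: the accumulators of the loop are the output, the
-- one-hot code of the state, the one-hot codes of the two halves of the tape,
-- the query tape and the remaining choice bits.
module Simulation (A : Language) (M : OTM) where
  open OTM M
  open Ops M

  K : ℕ
  K = 3 + Γ

  encTape : List (Sym Q Γ) → Str
  encTape [] = []
  encTape (s ∷ l) = oneHot s ++ encTape l

  encode : Config M → Str → Vec Str 6
  encode (cfg q l r w) u = [] ∷ oneHot q ∷ encTape l ∷ encTape r ∷ w ∷ u ∷ []

  outV stV lV rV wV chV : Exp 10
  outV = var (# 4)
  stV = var (# 5)
  lV = var (# 6)
  rV = var (# 7)
  wV = var (# 8)
  chV = var (# 9)

  dispatch : (Action Q Γ → Exp 10) → Exp 10
  -- The inner default `onBit q zero` serves an exhausted right half, which reads as blank. The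
  -- outer default `nil` is met only after halting, when the code of the state is empty.
  dispatch g = switch Q stV nil λ q → switch K rV (onBit q zero) (onBit q)
    where
    onBit : Fin Q → Fin K → Exp 10
    onBit q s = cond isTrue chV (g (δ q s true)) (g (δ q s false))

  outE stE lE rE wE : Action Q Γ → Exp 10
  outE accept = cons true nil
  outE reject = cons false nil
  outE _ = nil
  stE (step q _ _ _) = consE (oneHot q) nil
  stE (ask qy qn) = cond isTrue (orc (revE wV nil)) (consE (oneHot qy) nil) (consE (oneHot qn) nil)
  stE _ = nil
  lE (step _ s left _) = tlsE K lV
  lE (step _ s right _) = consE (oneHot s) lV
  lE _ = lV
  rE (step _ s left _) = switch K lV (consE (oneHot blank) r') λ a → consE (oneHot a) r'
    where r' = consE (oneHot s) (tlsE K rV)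
  rE (step _ s right _) = tlsE K rV
  rE (step _ s stay _) = consE (oneHot s) (tlsE K rV)
  rE _ = rV
  wE (step _ _ _ nothing) = wV
  wE (step _ _ _ (just b)) = cons b wV
  wE (ask _ _) = nil
  wE _ = wV

  bodies : Vec (Exp 10) 6
  -- A verdict once produced is frozen, so the loop may run on after the machine has halted.
  bodies = cond isJust outV outV (dispatch outE) ∷ dispatch stE ∷ dispatch lE ∷ dispatch rE ∷ dispatch wE ∷ tl chV ∷ []

  simX : Exp 4
  simX = loop x₀ x₁ (nil ∷ consE (oneHot start) nil ∷ nil ∷ x₂ ∷ nil ∷ x₃ ∷ []) bodies (# 0)

  eval-onTape : ∀ {n} (e : Exp n) f env l → eval A e env ≡ encTape l → eval A (switch K e (f blank) f) env ≡ eval A (f (readHead l)) env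
  eval-onTape e f env [] h = eval-switch-nil A K e (f blank) f env h
  eval-onTape e f env (s ∷ l) h = eval-switch A e (f blank) f env s (encTape l) h

  encTape-write : ∀ s r → encTape (writeHead s r) ≡ oneHot s ++ drop K (encTape r)
  encTape-write s [] = refl
  encTape-write s (a ∷ r) = cong (oneHot s ++_) (sym (dropHot a (encTape r)))

  actVec : Vec Str 4 → Config M → Str → Action Q Γ → Vec Str 6
  actVec e c u a = evals A (outE a ∷ stE a ∷ lE a ∷ rE a ∷ wE a ∷ tl chV ∷ []) (e Vec.++ encode c u)

  eval-dispatch : ∀ g (e : Vec Str 4) q l r w u → eval A (dispatch g) (e Vec.++ encode (cfg q l r w) u) ≡
    eval A (g (δ q (readHead r) (isT u))) (e Vec.++ encode (cfg q l r w) u)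
  eval-dispatch g e@(_ ∷ _ ∷ _ ∷ _ ∷ []) q l r w u =
    trans (eval-switch A stV nil (λ q → switch K rV (bit q zero) (bit q)) env q [] (sym (++-identityʳ (oneHot q))))
      (trans (eval-onTape rV (bit q) env r refl) onBit)
    where
    env = e Vec.++ encode (cfg q l r w) u
    bit : Fin Q → Fin K → Exp 10
    bit q s = cond isTrue chV (g (δ q s true)) (g (δ q s false))
    onBit : (if isT u then eval A (g (δ q (readHead r) true)) env else eval A (g (δ q (readHead r) false)) env) ≡
            eval A (g (δ q (readHead r) (isT u))) env
    onBit with isT u
    ... | true = refl
    ... | false = refl

  evals-bodies : ∀ e q l r w u → evals A bodies (e Vec.++ encode (cfg q l r w) u) ≡ actVec e (cfg q l r w) u (δ q (readHead r) (isT u))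
  evals-bodies e@(_ ∷ _ ∷ _ ∷ _ ∷ []) q l r w u =
    cong₂ _∷_ (eval-dispatch outE e q l r w u) (cong₂ _∷_ (eval-dispatch stE e q l r w u) (cong₂ _∷_ (eval-dispatch lE e q l r w u)
      (cong₂ _∷_ (eval-dispatch rE e q l r w u) (cong₂ _∷_ (eval-dispatch wE e q l r w u) refl))))

  vec5 : ∀ {a a' b b' c c' d d' f f' : Str} → a ≡ a' → b ≡ b' → c ≡ c' → d ≡ d' → f ≡ f' →
    _≡_ {A = Vec Str 5} (a ∷ b ∷ c ∷ d ∷ f ∷ []) (a' ∷ b' ∷ c' ∷ d' ∷ f' ∷ [])
  vec5 refl refl refl refl refl = refl

  after : Fin Q → Sym Q Γ → Move → Maybe Bool → List (Sym Q Γ) → List (Sym Q Γ) → Str → Config M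
  after q s mv o l r w = cfg q (proj₁ (moveHead mv l (writeHead s r))) (proj₂ (moveHead mv l (writeHead s r))) (appendQ o w)

  actVec-step : ∀ e q l r w u q' s mv o → actVec e (cfg q l r w) u (step q' s mv o) ≡
    encode (after q' s mv o l r w) (tail u)
  actVec-step e@(_ ∷ _ ∷ _ ∷ _ ∷ []) q l r w u q' s mv o =
    cong ([] ∷_) (vec5 (trans (eval-consE A (oneHot q') nil env) (++-identityʳ (oneHot q'))) (onL mv l) (onR mv l) (onW o) refl)
    where
    env = e Vec.++ encode (cfg q l r w) u
    r' = consE {10} (oneHot s) (tlsE K rV)
    written : ∀ env' → lookup env' (# 7) ≡ encTape r → eval A r' env' ≡ encTape (writeHead s r)
    written env' h = trans (eval-consE A (oneHot s) (tlsE K rV) env') (trans (cong (oneHot s ++_) (trans (eval-tlsE A K rV env') (cong (drop K) h))) (sym (encTape-write s r)))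
    onL : ∀ mv l → eval A (lE (step q' s mv o)) (e Vec.++ encode (cfg q l r w) u) ≡ encTape (proj₁ (moveHead mv l (writeHead s r)))
    onL left [] = trans (eval-tlsE A K lV (e Vec.++ encode (cfg q [] r w) u)) (drop-nil K)
    onL left (a ∷ l) = trans (eval-tlsE A K lV (e Vec.++ encode (cfg q (a ∷ l) r w) u)) (dropHot a (encTape l))
    onL right l = trans (eval-consE A (oneHot s) lV (e Vec.++ encode (cfg q l r w) u)) (moved r)
      where
      moved : ∀ r → oneHot s ++ encTape l ≡ encTape (proj₁ (moveHead right l (writeHead s r)))
      moved [] = refl
      moved (_ ∷ r) = refl
    onL stay l = refl
    onR : ∀ mv l → eval A (rE (step q' s mv o)) (e Vec.++ encode (cfg q l r w) u) ≡ encTape (proj₂ (moveHead mv l (writeHead s r)))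
    onR left [] = trans (eval-switch-nil A K lV (consE (oneHot blank) r') (λ a → consE (oneHot a) r') env' refl) (trans (eval-consE A (oneHot blank) r' env') (cong (oneHot blank ++_) (written env' refl)))
      where env' = e Vec.++ encode (cfg q [] r w) u
    onR left (a ∷ l) = trans (eval-switch A lV (consE (oneHot blank) r') (λ a → consE (oneHot a) r') env' a (encTape l) refl) (trans (eval-consE A (oneHot a) r' env') (cong (oneHot a ++_) (written env' refl)))
      where env' = e Vec.++ encode (cfg q (a ∷ l) r w) u
    onR right l = trans (eval-tlsE A K rV (e Vec.++ encode (cfg q l r w) u)) (moved r)
      where
      moved : ∀ r → drop K (encTape r) ≡ encTape (proj₂ (moveHead right l (writeHead s r)))
      moved [] = refl
      moved (a ∷ r) = dropHot a (encTape r)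
    onR stay l = written (e Vec.++ encode (cfg q l r w) u) refl
    onW : ∀ o → eval A (wE (step q' s mv o)) env ≡ appendQ o w
    onW nothing = refl
    onW (just b) = refl

  actVec-ask : ∀ e q l r w u qy qn → actVec e (cfg q l r w) u (ask qy qn) ≡ encode (cfg (if A (reverse w) then qy else qn) l r []) (tail u)
  actVec-ask e@(_ ∷ _ ∷ _ ∷ _ ∷ []) q l r w u qy qn = cong ([] ∷_) (vec5 answer refl refl refl refl)
    where
    env = e Vec.++ encode (cfg q l r w) u
    answer : eval A (stE (ask qy qn)) env ≡ oneHot (if A (reverse w) then qy else qn)
    answer rewrite eval-revE A wV nil env with A (reverse w)
    ... | true = trans (eval-consE A (oneHot qy) nil env) (++-identityʳ (oneHot qy))
    ... | false = trans (eval-consE A (oneHot qn) nil env) (++-identityʳ (oneHot qn))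

  weight : Config M → ℕ
  weight (cfg q l r w) = length l + length r + length w

  length-encTape : ∀ l → length (encTape l) ≡ length l * K
  length-encTape [] = refl
  length-encTape (s ∷ l) = trans (length-++ (oneHot s)) (cong₂ _+_ (length-oneHot s) (length-encTape l))

  moveHead-weight : ∀ mv l r → length (proj₁ (moveHead mv l r)) + length (proj₂ (moveHead mv l r)) ≤ 1 + (length l + length r)
  moveHead-weight left [] r = ≤-refl
  moveHead-weight left (a ∷ l) r = ≤-trans (≤-reflexive (+-suc (length l) (length r))) (n≤1+n _)
  moveHead-weight right l [] = ≤-refl
  moveHead-weight right l (a ∷ r) = m≤n⇒m≤1+n (≤-reflexive (sym (+-suc (length l) (length r))))
  moveHead-weight stay l r = n≤1+n _

  writeHead-weight : ∀ s r → length (writeHead s r) ≤ 1 + length r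
  writeHead-weight s [] = ≤-refl
  writeHead-weight s (a ∷ r) = n≤1+n _

  appendQ-weight : ∀ o w → length (appendQ o w) ≤ 1 + length w
  appendQ-weight nothing w = n≤1+n _
  appendQ-weight (just b) w = ≤-refl

  -- Writing beyond the end of the tape, moving off an end and appending to the query tape add at
  -- most one symbol each.
  step-weight : ∀ q q' l r w s mv o →
    weight (after q' s mv o l r w) ≤ 3 + weight (cfg q l r w)
  step-weight q q' l r w s mv o = ≤-trans (+-mono-≤ (≤-trans (moveHead-weight mv l (writeHead s r)) (s≤s (+-monoʳ-≤ (length l) (writeHead-weight s r)))) (appendQ-weight o w))
    (≤-reflexive (eq (length l) (length r) (length w)))
    where
    eq : ∀ a b c → 1 + (a + (1 + b)) + (1 + c) ≡ 3 + (a + b + c)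
    eq = solve-∀

  module _ (e : Vec Str 4) (B : ℕ) where
    next : Vec Str 6 → Vec Str 6
    next a = Vec.map (take B) (evals A bodies (e Vec.++ a))

    stable : ∀ T b v → 1 ≤ B → lookup (iter T next ((b ∷ []) ∷ v)) zero ≡ b ∷ []
    stable zero b v 1≤B = refl
    stable (suc T) b v 1≤B = trans (cong (λ x → lookup (iter T next (x ∷ Vec.tail (next ((b ∷ []) ∷ v)))) zero) (keep e v)) (stable T b (Vec.tail (next ((b ∷ []) ∷ v))) 1≤B)
      where
      keep : ∀ (e : Vec Str 4) v → take B (eval A (cond isJust outV outV (dispatch outE)) (e Vec.++ ((b ∷ []) ∷ v))) ≡ b ∷ []
      keep (_ ∷ _ ∷ _ ∷ _ ∷ []) v = take-all B (b ∷ []) 1≤B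

    take-encode : ∀ c u → (K + 1) * weight c + (1 + Q + length u) ≤ B → Vec.map (take B) (encode c u) ≡ encode c u
    take-encode (cfg q l r w) u h =
      cong₂ _∷_ (take-all B [] z≤n) (vec5 (take-all B (oneHot q) (≤-trans (≤-reflexive (length-oneHot q)) (≤-trans (≤-trans (m≤m+n Q (length u)) (n≤1+n _)) low)))
        (take-all B (encTape l) (≤-trans (≤-reflexive (length-encTape l)) (≤-trans (stored (length l) (≤-trans (m≤m+n _ (length r)) (m≤m+n _ (length w)))) high)))
        (take-all B (encTape r) (≤-trans (≤-reflexive (length-encTape r)) (≤-trans (stored (length r) (≤-trans (m≤n+m _ (length l)) (m≤m+n _ (length w)))) high)))
        (take-all B w (≤-trans (≤-trans (m≤n+m (length w) (length l + length r)) (m≤n*m W (K + 1))) high))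
        (take-all B u (≤-trans (≤-trans (m≤n+m (length u) Q) (n≤1+n _)) low)))
      where
      W = weight (cfg q l r w)
      low : 1 + Q + length u ≤ B
      low = ≤-trans (m≤n+m _ ((K + 1) * W)) h
      high : (K + 1) * W ≤ B
      high = ≤-trans (m≤m+n _ _) h
      stored : ∀ n → n ≤ W → n * K ≤ (K + 1) * W
      stored n n≤W = ≤-trans (≤-reflexive (*-comm n K)) (*-mono-≤ (m≤m+n K 1) n≤W)

    -- The invariant reserves room for three more symbols in each of the T remaining passes, so
    -- truncation leaves every encoding intact. T may exceed t, since the clock runs longer than the
    -- time bound of the machine.
    simulate : ∀ t T c u {b} → run A M t (chl u) c ≡ just b → t ≤ T → (K + 1) * (weight c + 3 * T) + (1 + Q + length u) ≤ B →
      lookup (iter T next (encode c u)) zero ≡ b ∷ []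
    simulate (suc t) (suc T) (cfg q l r w) u {b} h (s≤s t≤T) le =
      trans (cong (λ v → lookup (iter T next (Vec.map (take B) v)) zero) (evals-bodies e q l r w u))
        (onAct (δ q (readHead r) (isT u))
          (subst (λ β → runAct A M t (λ n → chl u (suc n)) (δ q (readHead r) β) l r w ≡ just b) (chl-head u)
            (trans (sym (run-suc A M t (chl u) q l r w)) h)))
      where
      1≤B : 1 ≤ B
      1≤B = ≤-trans (s≤s z≤n) (≤-trans (m≤n+m (1 + Q + length u) _) le)
      u' = tail u
      budget : ∀ c' → weight c' ≤ 3 + weight (cfg q l r w) → (K + 1) * (weight c' + 3 * T) + (1 + Q + length u') ≤ B
      budget c' le' = ≤-trans (+-mono-≤ (*-monoʳ-≤ (K + 1) (≤-trans (+-monoˡ-≤ (3 * T) le') (≤-reflexive (eq (weight (cfg q l r w)) T))))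
                        (+-monoʳ-≤ (1 + Q) (length-tail≤ u))) le
        where
        eq : ∀ a T → 3 + a + 3 * T ≡ a + 3 * suc T
        eq = solve-∀
      continue : ∀ {v} c' → v ≡ encode c' u' → weight c' ≤ 3 + weight (cfg q l r w) → run A M t (λ n → chl u (suc n)) c' ≡ just b →
        lookup (iter T next (Vec.map (take B) v)) zero ≡ b ∷ []
      continue c' refl le' h' = trans (cong (λ v → lookup (iter T next v) zero)
          (take-encode c' u' (≤-trans (+-monoˡ-≤ (1 + Q + length u') (*-monoʳ-≤ (K + 1) (m≤m+n (weight c') (3 * T)))) (budget c' le'))))
        (simulate t T c' u' (chl-tail u (λ ch → run A M t ch c' ≡ just b) h') t≤T (budget c' le'))
      onAct : ∀ a → runAct A M t (λ n → chl u (suc n)) a l r w ≡ just b →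
        lookup (iter T next (Vec.map (take B) (actVec e (cfg q l r w) u a))) zero ≡ b ∷ []
      onAct accept refl = trans (cong (λ x → lookup (iter T next (x ∷ Vec.map (take B) (Vec.tail (actVec e (cfg q l r w) u accept)))) zero) (take-all B (true ∷ []) 1≤B)) (stable T true _ 1≤B)
      onAct reject refl = trans (cong (λ x → lookup (iter T next (x ∷ Vec.map (take B) (Vec.tail (actVec e (cfg q l r w) u reject)))) zero) (take-all B (false ∷ []) 1≤B)) (stable T false _ 1≤B)
      onAct (step q' s mv o) h' = continue _ (actVec-step e q l r w u q' s mv o) (step-weight q q' l r w s mv o) h'
      onAct (ask qy qn) h' = continue _ (actVec-ask e q l r w u qy qn) (≤-trans (+-monoʳ-≤ (length l + length r) z≤n) (m≤n+m _ 3)) h'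

  run-prefix : ∀ t T ch c → t ≤ T → run A M t (chl (prefix T ch)) c ≡ run A M t ch c
  run-prefix zero T ch c le = refl
  run-prefix (suc t) (suc T) ch (cfg q l r w) (s≤s le) =
    trans (run-suc A M t (chl (prefix (suc T) ch)) q l r w)
      (trans (onAct (δ q (readHead r) (ch 0))) (sym (run-suc A M t ch q l r w)))
    where
    onAct : ∀ a → runAct A M t (chl (prefix T (λ n → ch (suc n)))) a l r w ≡ runAct A M t (λ n → ch (suc n)) a l r w
    onAct accept = refl
    onAct reject = refl
    onAct (step q' s mv o) = run-prefix t T _ _ le
    onAct (ask qy qn) = run-prefix t T _ _ le

  bitCode : Bool → Str
  bitCode b = oneHot (bitSym b)

  -- The fold reverses the order of the blocks, whence the reversal.
  tapeE : ∀ {n} → Exp n → Exp n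
  tapeE e = comp (foldX bitCode) (revE e nil ∷ nil ∷ [])

  rfold-ʳ++ : ∀ x y o → rfold bitCode (x ʳ++ y) o ≡ rfold bitCode y (encTape (map bitSym x) ++ o)
  rfold-ʳ++ [] y o = refl
  rfold-ʳ++ (b ∷ x) y o = trans (rfold-ʳ++ x (b ∷ y) o) (cong (rfold bitCode y) (sym (++-assoc (bitCode b) (encTape (map bitSym x)) o)))

  eval-tapeE : ∀ {n} (e : Exp n) env → eval A (tapeE e) env ≡ encTape (map bitSym (eval A e env))
  eval-tapeE e env = trans (eval-foldX A bitCode (eval A (revE e nil) env) []) (trans (cong (λ v → rfold bitCode v []) (eval-revE A e nil env))
    (trans (rfold-ʳ++ (eval A e env) [] []) (++-identityʳ _)))

  module _ (c : ℕ) where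
    clockE : ∀ {n} → Exp n → Exp n
    clockE x = powE (suc c) x

    -- With T the clock, the input weighs at most T and grows by at most 3T, which gives (K + 1) ·
    -- 4T for tape and query. The code of the state takes at most (1 + Q)T, and the choice bits T.
    factor : ℕ
    factor = (K + 1) * 4 + (2 + Q)

    runE : ∀ {n} → Exp n → Exp n → Exp n
    runE x u = comp simX (clockE x ∷ mul (consE (replicate factor true) nil) (clockE x) ∷ tapeE x ∷ u ∷ [])

    bound≤clock : ∀ n → n ^ c + c ≤ (2 + n) ^ suc c
    bound≤clock n = ≤-trans (+-mono-≤ (^-monoˡ-≤ c (m≤n+m n 2)) (≤-trans (n<2^n c) (^-monoˡ-≤ c (m≤m+n 2 n)))) (double≤ n c)

    eval-runE : ∀ {n} (x u : Exp n) env {b} → length (eval A u env) ≤ (2 + length (eval A x env)) ^ suc c →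
      run A M (bound c (eval A x env)) (chl (eval A u env)) (initConfig M (eval A x env)) ≡ just b → eval A (runE x u) env ≡ b ∷ []
    eval-runE x u env {b} le h =
      trans (cong (λ v → lookup (iter (length C) (next E B) v) zero) start≡)
        (simulate E B (bound c X) (length C) (initConfig M X) U h (≤-trans (bound≤clock (length X)) (≤-reflexive (sym lC))) enough)
      where
      X = eval A x env
      U = eval A u env
      C = eval A (clockE x) env
      Bv = eval A (mul (consE (replicate factor true) nil) (clockE x)) env
      B = length Bv
      E : Vec Str 4
      E = C ∷ Bv ∷ eval A (tapeE x) env ∷ U ∷ []
      lC : length C ≡ (2 + length X) ^ suc c
      lC = length-powE A (suc c) x env
      start≡ : evals A (nil ∷ consE (oneHot start) nil ∷ nil ∷ x₂ ∷ nil ∷ x₃ ∷ []) E ≡ encode (initConfig M X) U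
      start≡ = cong ([] ∷_) (vec5 (trans (eval-consE A (oneHot start) nil E) (++-identityʳ _)) refl (eval-tapeE x env) refl refl)
      T = length C
      X≤T : length X ≤ T
      X≤T = ≤-trans (m≤n+m (length X) 2) (≤-trans (m≤m*n (2 + length X) ((2 + length X) ^ c) {{m^n≢0 (2 + length X) c}}) (≤-reflexive (sym lC)))
      1≤T : 1 ≤ T
      1≤T = ≤-trans (m^n>0 (2 + length X) (suc c)) (≤-reflexive (sym lC))
      B≡ : B ≡ factor * T
      B≡ = trans (length-replicate (length (eval A (consE (replicate factor true) nil) env) * T))
        (cong (_* T) (trans (cong length (eval-consE A (replicate factor true) nil env)) (trans (cong length (++-identityʳ (replicate factor true))) (length-replicate factor))))
      weight≡ : weight (initConfig M X) ≡ length X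
      weight≡ = trans (+-identityʳ _) (length-map bitSym X)
      enough : (K + 1) * (weight (initConfig M X) + 3 * T) + (1 + Q + length U) ≤ B
      enough = ≤-trans (+-mono-≤ (*-monoʳ-≤ (K + 1) (+-monoˡ-≤ (3 * T) (≤-trans (≤-reflexive weight≡) X≤T)))
                 (+-mono-≤ (≤-trans (≤-reflexive (sym (*-identityʳ (1 + Q)))) (*-monoʳ-≤ (1 + Q) 1≤T)) (≤-trans le (≤-reflexive (sym lC)))))
               (≤-reflexive (trans (eq K Q T) (sym B≡)))
        where
        eq : ∀ K Q T → (K + 1) * (T + 3 * T) + ((1 + Q) * T + T) ≡ ((K + 1) * 4 + (2 + Q)) * T
        eq = solve-∀

isTrueRun : ∀ {m : Maybe Bool} → Is-just m → ∃ λ b → m ≡ just b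
isTrueRun {just b} _ = b , refl

opaque
  fromPrel : ∀ {A L} → Prel A L → Σ (Exp 1) λ e → ∀ x → isT (eval A e (x ∷ [])) ≡ L x
  fromPrel {A} {L} (M , c , h) = runE c x₀ nil , λ x → cong isT (eval-runE c x₀ nil (x ∷ []) z≤n (h x))
    where open Simulation A M

  fromNPrel : ∀ {A L} → NPrel A L → Σ ℕ λ d → Σ (Exp 2) λ e → ∀ x → anyBits ((2 + length x) ^ d) (λ u → isT (eval A e (x ∷ u ∷ []))) ≡ L x
  fromNPrel {A} {L} (M , c , tot , acc) = suc c , runE c x₀ x₁ , λ x → Bool-ext (sound x) (complete x)
    where
    open Simulation A M
    sound : ∀ x → anyBits ((2 + length x) ^ suc c) (λ u → isT (eval A (runE c x₀ x₁) (x ∷ u ∷ []))) ≡ true → L x ≡ true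
    sound x h with anyBits-elim _ _ h
    ... | u , lu , q with isTrueRun (tot x (chl u))
    ...   | b , e = proj₂ (acc x) (chl u , trans e (cong just (trans (sym (cong isT (eval-runE c x₀ x₁ (x ∷ u ∷ []) (≤-reflexive lu) e))) q)))
    complete : ∀ x → L x ≡ true → anyBits ((2 + length x) ^ suc c) (λ u → isT (eval A (runE c x₀ x₁) (x ∷ u ∷ []))) ≡ true
    complete x h with proj₁ (acc x) h
    ... | ch , e = subst (λ n → anyBits n f ≡ true) (length-prefix T ch) (anyBits-intro f (prefix T ch)
          (cong isT (eval-runE c x₀ x₁ (x ∷ prefix T ch ∷ []) (≤-reflexive (length-prefix T ch))
            (trans (run-prefix (bound c x) T ch (initConfig M x) (bound≤clock c (length x))) e))))
      where
      T : ℕ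
      T = (2 + length x) ^ suc c
      f : Str → Bool
      f u = isT (eval A (runE c x₀ x₁) (x ∷ u ∷ []))

-- Closure properties of the hierarchy

Reduction : (Str → Str) → Set
Reduction g = Σ (Exp 1) λ e → ∀ A x → eval A e (x ∷ []) ≡ g x

red-id : Reduction id
red-id = var zero , λ A x → refl

red-nil : Reduction (λ _ → [])
red-nil = nil , λ A x → refl

red-cons : ∀ b {g} → Reduction g → Reduction (λ x → b ∷ g x)
red-cons b (e , h) = cons b e , λ A x → cong (b ∷_) (h A x)

red-fst : ∀ {g} → Reduction g → Reduction (λ x → fst (g x))
red-fst (e , h) = fstE e , λ A x → trans (eval-fstE A e _) (cong fst (h A x))

red-snd : ∀ {g} → Reduction g → Reduction (λ x → snd (g x))
red-snd (e , h) = sndE e , λ A x → trans (eval-sndE A e _) (cong snd (h A x))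

red-pair : ∀ {g g'} → Reduction g → Reduction g' → Reduction (λ x → pair (g x) (g' x))
red-pair (e , h) (e' , h') = pairE e e' , λ A x → trans (eval-pairE A e e' _) (cong₂ pair (h A x) (h' A x))

-- Composition of oracle computations

mutual
  -- Substitutes `f` for the oracle and carries one extra variable z through all scopes, so that the
  -- answers may depend on a parameter. For plain composition z is empty; in `parametrise` it is
  -- appended to each query.
  interpret : ∀ {n} → Exp 2 → Exp n → Exp (suc n)
  interpret f (var i) = var (suc i)
  interpret f nil = nil
  interpret f (cons b e) = cons b (interpret f e)
  interpret f (tl e) = tl (interpret f e)
  interpret f (cond φ e a b) = cond φ (interpret f e) (interpret f a) (interpret f b)
  interpret f (orc e) = comp f (x₀ ∷ interpret f e ∷ [])
  interpret f (mul a b) = mul (interpret f a) (interpret f b)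
  interpret f (comp g es) = comp (interpret f g) (x₀ ∷ interprets f es)
  interpret f (loop c d is bs j) = loop (interpret f c) (interpret f d) (interprets f is) (interprets f bs) j

  interprets : ∀ {n m} → Exp 2 → Vec (Exp n) m → Vec (Exp (suc n)) m
  interprets f [] = []
  interprets f (e ∷ es) = interpret f e ∷ interprets f es

iter-ext : {X : Set} {f g : X → X} → (∀ a → f a ≡ g a) → ∀ t a → iter t f a ≡ iter t g a
iter-ext h t a = iter-cong (λ _ → ⊤) (λ a _ → h a , tt) t tt

module _ {A B : Language} (f : Exp 2) (z : Str) (h : ∀ q → eval B f (z ∷ q ∷ []) ≡ A q ∷ []) where
  mutual
    eval-interpret : ∀ {n} (e : Exp n) env → eval B (interpret f e) (z ∷ env) ≡ eval A e env
    eval-interpret (var i) env = refl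
    eval-interpret nil env = refl
    eval-interpret (cons b e) env = cong (b ∷_) (eval-interpret e env)
    eval-interpret (tl e) env = cong tail (eval-interpret e env)
    eval-interpret (cond φ e a b) env
      rewrite eval-interpret e env | eval-interpret a env | eval-interpret b env = refl
    eval-interpret (orc e) env = trans (cong (λ v → eval B f (z ∷ v ∷ [])) (eval-interpret e env)) (h _)
    eval-interpret (mul a b) env = cong₂ (λ x y → replicate (length x * length y) true) (eval-interpret a env) (eval-interpret b env)
    eval-interpret (comp g es) env =
      trans (cong (λ v → eval B (interpret f g) (z ∷ v)) (evals-interpret es env)) (eval-interpret g (evals A es env))
    eval-interpret (loop c d is bs j) env
      rewrite eval-interpret c env | eval-interpret d env | evals-interpret is env =
      cong (λ v → lookup v j) (iter-ext (λ a → cong (Vec.map (take (length (eval A d env)))) (evals-interpret bs (env Vec.++ a))) (length (eval A c env)) (evals A is env))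

    evals-interpret : ∀ {n m} (es : Vec (Exp n) m) env → evals B (interprets f es) (z ∷ env) ≡ evals A es env
    evals-interpret [] env = refl
    evals-interpret (e ∷ es) env = cong₂ _∷_ (eval-interpret e env) (evals-interpret es env)

bitE : ∀ {n} → Exp n → Exp n
bitE e = cond isTrue e (cons true nil) (cons false nil)

eval-bitE : ∀ {n} A (e : Exp n) env → eval A (bitE e) env ≡ isT (eval A e env) ∷ []
eval-bitE A e env with isT (eval A e env)
... | true = refl
... | false = refl

Computes : Language → Language → Set
Computes B A = Σ (Exp 2) λ f → ∀ q → eval B f ([] ∷ q ∷ []) ≡ A q ∷ []

computes : ∀ {A B} → Prel B A → Computes B A
computes {A} {B} p with fromPrel p
... | e , h = bitE (comp e (x₁ ∷ [])) , λ q → trans (eval-bitE B (comp e (x₁ ∷ [])) ([] ∷ q ∷ [])) (cong (_∷ []) (h q))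

recast : ∀ {A B n} → Computes B A → Exp n → Exp n
recast (f , _) e = comp (interpret f e) (nil ∷ Vec.tabulate var)

evals-vars : ∀ {n} A (env : Vec Str n) → evals A (Vec.tabulate var) env ≡ env
evals-vars {n} A env = go env id (λ _ → refl)
  where
  go : ∀ {m} (v : Vec Str m) (ι : Fin m → Fin n) → (∀ i → lookup env (ι i) ≡ lookup v i) → evals A (Vec.tabulate (var ∘ ι)) env ≡ v
  go [] ι h = refl
  go (x ∷ v) ι h = cong₂ _∷_ (h zero) (go v (ι ∘ suc) (h ∘ suc))

eval-recast : ∀ {A B n} (c : Computes B A) (e : Exp n) env → eval B (recast {A} {B} c e) env ≡ eval A e env
eval-recast {A} {B} (f , h) e env =
  trans (cong (λ v → eval B (interpret f e) ([] ∷ v)) (evals-vars B env)) (eval-interpret f [] h e env)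

Prel-trans : ∀ {A B L} → Prel B A → Prel A L → Prel B L
Prel-trans {A} {B} b a with computes b | fromPrel a
... | c , hc | e , h = toPrel (recast {A} {B} (c , hc) e) λ x → trans (cong isT (eval-recast (c , hc) e (x ∷ []))) (h x)

NPrel-trans : ∀ {A B L} → Prel B A → NPrel A L → NPrel B L
NPrel-trans {A} {B} b a with computes b | fromNPrel a
... | c , hc | d , e , h = toNPrel (powE d x₀) (recast {A} {B} (c , hc) e) λ x →
  trans (cong₂ anyBits (length-powE B d x₀ (x ∷ [])) refl)
    (trans (anyBits-cong ((2 + length x) ^ d) λ u _ → cong isT (eval-recast (c , hc) e (x ∷ u ∷ []))) (h x))

NPrel-ext : ∀ {A L L'} → (∀ x → L x ≡ L' x) → NPrel A L → NPrel A L'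
NPrel-ext e (M , c , tot , acc) = M , c , tot , λ x →
  (λ q → proj₁ (acc x) (trans (e x) q)) , λ q → trans (sym (e x)) (proj₂ (acc x) q)

Prel-reduce : ∀ {A L g} → Reduction g → Prel A L → Prel A (λ x → L (g x))
Prel-reduce {A} {g = g} (ge , hg) p with fromPrel p
... | e , h = toPrel (comp e (ge ∷ [])) λ x → trans (cong (λ v → isT (eval A e (v ∷ []))) (hg A x)) (h (g x))

NPrel-reduce : ∀ {A L g} → Reduction g → NPrel A L → NPrel A (λ x → L (g x))
NPrel-reduce {A} {g = g} (ge , hg) p with fromNPrel p
... | d , e , h = toNPrel (powE d ge) (comp e (comp ge (x₀ ∷ []) ∷ x₁ ∷ [])) λ x →
  trans (cong₂ anyBits (trans (length-powE A d ge (x ∷ [])) (cong (λ v → (2 + length v) ^ d) (hg A x))) refl)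
    (trans (anyBits-cong ((2 + length (g x)) ^ d) λ u _ → cong (λ v → isT (eval A e (v ∷ u ∷ []))) (hg A x)) (h (g x)))

Prel-query : ∀ A → Prel A A
Prel-query A = toPrel (orc x₀) λ x → refl

P⇒NP : ∀ {A L} → Prel A L → NPrel A L
P⇒NP p with fromPrel p
... | e , h = toNPrel nil (comp e (x₀ ∷ [])) h

infixr 6 _⊕_
_⊕_ : Language → Language → Language
(A ⊕ B) q = if isT q then A (tail q) else B (tail q)

∅∈P : Prel ∅ ∅
∅∈P = toPrel nil λ x → refl

-- Level 1 is defined as NP, not as NP with an oracle in P. Together with its converse this lets
-- every induction treat all successor levels alike.
Σ⇒NP : ∀ k {L} → Σp (suc k) L → NP^ (Σp k) L
Σ⇒NP zero p = ∅ , ∅∈P , p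
Σ⇒NP (suc k) p = p

NP⇒Σ : ∀ k {L} → NP^ (Σp k) L → Σp (suc k) L
NP⇒Σ zero (A , a , p) = NPrel-trans a p
NP⇒Σ (suc k) p = p

queryˡ : ∀ {A B} → Prel (A ⊕ B) A
queryˡ = toPrel (orc (cons true x₀)) λ x → refl

queryʳ : ∀ {A B} → Prel (A ⊕ B) B
queryʳ = toPrel (orc (cons false x₀)) λ x → refl

Prel-join : ∀ {X A B} → Prel X A → Prel X B → Prel X (A ⊕ B)
Prel-join {X} {A} {B} a b with fromPrel a | fromPrel b
... | e , h | e' , h' = toPrel (cond isTrue x₀ (comp e (tl x₀ ∷ [])) (comp e' (tl x₀ ∷ []))) λ x → branch x (isT x)
  where
  branch : ∀ x t → isT (if t then eval X e (tail x ∷ []) else eval X e' (tail x ∷ [])) ≡ (if t then A (tail x) else B (tail x))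
  branch x true = h (tail x)
  branch x false = h' (tail x)

NPrel-join : ∀ {X A B} → NPrel X A → NPrel X B → NPrel X (A ⊕ B)
NPrel-join {X} {A} {B} a b with fromNPrel a | fromNPrel b
... | d , e , h | d' , e' , h' =
  toNPrel (cond isTrue x₀ (powE d (tl x₀)) (powE d' (tl x₀))) (cond isTrue x₀ (comp e (tl x₀ ∷ x₁ ∷ [])) (comp e' (tl x₀ ∷ x₁ ∷ [])))
    λ x → branch x (isT x)
  where
  branch : ∀ x t → anyBits (length (if t then eval X (powE d (tl x₀)) (x ∷ []) else eval X (powE d' (tl x₀)) (x ∷ [])))
    (λ u → isT (if t then eval X e (tail x ∷ u ∷ []) else eval X e' (tail x ∷ u ∷ []))) ≡ (if t then A (tail x) else B (tail x))
  branch x true = trans (cong₂ anyBits (length-powE X d (tl x₀) (x ∷ [])) refl) (h (tail x))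
  branch x false = trans (cong₂ anyBits (length-powE X d' (tl x₀) (x ∷ [])) refl) (h' (tail x))

-- The two machines may use different oracles; their join, which exists one level down by recursion,
-- answers for both. This takes the place of complete sets whenever several oracles must become one.
Σ-join : ∀ k {A B} → Σp k A → Σp k B → Σp k (A ⊕ B)
Σ-join zero a b = Prel-join a b
Σ-join (suc k) a b with Σ⇒NP k a | Σ⇒NP k b
... | X , x , p | Y , y , q = NP⇒Σ k (X ⊕ Y , Σ-join k x y , NPrel-join (NPrel-trans (queryˡ {X} {Y}) p) (NPrel-trans (queryʳ {X} {Y}) q))

Δ-closed : ∀ k {O L} → P^ (Σp k) O → Prel O L → P^ (Σp k) L
Δ-closed k (X , x , p) q = X , x , Prel-trans p q

ΔNP⇒Σ : ∀ k {O L} → P^ (Σp k) O → NPrel O L → Σp (suc k) L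
ΔNP⇒Σ k (X , x , p) q = NP⇒Σ k (X , x , NPrel-trans p q)

Δ-join : ∀ k {A B} → P^ (Σp k) A → P^ (Σp k) B → P^ (Σp k) (A ⊕ B)
Δ-join k (X , x , p) (Y , y , q) = X ⊕ Y , Σ-join k x y ,
  Prel-join (Prel-trans (queryˡ {X} {Y}) p) (Prel-trans (queryʳ {X} {Y}) q)

Δ-reduce : ∀ k {L g} → Reduction g → P^ (Σp k) L → P^ (Σp k) (λ x → L (g x))
Δ-reduce k r (X , x , p) = X , x , Prel-reduce r p

Σ-reduce : ∀ k {L g} → Reduction g → Σp (suc k) L → Σp (suc k) (λ x → L (g x))
Σ-reduce k r p with Σ⇒NP k p
... | X , x , q = NP⇒Σ k (X , x , NPrel-reduce r q)

Σ-ext : ∀ k {L L'} → (∀ x → L x ≡ L' x) → Σp (suc k) L → Σp (suc k) L'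
Σ-ext zero e p = NPrel-ext e p
Σ-ext (suc k) e (A , a , p) = A , a , NPrel-ext e p

Σ⇒Δ : ∀ k {L} → Σp k L → P^ (Σp k) L
Σ⇒Δ k {L} p = L , p , Prel-query L

Δ⇒Σ : ∀ k {L} → P^ (Σp k) L → Σp (suc k) L
Δ⇒Σ k (X , x , p) = NP⇒Σ k (X , x , P⇒NP p)

lift : ∀ i d {L} → Σp (suc i) L → P^ (Σp (suc d + i)) L
lift i zero p = Σ⇒Δ (suc i) p
lift i (suc d) p = Σ⇒Δ (suc (suc d + i)) (Δ⇒Σ (suc d + i) (lift i d p))

Δ-bool : ∀ k (φ : Bool → Bool → Bool) {A B} → P^ (Σp k) A → P^ (Σp k) B → P^ (Σp k) (λ x → φ (A x) (B x))
Δ-bool k φ {A} {B} a b = Δ-closed k (Δ-join k a b)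
  (toPrel (cond isTrue (orc (cons true x₀)) (row true) (row false)) λ x → table (A x) (B x))
  where
  row : Bool → Exp 1
  row s = cond isTrue (orc (cons false x₀)) (cons (φ s true) nil) (cons (φ s false) nil)
  table : ∀ s t → isT (if s then (if t then φ true true ∷ [] else φ true false ∷ []) else (if t then φ false true ∷ [] else φ false false ∷ [])) ≡ φ s t
  table true true = refl
  table true false = refl
  table false true = refl
  table false false = refl

Σ-normal : ∀ k {L} → Σp (suc k) L → Σ Language λ R → P^ (Σp k) R × Σ ℕ λ d →
  ∀ x → anyBits ((2 + length x) ^ d) (λ u → R (pair x u)) ≡ L x
Σ-normal k {L} p with Σ⇒NP k p
... | X , x , q with fromNPrel q
...   | d , e , h = (λ s → isT (eval X e (fst s ∷ snd s ∷ []))) ,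
    (X , x , toPrel (comp e (fstE x₀ ∷ sndE x₀ ∷ [])) λ s →
      cong₂ (λ v w → isT (eval X e (v ∷ w ∷ []))) (eval-fstE X x₀ (s ∷ [])) (eval-sndE X x₀ (s ∷ []))) ,
    d , λ x → trans (anyBits-cong ((2 + length x) ^ d) λ u _ → cong₂ (λ v w → isT (eval X e (v ∷ w ∷ []))) (fst-pair x u) (snd-pair x u)) (h x)

DIFF-ext : ∀ m k {L L'} → (∀ x → L x ≡ L' x) → DIFF (suc m) (Σp (suc k)) L → DIFF (suc m) (Σp (suc k)) L'
DIFF-ext zero k e p = Σ-ext k e p
DIFF-ext (suc m) k e (L₁ , L₂ , p₁ , p₂ , h) = L₁ , L₂ , p₁ , p₂ , λ x → trans (sym (e x)) (h x)

DIFF-reduce : ∀ m k {L g} → Reduction g → DIFF (suc m) (Σp (suc k)) L → DIFF (suc m) (Σp (suc k)) (λ x → L (g x))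
DIFF-reduce zero k r p = Σ-reduce k r p
DIFF-reduce (suc m) k {g = g} r (L₁ , L₂ , p₁ , p₂ , h) =
  (λ x → L₁ (g x)) , (λ x → L₂ (g x)) , Σ-reduce k r p₁ , DIFF-reduce m k r p₂ , λ x → h (g x)

-- Lowering a tower of oracles

-- V replaces the oracle; queries are passed on together with the parameter z.
parametrise : Exp 2 → ℕ → Language → Language
parametrise e d V p = anyBits ((2 + length (fst p)) ^ d) (λ u → isT (eval (λ q → V (pair q (snd p))) e (fst p ∷ u ∷ [])))

parametrise-NP : ∀ e d V → NPrel V (parametrise e d V)
parametrise-NP e d V = toNPrel (powE d (fstE x₀)) (comp (interpret f e) (sndE x₀ ∷ fstE x₀ ∷ x₁ ∷ []))
  λ p → trans (cong₂ anyBits (trans (length-powE V d (fstE x₀) (p ∷ [])) (cong (λ v → (2 + length v) ^ d) (eval-fstE V x₀ (p ∷ [])))) refl)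
    (anyBits-cong ((2 + length (fst p)) ^ d) λ u _ → cong isT
      (trans (cong₂ (λ v w → eval V (interpret f e) (v ∷ w ∷ u ∷ [])) (eval-sndE V x₀ (p ∷ u ∷ [])) (eval-fstE V x₀ (p ∷ u ∷ [])))
        (eval-interpret f (snd p) (λ q → cong (λ v → V v ∷ []) (eval-pairE V x₁ x₀ (snd p ∷ q ∷ []))) e (fst p ∷ u ∷ []))))
  where
  f : Exp 2
  f = orc (pairE x₁ x₀)

QueryBound : Exp 2 → ℕ → Set
QueryBound e d = PolyBounded (λ n → cost e (n + (2 + n) ^ d))

queryBound : ∀ e d → QueryBound e d
queryBound e d = poly-∘ (cost-poly e) (poly-+ poly-id (d , λ n → ≤-refl))

-- By `eval-local`, runs on x with guesses of the given length see only queries within `queryBound`,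
-- so V has to imitate O only there.
parametrise-correct : ∀ e d V {O : Language} x z →
  (∀ q → length q ≤ (2 + length x) ^ proj₁ (queryBound e d) → V (pair q z) ≡ O q) →
  parametrise e d V (pair x z) ≡ anyBits ((2 + length x) ^ d) (λ u → isT (eval O e (x ∷ u ∷ [])))
parametrise-correct e d V {O} x z h = trans
  (cong₂ (λ v w → anyBits ((2 + length v) ^ d) (λ u → isT (eval (λ q → V (pair q w)) e (v ∷ u ∷ [])))) (fst-pair x z) (snd-pair x z))
  (anyBits-cong ((2 + length x) ^ d) λ u lu → cong isT
    (eval-local e (x ∷ u ∷ []) (length x + (2 + length x) ^ d)
      (λ { zero → m≤m+n _ _ ; (suc zero) → ≤-trans (≤-reflexive lu) (m≤n+m _ (length x)) })
      λ q l → h q (≤-trans l (proj₂ (queryBound e d) (length x)))))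

-- The order of the quantifiers matters: U and the length bound c depend on L alone and precede A,
-- because A will come from the hypothesis applied to the search problem of U. V is promised to be
-- right only for those z whose slice of A agrees with U on the queries that x can cause.
Lowers : ℕ → Class → Language → Set
Lowers i C L = Σ Language λ U → Σp (suc i) U × Σ ℕ λ c → ∀ A → P^ (Σp i) A → Σ Language λ V → C V ×
  (∀ x z → (∀ q → length q ≤ (2 + length x) ^ c → A (pair q z) ≡ U q) → V (pair x z) ≡ L x)

-- Replacing the bottom oracle in Σ_(i+1) by one in Δ_(i+1) = P^(Σ_i) brings the level resting on it
-- down to NP^(Σ_i) = Σ_(i+1). Each further level then rests on an oracle one level lower than
-- before. Bounds on query lengths compose along the tower.
lower-Σ : ∀ i d {L} → Σp (suc (suc d + i)) L → Lowers i (Σp (suc d + i)) L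
lower-Σ i zero p with Σ⇒NP (suc i) p
... | O , o , q with fromNPrel q
...   | d , e , h = O , o , proj₁ (queryBound e d) , λ A a → parametrise e d A ,
        ΔNP⇒Σ i a (parametrise-NP e d A) , λ x z k → trans (parametrise-correct e d A x z k) (h x)
lower-Σ i (suc s) p with Σ⇒NP (suc (suc s + i)) p
... | O , o , q with fromNPrel q | lower-Σ i s o
...   | d , e , h | U , u , c , low = U , u , proj₁ comp≤ , λ A a → let (V , v , k) = low A a in
        parametrise e d V , NP⇒Σ (suc s + i) (V , v , parametrise-NP e d V) , λ x z hard →
          trans (parametrise-correct e d V x z λ q' l → k q' z λ q l' → hard q (≤-trans l' (≤-trans (^-monoˡ-≤ c (+-monoʳ-≤ 2 l)) (proj₂ comp≤ (length x))))) (h x)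
  where
  comp≤ = poly-∘ {λ n → (2 + n) ^ c} {λ n → (2 + n) ^ proj₁ (queryBound e d)} (c , λ n → ≤-refl) (proj₁ (queryBound e d) , λ n → ≤-refl)

-- Each set of the chain has its own bottom oracle, and their marked union becomes the single U; a
-- slice of A fixes the mark. The lowered sets are one level below the original ones, so their
-- Boolean combination is in Δ of the original level.
lower-DIFF : ∀ m i d {L} → DIFF (suc m) (Σp (suc (suc d + i))) L → Lowers i (P^ (Σp (suc d + i))) L
lower-DIFF zero i d p with lower-Σ i d p
... | U , u , c , low = U , u , c , λ A a → let (V , v , k) = low A a in V , Σ⇒Δ (suc d + i) v , k
lower-DIFF (suc m) i d {L} (L₁ , L₂ , p₁ , p₂ , h) with lower-Σ i d p₁ | lower-DIFF m i d p₂
-- The additional power of `2 + length x` pays for the mark in front of the query.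
... | U₁ , u₁ , c₁ , low₁ | U₂ , u₂ , c₂ , low₂ = U₁ ⊕ U₂ , Σ-join (suc i) u₁ u₂ , suc (c₁ + c₂) , λ A a →
    let (V₁ , v₁ , k₁) = low₁ (branch A true) (Δ-reduce i (red true) a)
        (V₂ , v₂ , k₂) = low₂ (branch A false) (Δ-reduce i (red false) a)
    in (λ p → V₁ p ∧ not (V₂ p)) , Δ-bool (suc d + i) (λ a b → a ∧ not b) (Σ⇒Δ (suc d + i) v₁) v₂ , λ x z hard →
      trans (cong₂ (λ a b → a ∧ not b)
        (k₁ x z λ q l → trans (branch-pair A true q z) (hard (true ∷ q) (longer x q c₁ l (m≤m+n c₁ c₂))))
        (k₂ x z λ q l → trans (branch-pair A false q z) (hard (false ∷ q) (longer x q c₂ l (m≤n+m c₂ c₁))))) (sym (h x))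
  where
  branch : Language → Bool → Language
  branch A b p = A (pair (b ∷ fst p) (snd p))
  branch-pair : ∀ A b q z → branch A b (pair q z) ≡ A (pair (b ∷ q) z)
  branch-pair A b q z = cong₂ (λ v w → A (pair (b ∷ v) w)) (fst-pair q z) (snd-pair q z)
  red : ∀ b → Reduction (λ p → pair (b ∷ fst p) (snd p))
  red b = red-pair (red-cons b (red-fst red-id)) (red-snd red-id)
  longer : ∀ (x q : Str) c → length q ≤ (2 + length x) ^ c → c ≤ c₁ + c₂ → suc (length q) ≤ (2 + length x) ^ suc (c₁ + c₂)
  longer x q c l c≤ = ≤-trans (+-mono-≤ (m^n>0 (2 + length x) (c₁ + c₂)) (≤-trans l (^-mono-exp (length x) c≤))) (double≤ (length x) (c₁ + c₂))

-- Existential quantifiers and conjunctions in the hierarchy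

anyBits-+ : ∀ n m f → anyBits (n + m) f ≡ anyBits n (λ u → anyBits m (λ v → f (u ++ v)))
anyBits-+ zero m f = refl
anyBits-+ (suc n) m f = cong₂ _∨_ (anyBits-+ n m (f ∘ (false ∷_))) (anyBits-+ n m (f ∘ (true ∷_)))

anyBits-∨ : ∀ n b f → anyBits n (λ u → b ∨ f u) ≡ b ∨ anyBits n f
anyBits-∨ zero b f = refl
anyBits-∨ (suc n) b f rewrite anyBits-∨ n b (f ∘ (false ∷_)) | anyBits-∨ n b (f ∘ (true ∷_)) with b
... | true = refl
... | false = refl

anyBits-false : ∀ n f → (∀ u → length u ≡ n → f u ≡ false) → anyBits n f ≡ false
anyBits-false n f h = Bool-ext (λ e → let (u , l , q) = anyBits-elim n f e in trans (sym (h u l)) q) (λ ())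

anyBits-∧ : ∀ n b f → anyBits n (λ u → b ∧ f u) ≡ b ∧ anyBits n f
anyBits-∧ n true f = refl
anyBits-∧ n false f = anyBits-false n _ λ _ _ → refl

take-++-≡ : ∀ n (u v : Str) → length u ≡ n → take n (u ++ v) ≡ u
take-++-≡ zero [] v e = refl
take-++-≡ (suc n) (b ∷ u) v e = cong (b ∷_) (take-++-≡ n u v (suc-injective e))

drop-++-≡ : ∀ n (u v : Str) → length u ≡ n → drop n (u ++ v) ≡ v
drop-++-≡ zero [] v e = refl
drop-++-≡ (suc n) (b ∷ u) v e = drop-++-≡ n u v (suc-injective e)

anyBits-split : ∀ n m (f : Str → Str → Bool) → anyBits (n + m) (λ s → f (take n s) (drop n s)) ≡ anyBits n (λ u → anyBits m (λ v → f u v))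
anyBits-split n m f = trans (anyBits-+ n m _) (anyBits-cong n λ u lu → anyBits-cong m λ v _ → cong₂ f (take-++-≡ n u v lu) (drop-++-≡ n u v lu))

length-revpow : ∀ {n} A (r s : Exp n) env → length (eval A (revE r s) env) ≡ length (eval A r env) + length (eval A s env)
length-revpow A r s env = trans (cong length (eval-revE A r s env)) (length-ʳ++ (eval A r env))

opaque
  -- The quantified y and the witness for F are guessed as one string, which is then cut. Since y
  -- has an exact length determined by z, the length of ⟨y,z⟩, and with it that of the witness, is
  -- known before guessing.
  Σ-∃ : ∀ k g {F H} → Σp (suc k) F → P^ (Σp k) H →
    Σp (suc k) (λ z → H z ∨ anyBits ((2 + length z) ^ g) (λ y → F (pair y z)))
  Σ-∃ k g {F} {H} f h with Σ-normal k f
  ... | R , r , d , hR = ΔNP⇒Σ k (Δ-join k h r)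
      (toNPrel (revE n₁ n₂) (cond isTrue q₁ (cons true nil) q₂) λ z →
        trans (cong₂ anyBits (trans (length-revpow O n₁ n₂ (z ∷ [])) (cong₂ _+_ (length-powE O g x₀ (z ∷ [])) (length₂ z))) refl)
          (trans (anyBits-cong (N z + N' z) λ s _ → both z s)
            (trans (anyBits-∨ (N z + N' z) (H z) (λ s → R (pair (pair (take (N z) s) z) (drop (N z) s))))
              (cong (H z ∨_) (trans (anyBits-split (N z) (N' z) (λ y v → R (pair (pair y z) v)))
                (anyBits-cong (N z) λ y ly → trans (cong (λ n → anyBits ((2 + n) ^ d) (λ v → R (pair (pair y z) v))) (length-yz y z ly)) (hR (pair y z))))))))
    where
    O : Language
    O = H ⊕ R
    N N' : Str → ℕ
    N z = (2 + length z) ^ g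
    N' z = (2 + (2 * N z + suc (length z))) ^ d
    n₁ n₂ : Exp 1
    n₁ = powE g x₀
    -- Only lengths count here, so a unary string of the right length stands in for y, which is not
    -- yet known.
    n₂ = powE d (pairE (powE g x₀) x₀)
    length-yz : ∀ y z → length y ≡ N z → 2 * N z + suc (length z) ≡ length (pair y z)
    length-yz y z ly = trans (cong (λ n → 2 * n + suc (length z)) (sym ly)) (sym (length-pair y z))
    length₂ : ∀ z → length (eval O n₂ (z ∷ [])) ≡ N' z
    length₂ z = trans (length-powE O d (pairE (powE g x₀) x₀) (z ∷ []))
      (cong (λ n → (2 + n) ^ d) (trans (cong length (eval-pairE O (powE g x₀) x₀ (z ∷ [])))
        (sym (length-yz (eval O (powE g x₀) (z ∷ [])) z (length-powE O g x₀ (z ∷ []))))))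
    q₁ q₂ : Exp 2
    q₁ = orc (cons true x₀)
    q₂ = orc (cons false (pairE (pairE (takeE (powE g x₀) x₁) x₀) (dropE (powE g x₀) x₁)))
    both : ∀ z s → isT (eval O (cond isTrue q₁ (cons true nil) q₂) (z ∷ s ∷ [])) ≡ H z ∨ R (pair (pair (take (N z) s) z) (drop (N z) s))
    both z s rewrite eval-pairE O (pairE (takeE (powE g x₀) x₁) x₀) (dropE (powE g x₀) x₁) (z ∷ s ∷ [])
                   | eval-pairE O (takeE (powE g x₀) x₁) x₀ (z ∷ s ∷ [])
                   | eval-takeE O (powE g x₀) x₁ (z ∷ s ∷ [])
                   | eval-dropE O (powE g x₀) x₁ (z ∷ s ∷ [])
                   | length-powE O g x₀ (z ∷ s ∷ [])
                   with H z
    ... | true = refl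
    ... | false = refl

  Σ-Δ∧ : ∀ k {F G} → P^ (Σp k) F → Σp (suc k) G → Σp (suc k) (λ p → F p ∧ G p)
  Σ-Δ∧ k {F} {G} f g with Σ-normal k g
  ... | R , r , d , hR = ΔNP⇒Σ k (Δ-join k f r) (toNPrel (powE d x₀) (cond isTrue (orc (cons true x₀)) (orc (cons false (pairE x₀ x₁))) nil) λ p →
      trans (cong₂ anyBits (length-powE (F ⊕ R) d x₀ (p ∷ [])) refl)
        (trans (anyBits-cong ((2 + length p) ^ d) λ u _ → both p u) (trans (anyBits-∧ ((2 + length p) ^ d) (F p) (λ u → R (pair p u))) (cong (F p ∧_) (hR p)))))
    where
    both : ∀ p u → isT (if F p then R (eval (F ⊕ R) (pairE x₀ x₁) (p ∷ u ∷ [])) ∷ [] else []) ≡ F p ∧ R (pair p u)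
    both p u rewrite eval-pairE (F ⊕ R) x₀ x₁ (p ∷ u ∷ []) with F p
    ... | true = refl
    ... | false = refl

  -- With F = ∃y R, the conjunction is ∃y (R ∧ G), so closure under quantification reduces it to a
  -- conjunction with a set in Δ. The disjunct of `Σ-∃` is set to false.
  Σ-∧ : ∀ k {F G} → Σp (suc k) F → Σp (suc k) G → Σp (suc k) (λ p → F p ∧ G p)
  Σ-∧ k {F} {G} f g with Σ-normal k f
  ... | R , r , d , hR = Σ-ext k
      (λ z → trans (anyBits-cong ((2 + length z) ^ d) λ y _ → trans (cong₂ (λ v w → R (pair v w) ∧ G v) (snd-pair y z) (fst-pair y z)) (∧-comm (R (pair z y)) (G z)))
        (trans (anyBits-∧ ((2 + length z) ^ d) (G z) (λ y → R (pair z y))) (trans (∧-comm (G z) _) (cong (_∧ G z) (hR z)))))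
      (Σ-∃ k d (Σ-Δ∧ k (Δ-reduce k (red-pair (red-snd red-id) (red-fst red-id)) r) (Σ-reduce k (red-snd red-id) g)) (Δ-bool k (λ _ _ → false) r r))

-- The difference hierarchy

anyBits-guarded : ∀ n (G B : Str → Bool) v y → length y ≡ n → G y ≡ true → (∀ y → length y ≡ n → G y ≡ true → B y ≡ v) →
  anyBits n (λ y → G y ∧ B y) ≡ v
anyBits-guarded n G B true y ly gy h = subst (λ n → anyBits n (λ y → G y ∧ B y) ≡ true) ly
  (anyBits-intro (λ y → G y ∧ B y) y (cong₂ _∧_ gy (h y ly gy)))
anyBits-guarded n G B false y ly gy h = anyBits-false n _ λ y' l → cases y' l (G y') refl
  where
  cases : ∀ y' → length y' ≡ n → ∀ b → G y' ≡ b → G y' ∧ B y' ≡ false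
  cases y' l true e = trans (cong (_∧ B y') e) (h y' l e)
  cases y' l false e = cong (_∧ B y') e

-- D agrees with H where the guard G holds for no y, and with the common value
-- of B over all y satisfying the guard elsewhere.
Selects : ℕ → (G H B D : Language) → Set
Selects g G H B D = ∀ z →
  ((∀ y → length y ≡ (2 + length z) ^ g → G (pair y z) ≡ false) → D z ≡ H z) ×
  (H z ≡ false → ∀ v y → length y ≡ (2 + length z) ^ g → G (pair y z) ≡ true →
    (∀ y → length y ≡ (2 + length z) ^ g → G (pair y z) ≡ true → B (pair y z) ≡ v) → D z ≡ v)

-- Guarding the remaining differences by G ∧ L₁ makes the number of sets of the
-- chain hit by some guarded y have the parity common to all of them.
DIFF-∃ : ∀ m k g {G H B} → Σp (suc k) G → P^ (Σp k) H → DIFF (suc m) (Σp (suc k)) B →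
  Σ Language λ D → DIFF (suc m) (Σp (suc k)) D × Selects g G H B D
DIFF-∃ zero k g {G} {H} {B} sG dH sB =
  (λ z → H z ∨ anyBits ((2 + length z) ^ g) (λ y → G (pair y z) ∧ B (pair y z))) , Σ-∃ k g (Σ-∧ k sG sB) dH , λ z →
    (λ none → trans (cong (H z ∨_) (anyBits-false _ _ λ y l → cong (_∧ B (pair y z)) (none y l))) (∨-identityʳ (H z))) ,
    λ h v y ly gy all → trans (cong (_∨ _) h) (anyBits-guarded _ (λ y → G (pair y z)) (λ y → B (pair y z)) v y ly gy all)
DIFF-∃ (suc m) k g {G} {H} {B} sG dH (B₁ , B₂ , s₁ , s₂ , hB)
  -- Below the top set the alternative is the constant false: H enters through `D₁` alone, and `D₂`
  -- vanishes wherever the guard is empty.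
  with DIFF-∃ m k g (Σ-∧ k sG s₁) (Δ-bool k (λ _ _ → false) dH dH) s₂
... | D₂ , p₂ , sel₂ = (λ z → D₁ z ∧ not (D₂ z)) , (D₁ , D₂ , Σ-∃ k g (Σ-∧ k sG s₁) dH , p₂ , λ z → refl) , sel
  where
  guard : Str → Str → Bool
  guard z y = G (pair y z) ∧ B₁ (pair y z)
  D₁ : Language
  D₁ z = H z ∨ anyBits ((2 + length z) ^ g) (guard z)
  sel : Selects g G H B (λ z → D₁ z ∧ not (D₂ z))
  sel z .proj₁ h = trans (cong₂ (λ a b → (H z ∨ a) ∧ not b) (anyBits-false _ _ off) (proj₁ (sel₂ z) off)) (simplify (H z))
    where
    off : ∀ y → length y ≡ (2 + length z) ^ g → guard z y ≡ false
    off y l = cong (_∧ B₁ (pair y z)) (h y l)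
    simplify : ∀ b → (b ∨ false) ∧ true ≡ b
    simplify true = refl
    simplify false = refl
  sel z .proj₂ h v y ly gy all = cases (anyBits ((2 + length z) ^ g) (guard z)) refl
    where
    flipped : ∀ a b → a ∧ not b ≡ v → a ≡ true → b ≡ not v
    flipped true true e refl = cong not e
    flipped true false e refl = cong not e
    restore : ∀ v → true ∧ not (not v) ≡ v
    restore true = refl
    restore false = refl
    both : ∀ {a b} → a ∧ b ≡ true → a ≡ true × b ≡ true
    both {true} {true} e = refl , refl
    cases : ∀ b → anyBits ((2 + length z) ^ g) (guard z) ≡ b → D₁ z ∧ not (D₂ z) ≡ v
    -- Some guarded y lies in `B₁`, so `D₁` holds. On all y guarded by both G and `B₁`, membership
    -- in `B₂` has the constant value `not v`, and the recursion supplies that value for `D₂`.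
    cases true e with anyBits-elim _ (guard z) e
    ... | y₁ , l₁ , q₁ = trans (cong₂ (λ a b → a ∧ not b) (trans (cong (H z ∨_) e) (trans (cong (_∨ true) h) refl))
            (proj₂ (sel₂ z) refl (not v) y₁ l₁ q₁ λ y' l' q' →
              flipped (B₁ (pair y' z)) (B₂ (pair y' z)) (trans (sym (hB (pair y' z))) (all y' l' (proj₁ (both q')))) (proj₂ (both {G (pair y' z)} q'))))
            (restore v)
    -- No guarded y lies in `B₁`, so B is false on all of them; hence v is false, and so is `D₁`.
    cases false e = trans (cong (_∧ not (D₂ z)) (trans (cong (H z ∨_) e) (cong (_∨ false) h)))
        (sym (trans (sym (all y ly gy)) (trans (hB (pair y z)) (cong (_∧ not (B₂ (pair y z))) (missed (B₁ (pair y z)) refl)))))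
      where
      missed : ∀ b → B₁ (pair y z) ≡ b → B₁ (pair y z) ≡ false
      missed false e₁ = e₁
      missed true e₁ with () ← trans (sym e) (subst (λ n → anyBits n (guard z) ≡ true) ly (anyBits-intro (guard z) y (cong₂ _∧_ gy e₁)))

-- Self-reducible witness search

isPos : ℕ → Bool
isPos zero = false
isPos (suc _) = true

head-drop : ∀ a n → isJust (head (drop a (replicate n true))) ≡ isPos (n ∸ a)
head-drop zero zero = refl
head-drop zero (suc n) = refl
head-drop (suc a) zero = refl
head-drop (suc a) (suc n) = head-drop a n

powE-replicate : ∀ {n} A d (e : Exp n) env → eval A (powE d e) env ≡ replicate ((2 + length (eval A e env)) ^ d) true
powE-replicate A zero e env = refl
powE-replicate A (suc d) e env = cong (λ n → replicate ((2 + length (eval A e env)) * n) true) (length-powE A d e env)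

xorE : ∀ {n} → Exp n → Exp n → Exp n
xorE a b = cond isTrue a (cond isTrue b (cons false nil) (cons true nil)) b

eval-xorE : ∀ {n} A (a b : Exp n) env → isT (eval A (xorE a b) env) ≡ isT (eval A a env) xor isT (eval A b env)
eval-xorE A a b env with isT (eval A a env) | isT (eval A b env) in eq
... | true | true = refl
... | true | false = refl
... | false | _ = eq

xor-false : ∀ {a b} → a xor b ≡ false → a ≡ b
xor-false {true} {true} e = refl
xor-false {false} {false} e = refl

xor-same : ∀ a → a xor a ≡ false
xor-same true = refl
xor-same false = refl

-- For U q = ∃u R⟨q,u⟩ with |u| = N q, search q u says that the reversal of u
-- is the beginning of a witness for q.
module Search (R : Language) (d : ℕ) where
  N : Str → ℕ
  N q = (2 + length q) ^ d

  -- Keeping u reversed makes the extension of a partial witness a cons. When u has reached full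
  -- length, only the test of R remains.
  search : Str → Str → Bool
  search q u = anyBits (N q ∸ length u) (λ v → R (pair q (u ʳ++ v)))

  T : Language
  T w = search (fst w) (snd w)

  T-pair : ∀ q u → T (pair q u) ≡ search q u
  T-pair q u = cong₂ search (fst-pair q u) (snd-pair q u)

  T-NP : NPrel R T
  T-NP = toNPrel (dropE u₁ (powE d (fstE x₀))) (orc (pairE (fstE x₀) (revE (sndE x₀) x₁))) λ w →
    trans (cong₂ anyBits (len w) refl) (anyBits-cong (N (fst w) ∸ length (snd w)) λ v _ → query w v)
    where
    u₁ : Exp 1
    u₁ = sndE x₀
    len : ∀ w → length (eval R (dropE u₁ (powE d (fstE x₀))) (w ∷ [])) ≡ N (fst w) ∸ length (snd w)
    len w = trans (cong length (eval-dropE R u₁ (powE d (fstE x₀)) (w ∷ [])))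
      (trans (length-drop (length (eval R u₁ (w ∷ []))) (eval R (powE d (fstE x₀)) (w ∷ [])))
        (cong₂ _∸_ (trans (length-powE R d (fstE x₀) (w ∷ [])) (cong N (eval-fstE R x₀ (w ∷ []))))
                   (cong length (eval-sndE R x₀ (w ∷ [])))))
    query : ∀ w v → R (eval R (pairE (fstE x₀) (revE (sndE x₀) x₁)) (w ∷ v ∷ [])) ≡ R (pair (fst w) (snd w ʳ++ v))
    query w v = cong R (trans (eval-pairE R (fstE x₀) (revE (sndE x₀) x₁) (w ∷ v ∷ []))
      (cong₂ pair (eval-fstE R x₀ (w ∷ v ∷ [])) (trans (eval-revE R (sndE x₀) x₁ (w ∷ v ∷ [])) (cong (_ʳ++ v) (eval-sndE R x₀ (w ∷ v ∷ []))))))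

  -- One step of the self-reduction with a candidate `a` in place of T, which is a fixed point of
  -- it. The leaf case consults R: without it, an `a` that is false everywhere would count as
  -- consistent.
  expand : (Str → Bool) → Str → Str → Bool
  expand a q u = if isPos (N q ∸ length u) then a (pair q (false ∷ u)) ∨ a (pair q (true ∷ u)) else R (pair q (u ʳ++ []))

  pred-∸ : ∀ a b {n} → a ∸ b ≡ suc n → a ∸ suc b ≡ n
  pred-∸ a b e = trans (sym (pred[m∸n]≡m∸[1+n] a b)) (cong Data.Nat.pred e)

  search-expand : ∀ q u → T (pair q u) ≡ expand T q u
  search-expand q u = trans (T-pair q u) (cases (N q ∸ length u) refl)
    where
    cases : ∀ n → N q ∸ length u ≡ n → anyBits (N q ∸ length u) (λ v → R (pair q (u ʳ++ v))) ≡ expand T q u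
    cases zero e rewrite e = refl
    cases (suc n) e rewrite T-pair q (false ∷ u) | T-pair q (true ∷ u) | pred-∸ (N q) (length u) e | e = refl

  module _ (A : Language) where
    inconsistent : Str → Str → Str → Bool
    inconsistent z q u = A (pair (pair q u) z) xor expand (λ w → A (pair w z)) q u

    -- Induction on the number n of missing bits, from the leaves, where R decides, up to shorter
    -- partial witnesses.
    consistent⇒correct : ∀ z q → (∀ u → length u ≤ N q → inconsistent z q u ≡ false) →
      ∀ n u → N q ∸ length u ≡ n → length u ≤ N q → A (pair (pair q u) z) ≡ T (pair q u)
    consistent⇒correct z q h n u e l = trans (xor-false (h u l)) (trans (cases n e) (sym (search-expand q u)))
      where
      cases : ∀ n → N q ∸ length u ≡ n → expand (λ w → A (pair w z)) q u ≡ expand T q u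
      cases zero e rewrite e = refl
      cases (suc n) e = trans (cong (λ k → if isPos k then A (pair (pair q (false ∷ u)) z) ∨ A (pair (pair q (true ∷ u)) z) else R (pair q (u ʳ++ []))) e)
        (trans (cong₂ _∨_ (child false) (child true))
          (cong (λ k → if isPos k then T (pair q (false ∷ u)) ∨ T (pair q (true ∷ u)) else R (pair q (u ʳ++ []))) (sym e)))
        where
        child : ∀ b → A (pair (pair q (b ∷ u)) z) ≡ T (pair q (b ∷ u))
        child b = consistent⇒correct z q h n (b ∷ u) (pred-∸ (N q) (length u) e)
          (m∸n≢0⇒n<m (λ z → case-absurd (trans (sym e) z)))
          where
          case-absurd : suc n ≢ 0
          case-absurd ()

    wrong : Str → Str → Bool
    wrong z w = A (pair w z) xor T w

    -- T satisfies its own expansion, so if A agreed with T at the node and at both children, the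
    -- node would be consistent. Hence one of these three strings is an error.
    find-wrong : ∀ z q u → inconsistent z q u ≡ true → ∃ λ w → length w ≤ 2 * length q + (2 + length u) × wrong z w ≡ true
    find-wrong z q u h = cases (wrong z (pair q u)) refl (wrong z (pair q (false ∷ u))) refl (wrong z (pair q (true ∷ u))) refl
      where
      short : ∀ b → length (pair q (b ∷ u)) ≤ 2 * length q + (2 + length u)
      short b = ≤-reflexive (length-pair q (b ∷ u))
      cases : ∀ a → wrong z (pair q u) ≡ a → ∀ b → wrong z (pair q (false ∷ u)) ≡ b → ∀ c → wrong z (pair q (true ∷ u)) ≡ c →
        ∃ λ w → length w ≤ 2 * length q + (2 + length u) × wrong z w ≡ true
      cases true e _ _ _ _ = pair q u , ≤-trans (≤-reflexive (length-pair q u)) (+-monoʳ-≤ (2 * length q) (n≤1+n _)) , e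
      cases false _ true e _ _ = pair q (false ∷ u) , short false , e
      cases false _ false _ true e = pair q (true ∷ u) , short true , e
      cases false e₀ false e₁ false e₂ with () ← trans (sym h) (trans (cong₂ _xor_ (xor-false {A (pair (pair q u) z)} {T (pair q u)} e₀)
          (cong₂ (λ a b → if isPos (N q ∸ length u) then a ∨ b else R (pair q (u ʳ++ []))) (xor-false {A (pair (pair q (false ∷ u)) z)} {T (pair q (false ∷ u))} e₁) (xor-false {A (pair (pair q (true ∷ u)) z)} {T (pair q (true ∷ u))} e₂)))
        (trans (cong (_xor expand T q u) (search-expand q u)) (xor-same (expand T q u))))

    -- y is read as ⟨q,⟨u,pad⟩⟩; the ignored third component lets strings of one exact length cover
    -- all shorter pairs q, u.
    Inconsistent : ℕ → Language
    Inconsistent e z = anyBits ((2 + length z) ^ e) (λ y → inconsistent z (fst y) (fst (snd y)))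

    Inconsistent-NP : ∀ e → NPrel (A ⊕ R) (Inconsistent e)
    Inconsistent-NP e = toNPrel (powE e x₀) (xorE (posed (pairE q u)) expanded) λ z →
      trans (cong₂ anyBits (length-powE O e x₀ (z ∷ [])) refl) (anyBits-cong ((2 + length z) ^ e) λ y _ → correct z y)
      where
      O = A ⊕ R
      q u leaf expanded : Exp 2
      q = fstE x₁
      u = fstE (sndE x₁)
      posed : Exp 2 → Exp 2
      posed w = orc (cons true (pairE w x₀))
      leaf = orc (cons false (pairE q (revE u nil)))
      expanded = cond isJust (dropE u (powE d q)) (cond isTrue (posed (pairE q (cons false u))) (cons true nil) (posed (pairE q (cons true u)))) leaf
      correct : ∀ z y → isT (eval O (xorE (posed (pairE q u)) expanded) (z ∷ y ∷ []))
        ≡ inconsistent z (fst y) (fst (snd y))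
      correct z y = trans (eval-xorE O (posed (pairE q u)) expanded env) (cong₂ _xor_ (asked u u≡) rest)
        where
        env : Vec Str 2
        env = z ∷ y ∷ []
        q≡ : eval O q env ≡ fst y
        q≡ = eval-fstE O x₁ env
        u≡ : eval O u env ≡ fst (snd y)
        u≡ = trans (eval-fstE O (sndE x₁) env) (cong fst (eval-sndE O x₁ env))
        asked : ∀ v {v'} → eval O v env ≡ v' → A (eval O (pairE (pairE q v) x₀) env) ≡ A (pair (pair (fst y) v') z)
        asked v h = cong A (trans (eval-pairE O (pairE q v) x₀ env) (cong (λ w → pair w z) (trans (eval-pairE O q v env) (cong₂ pair q≡ h))))
        test≡ : isJust (head (eval O (dropE u (powE d q)) env)) ≡ isPos (N (fst y) ∸ length (fst (snd y)))
        test≡ = trans (cong (isJust ∘ head) (trans (eval-dropE O u (powE d q) env)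
            (cong₂ (λ v w → drop (length v) w) u≡ (trans (powE-replicate O d q env) (cong (λ w → replicate (N w) true) q≡)))))
          (head-drop (length (fst (snd y))) (N (fst y)))
        leaf≡ : R (eval O (pairE q (revE u nil)) env) ≡ R (pair (fst y) (fst (snd y) ʳ++ []))
        leaf≡ = cong R (trans (eval-pairE O q (revE u nil) env) (cong₂ pair q≡ (trans (eval-revE O u nil env) (cong (_ʳ++ []) u≡))))
        or : ∀ a b → isT (if a then true ∷ [] else (b ∷ [])) ≡ a ∨ b
        or true b = refl
        or false b = refl
        rest : isT (eval O expanded env)
          ≡ expand (λ w → A (pair w z)) (fst y) (fst (snd y))
        rest rewrite test≡ with isPos (N (fst y) ∸ length (fst (snd y)))
        ... | true = trans (or (A (eval O (pairE (pairE q (cons false u)) x₀) env)) (A (eval O (pairE (pairE q (cons true u)) x₀) env))) (cong₂ _∨_ (asked (cons false u) (cong (false ∷_) u≡)) (asked (cons true u) (cong (true ∷_) u≡)))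
        ... | false = leaf≡

-- Complementation in the difference hierarchy

complement : ∀ m i d → (Δp (suc i) 𝚫 DIFF (suc m) (Σp (suc (suc d + i)))) ≐ (Σp (suc i) 𝚫 DIFF (suc m) (Σp (suc (suc d + i)))) →
  ∀ L → DIFF (suc m) (Σp (suc (suc d + i))) L → DIFF (suc m) (Σp (suc (suc d + i))) (λ x → not (L x))
complement m i s hyp L diffL = conclude (lower-DIFF m i s diffL)
  where
  -- In terms of the theorem, its i is `suc i`, its k is `suc k`, and s = k - i - 1 there; this
  -- encodes 0 < i < k.
  k = suc s + i

  conclude : Lowers i (P^ (Σp k)) L → DIFF (suc m) (Σp (suc k)) (λ x → not (L x))
  conclude (U , u , c , low) = search (Σ-normal i u)
    where
    search : (Σ Language λ R → P^ (Σp i) R × Σ ℕ λ d → ∀ x → anyBits ((2 + length x) ^ d) (λ v → R (pair x v)) ≡ U x) →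
      DIFF (suc m) (Σp (suc k)) (λ x → not (L x))
    search (R , r , d , hU) = split (proj₂ (hyp (λ p → T (fst p) xor L (snd p)))
        ((λ p → T (fst p)) , (λ p → L (snd p)) , Σ-reduce i (red-fst red-id) T∈Σ , DIFF-reduce m k (red-snd red-id) diffL , λ p → refl))
      where
      open Search R d using (N; T; T-pair; T-NP)
      T∈Σ : Σp (suc i) T
      T∈Σ = ΔNP⇒Σ i r T-NP

      split : (Δp (suc i) 𝚫 DIFF (suc m) (Σp (suc k))) (λ p → T (fst p) xor L (snd p)) → DIFF (suc m) (Σp (suc k)) (λ x → not (L x))
      split (A , B , a , b , hAB) = assemble (low A' (Δ-reduce i (red-pair (red-pair (red-fst red-id) red-nil) (red-snd red-id)) a))
        where
        open Search R d using (inconsistent; wrong)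
        -- With the empty partial witness T⟨q,[]⟩ is U q, so these values of A form the candidate
        -- for U.
        A' : Language
        A' p = A (pair (pair (fst p) []) (snd p))

        -- The length of ⟨q,⟨u,[]⟩⟩ for the longest q that the lowered tower asks about and the
        -- longest u to be checked for it, namely `N q`.
        maxPair : ℕ → ℕ
        maxPair n = 2 * (2 + n) ^ c + suc (2 * (2 + (2 + n) ^ c) ^ d + 1)
        maxPair-poly : PolyBounded maxPair
        maxPair-poly = poly-+ (poly-* (poly-const 2) q-poly) (poly-+ (poly-const 1) (poly-+ (poly-* (poly-const 2)
          (poly-∘ {λ n → (2 + n) ^ d} {λ n → (2 + n) ^ c} (d , λ n → ≤-refl) q-poly)) (poly-const 1)))
          where
          q-poly : PolyBounded (λ n → (2 + n) ^ c)
          q-poly = c , λ n → ≤-refl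
        e : ℕ
        e = proj₁ maxPair-poly

        E : Language
        E = Search.Inconsistent R d A e

        -- An inconsistency found in a string y yields an error w of length at most 3|y| + 2, and
        -- ⟨w,[]⟩ has length 2|w| + 1.
        maxWrong : ℕ → ℕ
        maxWrong n = 2 * (3 * (2 + n) ^ e + 2) + 1
        maxWrong-poly : PolyBounded maxWrong
        maxWrong-poly = poly-+ (poly-* (poly-const 2) (poly-+ (poly-* (poly-const 3) (e , λ n → ≤-refl)) (poly-const 2))) (poly-const 1)
        g : ℕ
        g = proj₁ maxWrong-poly

        E∈Δ : P^ (Σp k) E
        E∈Δ = lift i s (ΔNP⇒Σ i (Δ-join i a r) (Search.Inconsistent-NP R d A e))

        -- y is read as ⟨w,pad⟩ with w an error of A. The factor `E (snd p)` empties the guard at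
        -- consistent z: there A may still err on strings beyond the tested length, but the value
        -- has to come from H.
        G : Language
        G p = E (snd p) ∧ (A (pair (fst (fst p)) (snd p)) xor T (fst (fst p)))

        G∈Σ : Σp (suc k) G
        G∈Σ = Δ⇒Σ k (Δ-bool k _∧_ (Δ-reduce k (red-snd red-id) E∈Δ)
          (Δ-bool k _xor_ (Δ-reduce k (red-pair (red-fst (red-fst red-id)) (red-snd red-id)) (lift i s (Δ⇒Σ i a)))
                          (Δ-reduce k (red-fst (red-fst red-id)) (lift i s T∈Σ))))

        G-pair : ∀ y z → G (pair y z) ≡ E z ∧ wrong A z (fst y)
        G-pair y z = cong₂ (λ v w → E w ∧ (A (pair (fst v) w) xor T (fst v))) (fst-pair y z) (snd-pair y z)

        -- All quantifiers range over a single length; the second component of a pair fills up any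
        -- difference from the minimum 2|w| + 1.
        padded : ∀ n w → 2 * length w + 1 ≤ n → ∃ λ pad → length (pair w pad) ≡ n
        padded n w l = replicate (n ∸ (2 * length w + 1)) false ,
          trans (length-pair w _) (trans (cong (λ k → 2 * length w + suc k) (length-replicate (n ∸ (2 * length w + 1))))
            (trans (sym (+-assoc (2 * length w) 1 _)) (m+[n∸m]≡n l)))

        -- Any inconsistency at q and some u of length at most `N q` could be padded to a string
        -- counted by `E z`. So there is none, and correctness reaches the root, where u is empty.
        hard⇒correct : ∀ z → E z ≡ false → ∀ q → length q ≤ (2 + length z) ^ c → A' (pair q z) ≡ U q
        hard⇒correct z hE q lq = trans (cong₂ (λ v w → A (pair (pair v []) w)) (fst-pair q z) (snd-pair q z))
          (trans (Search.consistent⇒correct R d A z q consistent (N q) [] refl z≤n) (trans (T-pair q []) (hU q)))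
          where
          consistent : ∀ u → length u ≤ N q → inconsistent A z q u ≡ false
          consistent u lu = check (padded (D ∸ (2 * length q + 1)) u room)
            where
            D : ℕ
            D = (2 + length z) ^ e
            fits : 2 * length q + suc (2 * length u + 1) ≤ D
            fits = ≤-trans (+-mono-≤ (*-monoʳ-≤ 2 lq) (s≤s (+-monoˡ-≤ 1 (*-monoʳ-≤ 2 (≤-trans lu (^-monoˡ-≤ d (+-monoʳ-≤ 2 lq)))))))
              (proj₂ maxPair-poly (length z))
            regroup : ∀ a b → a + suc (b + 1) ≡ a + 1 + (b + 1)
            regroup = solve-∀
            fits' : 2 * length q + 1 + (2 * length u + 1) ≤ D
            fits' = ≤-trans (≤-reflexive (sym (regroup (2 * length q) (2 * length u)))) fits
            room : 2 * length u + 1 ≤ D ∸ (2 * length q + 1)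
            room = ≤-trans (≤-reflexive (sym (m+n∸m≡n (2 * length q + 1) _))) (∸-monoˡ-≤ (2 * length q + 1) fits')
            check : (∃ λ pad → length (pair u pad) ≡ D ∸ (2 * length q + 1)) → inconsistent A z q u ≡ false
            check (pad , lp) = Bool-false λ found → subst (λ n → anyBits n test ≡ true) ly (anyBits-intro test y (trans test≡ found))
              where
              y : Str
              y = pair q (pair u pad)
              test : Str → Bool
              test y = inconsistent A z (fst y) (fst (snd y))
              ly : length y ≡ D
              ly = trans (length-pair q (pair u pad)) (trans (cong (λ n → 2 * length q + suc n) lp)
                (trans (sym (+-assoc (2 * length q) 1 _)) (m+[n∸m]≡n (m+n≤o⇒m≤o (2 * length q + 1) fits'))))
              test≡ : test y ≡ inconsistent A z q u
              test≡ = cong₂ (inconsistent A z) (fst-pair q (pair u pad)) (trans (cong fst (snd-pair q (pair u pad))) (fst-pair u pad))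
              Bool-false : ∀ {b} → (b ≡ true → E z ≡ true) → b ≡ false
              Bool-false {true} f with () ← trans (sym hE) (f refl)
              Bool-false {false} f = refl

        easy⇒wrong : ∀ z → E z ≡ true → ∃ λ y → length y ≡ (2 + length z) ^ g × wrong A z (fst y) ≡ true
        easy⇒wrong z hE with anyBits-elim ((2 + length z) ^ e) _ hE
        ... | y₀ , l₀ , bad with Search.find-wrong R d A z (fst y₀) (fst (snd y₀)) bad
        ...   | w , lw , isWrong with padded ((2 + length z) ^ g) w fits
          where
          lengths : ∀ a → 2 * a + (2 + a) ≡ 3 * a + 2
          lengths = solve-∀
          fits : 2 * length w + 1 ≤ (2 + length z) ^ g
          fits = ≤-trans (+-monoˡ-≤ 1 (*-monoʳ-≤ 2 (≤-trans lw (≤-trans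
              (+-mono-≤ (*-monoʳ-≤ 2 (length-fst y₀)) (s≤s (s≤s (≤-trans (length-fst (snd y₀)) (length-snd y₀)))))
              (≤-reflexive (trans (lengths (length y₀)) (cong (λ n → 3 * n + 2) l₀)))))))
            (proj₂ maxWrong-poly (length z))
        ...     | pad , lp = pair w pad , lp , trans (cong (wrong A z) (fst-pair w pad)) isWrong

        flip-wrong : ∀ a t l b → t xor l ≡ a xor b → a xor t ≡ true → b ≡ not l
        flip-wrong true false l b e h = helper b (trans (sym (cong (λ x → x) e)) refl)
          where
          helper : ∀ b → not b ≡ l → b ≡ not l
          helper true refl = refl
          helper false refl = refl
        flip-wrong false true l b e h = sym e

        assemble : (Σ Language λ V → P^ (Σp k) V × (∀ x z → (∀ q → length q ≤ (2 + length x) ^ c → A' (pair q z) ≡ U q) → V (pair x z) ≡ L x)) →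
          DIFF (suc m) (Σp (suc k)) (λ x → not (L x))
        assemble (V , v , correct) = select (DIFF-∃ m k g {G} {H} {B'} G∈Σ
            (Δ-bool k (λ a b → not a ∧ not b) E∈Δ (Δ-reduce k (red-pair red-id red-id) v))
            (DIFF-reduce m k (red-pair (red-fst (red-fst red-id)) (red-snd red-id)) b))
          where
          H B' : Language
          -- V receives z twice, as the input and as the parameter that selects the slice of A. The
          -- factor `not (E z)` makes H false at inconsistent z, as the second clause of `Selects`
          -- requires.
          H z = not (E z) ∧ not (V (pair z z))
          B' p = B (pair (fst (fst p)) (snd p))
          select : (Σ Language λ D → DIFF (suc m) (Σp (suc k)) D × Selects g G H B' D) → DIFF (suc m) (Σp (suc k)) (λ x → not (L x))
          select (D , diffD , sel) = DIFF-ext m k (λ z → decide z (E z) refl) diffD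
            where
            opposite : ∀ z → E z ≡ true → ∀ y → G (pair y z) ≡ true → B' (pair y z) ≡ not (L z)
            opposite z hE y gy = trans (cong₂ (λ v w → B (pair (fst v) w)) (fst-pair y z) (snd-pair y z))
              (flip-wrong (A (pair (fst y) z)) (T (fst y)) (L z) (B (pair (fst y) z))
                (trans (sym (cong₂ (λ v w → T v xor L w) (fst-pair (fst y) z) (snd-pair (fst y) z))) (hAB (pair (fst y) z)))
                (trans (cong (_∧ wrong A z (fst y)) (sym hE)) (trans (sym (G-pair y z)) gy)))
            easy : ∀ z → E z ≡ true → (∃ λ y → length y ≡ (2 + length z) ^ g × wrong A z (fst y) ≡ true) → D z ≡ not (L z)
            easy z hE (y₀ , l₀ , w₀) = proj₂ (sel z) (cong (λ a → not a ∧ not (V (pair z z))) hE) (not (L z)) y₀ l₀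
              (trans (G-pair y₀ z) (cong₂ _∧_ hE w₀)) λ y _ gy → opposite z hE y gy
            decide : ∀ z b → E z ≡ b → D z ≡ not (L z)
            decide z false hE = trans (proj₁ (sel z) λ y _ → trans (G-pair y z) (cong (_∧ wrong A z (fst y)) hE))
              (cong₂ (λ a b → not a ∧ not b) hE (correct z z (hard⇒correct z hE)))
            decide z true hE = easy z hE (easy⇒wrong z hE)

theorem2p3 : (m i k : ℕ) → 0 < m → 0 < i → i < k →
    (Δp i 𝚫 DIFF m (Σp k)) ≐ (Σp i 𝚫 DIFF m (Σp k)) →
    DIFF m (Σp k) ≐ coDIFF m (Σp k)
theorem2p3 (suc m) (suc i) (suc k) _ _ (s≤s i<k) =
  let (d , i+d≡k) = m≤n⇒∃[o]m+o≡n i<k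
  in subst (λ k → (Δp (suc i) 𝚫 DIFF (suc m) (Σp (suc k))) ≐ (Σp (suc i) 𝚫 DIFF (suc m) (Σp (suc k))) →
                  DIFF (suc m) (Σp (suc k)) ≐ coDIFF (suc m) (Σp (suc k)))
       (trans (cong suc (+-comm d i)) i+d≡k)
       λ hyp L → complement m i d hyp L , λ p →
         DIFF-ext m (suc d + i) (λ x → not-involutive (L x)) (complement m i d hyp (λ x → not (L x)) p)
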